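{- There exists a constant $C_u > 0$ such that for all positive integers $l,r$, $$c_\infty(lK_r) \leq lr + C_u\frac{r\log r}{l}.$$
   Context: All graphs are finite and simple. $K_r$ is the complete graph on $r$ vertices and $lK_r$ the disjoint union of $l$ copies of $K_r$. A graph $H$ is a minor of $G$ if a graph isomorphic to $H$ can be obtained from a subgraph of $G$ by contracting edges. For a non-null graph $G$, $d(G)=e(G)/v(G)$. For a graph $H$, $c_\infty(H)=\lim_{n\to\infty}\max d(G)$, the maximum over all graphs $G$ on $n$ vertices not containing $H$ as a minor. $\log$ is the natural logarithm. -}

module Defs where

open import Data.Nat using (ℕ; zero; suc; _+_; _*_; _<ᵇ_; _≡ᵇ_; NonZero)
open import Data.Nat.DivMod using (_/_)
open import Data.Bool using (Bool; true; false; _∧_; not; if_then_else_)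
open import Data.Fin using (Fin; toℕ)
open import Data.List using (List; []; _∷_; map; allFin)
open import Data.Nat.ListAction using (sum)
open import Data.Maybe using (Maybe; just; nothing)
open import Data.Product using (Σ; _×_; ∃; ∃-syntax)
open import Relation.Binary.PropositionalEquality using (_≡_; refl; cong₂)

record Graph (n : ℕ) : Set where
  field
    adj    : Fin n → Fin n → Bool
    sym    : ∀ i j → adj i j ≡ adj j i
    irrefl : ∀ i → adj i i ≡ false
open Graph public

edgeCount : ∀ {n} → Graph n → ℕ
edgeCount {n} G =
  sum (map (λ i → sum (map (λ j → if (toℕ i <ᵇ toℕ j) ∧ adj G i j then 1 else 0)
                           (allFin n)))
           (allFin n))

data WalkIn {n : ℕ} (G : Graph n) (P : Fin n → Set) : Fin n → Fin n → Set where
  here : ∀ {u} → P u → WalkIn G P u u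
  step : ∀ {u w v} → P u → adj G u w ≡ true → WalkIn G P w v → WalkIn G P u v

-- H is a minor of G, via a minor model: each vertex of G is assigned to at
-- most one branch set (φ v = just a means v ∈ B_a); so branch sets are
-- pairwise disjoint. Each branch set is nonempty and induces a connected
-- subgraph of G, and adjacent vertices of H have an edge of G between
-- their branch sets.
record MinorModel {m n : ℕ} (H : Graph m) (G : Graph n) : Set where
  field
    φ         : Fin n → Maybe (Fin m)
    nonempty  : ∀ a → ∃[ v ] (φ v ≡ just a)
    connected : ∀ a u v → φ u ≡ just a → φ v ≡ just a →
                WalkIn G (λ w → φ w ≡ just a) u v
    edges     : ∀ a b → adj H a b ≡ true →
                ∃[ u ] ∃[ v ] (φ u ≡ just a × φ v ≡ just b × adj G u v ≡ true)

IsMinor : ∀ {m n} → Graph m → Graph n → Set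
IsMinor H G = MinorModel H G

-- lK_r on vertex set Fin (l * r): vertex i lies in copy ⌊i / r⌋;
-- distinct vertices are adjacent iff they lie in the same copy.
lKr-adj : (l r : ℕ) .{{_ : NonZero r}} → Fin (l * r) → Fin (l * r) → Bool
lKr-adj l r i j = not (toℕ i ≡ᵇ toℕ j) ∧ ((toℕ i / r) ≡ᵇ (toℕ j / r))

≡ᵇ-sym : ∀ a b → (a ≡ᵇ b) ≡ (b ≡ᵇ a)
≡ᵇ-sym zero zero = refl
≡ᵇ-sym zero (suc b) = refl
≡ᵇ-sym (suc a) zero = refl
≡ᵇ-sym (suc a) (suc b) = ≡ᵇ-sym a b

≡ᵇ-refl : ∀ a → (a ≡ᵇ a) ≡ true
≡ᵇ-refl zero = refl
≡ᵇ-refl (suc a) = ≡ᵇ-refl a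

lK : (l r : ℕ) .{{_ : NonZero r}} → Graph (l * r)
lK l r = record
  { adj    = lKr-adj l r
  ; sym    = λ i j → cong₂ (λ x y → not x ∧ y) (≡ᵇ-sym (toℕ i) (toℕ j))
                                               (≡ᵇ-sym (toℕ i / r) (toℕ j / r))
  ; irrefl = λ i → irr (toℕ i)
  }
  where
  irr : ∀ a → (not (a ≡ᵇ a) ∧ ((a / r) ≡ᵇ (a / r))) ≡ false
  irr a rewrite ≡ᵇ-refl a = refl

module Submission where

-- Write γ = lr + ⌊c₀ r λ / l⌋ with λ = ⌊log₂ r⌋; every large graph with at least γ n edges is shown to have an lK_r minor
-- (for r = 1 any l vertices do).
--
-- Contracting edges with few common neighbours and deleting vertices of small degree makes the graph irreducible: adjacent
-- vertices have at least β = γ − 1 common neighbours.  By a descent on the density starting from Mader's bound, the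
-- density may be assumed to be below β + 2.  Let S be the vertices above a well chosen degree threshold.  Among the other
-- vertices many have disjoint neighbourhoods outside S of size at most about 2 (β − |N(v) ∩ S|); contracting some of them
-- into S and a pigeonhole argument (after Eppstein) produce l of them with the same neighbourhood in S, a clique.
--
-- So let S be a clique of size β − d and let J₁, …, J_l be disjoint sets of at most 8 d vertices, each vertex having at least
-- d neighbours in its own J and missing at most 7 d vertices of S.  Either |S| ≥ l (r − 1), or d ≥ l and d l ≥ c₀ r λ.
-- In the second case an expanding part V of J contains about 18 d / l disjoint connected sets, of size proportional to l, which
-- pairwise touch and miss few vertices of V (the greedy form of the random choice of Alon, Krivelevich and Sudakov).  Together with
-- vertices of S, each enlarged if d is large by a number of vertices of V proportional to d / r, they form a K_r model, and l pieces use up only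
-- disjoint parts of S.


-- The shape r λ / l of the error comes from one condition. Take a set that dominates all but a
-- fraction 2^(-k) of V and a second one containing about k freely chosen vertices of V: they fail
-- to touch at a rate near 2^(-k²), so about r such sets touch pairwise once k² exceeds a multiple
-- of log r. The room in V allows k ≈ l when about 18 d / l sets are built and k ≈ d / r when all r
-- branch sets lie in V; d l ≥ c₀ r λ makes k² large in both cases. The factor 18 pays for the
-- clique: |S| falls short of l r by about d and at most 14 d of its vertices are useless for a
-- given piece, so the l pieces must together save more than 15 d vertices. The threshold of S
-- resolves a conflict. With degrees below T outside S, a packing yields a constant times |P| / T
-- hubs, and these must far outnumber S, whereas the average degree alone only gives |S| of order
-- |P| / T. Averaging over many powers of two as values of T gains the missing factor. Random
-- choices are replaced by averaging throughout, so that only inequalities between natural numbers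
-- remain.

module Prelude where

  open import Defs public
  open import Data.Bool using (Bool; true; false; _∧_; _∨_; not; if_then_else_) renaming (_≟_ to _≟ᵇ_) public
  open import Data.Empty using (⊥; ⊥-elim) public
  open import Data.Fin using (Fin; zero; suc; _≟_) public
  open import Data.Fin.Properties using (any?) public
  open import Data.Nat hiding (_≟_) public
  open import Data.Nat.DivMod using (m/n*n≤m; m≡m%n+[m/n]*n; m%n<n; m≥n⇒m/n>0; m*n/n≡m; m<n⇒m/n≡0; +-distrib-/-∣ˡ) public
  open import Data.Nat.Properties hiding (_≟_) public
  open import Data.Nat.Tactic.RingSolver using (solve-∀) public
  open import Data.Product using (Σ; ∃; ∃-syntax; _×_; _,_; proj₁; proj₂) public
  open import Data.Sum using (_⊎_; inj₁; inj₂; [_,_]′) public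
  open import Function using (_∘_; case_of_) public
  open import Relation.Binary.PropositionalEquality
    using (_≡_; refl; cong; cong₂; subst; subst₂; trans; module ≡-Reasoning) renaming (sym to ≡-sym) public
  open import Relation.Nullary using (¬_; Dec; yes; no) public
  open import Relation.Nullary.Decidable using (⌊_⌋; _×-dec_; _→-dec_; ¬?) public

-- Finite sums and sizes of decidable subsets.

module Counting where

  open Prelude
  import Algebra.Properties.Semiring.Sum +-*-semiring as ∑

  -- Linear arithmetic by certificate: the hypotheses are added up to A ≤ B.
  linear : ∀ {x y A B} c → A ≤ B → y + A ≡ x + B + c → x ≤ y
  linear {x} {y} {A} {B} c A≤B eq = +-cancelʳ-≤ B x y (begin
    x + B      ≤⟨ m≤m+n (x + B) c ⟩
    x + B + c  ≡⟨ ≡-sym eq ⟩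
    y + A      ≤⟨ +-monoʳ-≤ y A≤B ⟩
    y + B      ∎)
    where open ≤-Reasoning

  infixl 6 _⊕_
  _⊕_ : ∀ {a b c d} → a ≤ b → c ≤ d → a + c ≤ b + d
  _⊕_ = +-mono-≤

  infixr 8 _⊛_
  _⊛_ : ∀ {a b} k → a ≤ b → k * a ≤ k * b
  k ⊛ p = *-monoʳ-≤ k p

  false≢true : ∀ {A : Set} {b} → b ≡ false → b ≡ true → A
  false≢true {b = false} _ ()

  ≢true⇒false : ∀ {b} → ¬ (b ≡ true) → b ≡ false
  ≢true⇒false {false} _ = refl
  ≢true⇒false {true} n = ⊥-elim (n refl)

  bool-ext : ∀ {a b} → (a ≡ true → b ≡ true) → (b ≡ true → a ≡ true) → a ≡ b
  bool-ext {true} f _ = ≡-sym (f refl)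
  bool-ext {false} {true} _ g = g refl
  bool-ext {false} {false} _ _ = refl

  ∧⁻ : ∀ {a b} → a ∧ b ≡ true → a ≡ true × b ≡ true
  ∧⁻ {true} {true} _ = refl , refl

  ∧⁺ : ∀ {a b} → a ≡ true → b ≡ true → a ∧ b ≡ true
  ∧⁺ refl refl = refl

  ∨⁻ : ∀ {a b} → a ∨ b ≡ true → a ≡ true ⊎ b ≡ true
  ∨⁻ {true} _ = inj₁ refl
  ∨⁻ {false} e = inj₂ e

  ∨⁺ˡ : ∀ {a b} → a ≡ true → a ∨ b ≡ true
  ∨⁺ˡ refl = refl

  ∨⁺ʳ : ∀ {a b} → b ≡ true → a ∨ b ≡ true
  ∨⁺ʳ {true} refl = refl
  ∨⁺ʳ {false} refl = refl

  not⁻ : ∀ {a} → not a ≡ true → a ≡ false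
  not⁻ {false} _ = refl

  not⁺ : ∀ {a} → a ≡ false → not a ≡ true
  not⁺ refl = refl

  bool? : ∀ b → b ≡ true ⊎ b ≡ false
  bool? true = inj₁ refl
  bool? false = inj₂ refl

  ⌊⌋⁺ : ∀ {A : Set} (d : Dec A) → A → ⌊ d ⌋ ≡ true
  ⌊⌋⁺ (yes _) _ = refl
  ⌊⌋⁺ (no ¬a) a = ⊥-elim (¬a a)

  ⌊⌋⁻ : ∀ {A : Set} (d : Dec A) → ⌊ d ⌋ ≡ true → A
  ⌊⌋⁻ (yes a) _ = a

  ⌊⌋-false⁺ : ∀ {A : Set} (d : Dec A) → ¬ A → ⌊ d ⌋ ≡ false
  ⌊⌋-false⁺ (yes a) ¬a = ⊥-elim (¬a a)
  ⌊⌋-false⁺ (no _) _ = refl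

  ⌊⌋-false⁻ : ∀ {A : Set} (d : Dec A) → ⌊ d ⌋ ≡ false → ¬ A
  ⌊⌋-false⁻ (no ¬a) _ = ¬a

  𝟙 : Bool → ℕ
  𝟙 true = 1
  𝟙 false = 0

  𝟙≤1 : ∀ b → 𝟙 b ≤ 1
  𝟙≤1 true = ≤-refl
  𝟙≤1 false = z≤n

  𝟙-mono : ∀ {a b} → (a ≡ true → b ≡ true) → 𝟙 a ≤ 𝟙 b
  𝟙-mono {true} h rewrite h refl = ≤-refl
  𝟙-mono {false} h = z≤n

  opaque
    sum : ∀ {n} → (Fin n → ℕ) → ℕ
    sum = ∑.sum

    sum-cong : ∀ {n} {f g : Fin n → ℕ} → (∀ i → f i ≡ g i) → sum f ≡ sum g
    sum-cong = ∑.sum-cong-≗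

    sum-+ : ∀ {n} (f g : Fin n → ℕ) → sum (λ i → f i + g i) ≡ sum f + sum g
    sum-+ = ∑.∑-distrib-+

    sum-comm : ∀ {m n} (f : Fin m → Fin n → ℕ) →
      sum (λ i → sum (λ j → f i j)) ≡ sum (λ j → sum (λ i → f i j))
    sum-comm = ∑.∑-comm

    sum-scale : ∀ {n} c (f : Fin n → ℕ) → sum (λ i → c * f i) ≡ c * sum f
    sum-scale c f = ≡-sym (∑.*-distribˡ-sum c f)

    sum-mono : ∀ {n} {f g : Fin n → ℕ} → (∀ i → f i ≤ g i) → sum f ≤ sum g
    sum-mono {zero} _ = z≤n
    sum-mono {suc n} h = +-mono-≤ (h zero) (sum-mono (λ i → h (suc i)))

    sum-const : ∀ n c → sum {n} (λ _ → c) ≡ n * c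
    sum-const zero c = refl
    sum-const (suc n) c = cong (c +_) (sum-const n c)

    sum-term : ∀ {n} (f : Fin n → ℕ) i → f i ≤ sum f
    sum-term f zero = m≤m+n _ _
    sum-term f (suc i) = ≤-trans (sum-term (f ∘ suc) i) (m≤n+m _ _)

  sum-zero : ∀ n → sum {n} (λ _ → 0) ≡ 0
  sum-zero n = trans (sum-const n 0) (*-zeroʳ n)

  opaque
    unfolding sum

    sum-δ : ∀ {n} (i : Fin n) (f : Fin n → ℕ) → sum (λ j → 𝟙 ⌊ i ≟ j ⌋ * f j) ≡ f i
    sum-δ {suc n} zero f =
      trans (cong₂ _+_ (+-identityʳ (f zero)) (sum-zero n)) (+-identityʳ (f zero))
    sum-δ {suc n} (suc i) f = trans (sum-cong eq) (sum-δ i (f ∘ suc))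
      where
      eq : ∀ j → 𝟙 ⌊ suc i ≟ suc j ⌋ * f (suc j) ≡ 𝟙 ⌊ i ≟ j ⌋ * f (suc j)
      eq j with i ≟ j
      ... | yes _ = refl
      ... | no _ = refl

  Sub : ℕ → Set
  Sub n = Fin n → Bool

  infix 4 _∈_ _∉_ _⊆_
  _∈_ : ∀ {n} → Fin n → Sub n → Set
  i ∈ P = P i ≡ true

  _∉_ : ∀ {n} → Fin n → Sub n → Set
  i ∉ P = P i ≡ false

  _⊆_ : ∀ {n} → Sub n → Sub n → Set
  P ⊆ Q = ∀ i → i ∈ P → i ∈ Q

  infixr 7 _∩_
  infixr 6 _∪_
  infixl 7 _∖_
  _∩_ _∪_ _∖_ : ∀ {n} → Sub n → Sub n → Sub n
  (P ∩ Q) i = P i ∧ Q i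
  (P ∪ Q) i = P i ∨ Q i
  (P ∖ Q) i = P i ∧ not (Q i)

  ∅ : ∀ {n} → Sub n
  ∅ _ = false

  ｛_｝ : ∀ {n} → Fin n → Sub n
  ｛ i ｝ j = ⌊ i ≟ j ⌋

  ∈｛｝ : ∀ {n} (i : Fin n) → i ∈ ｛ i ｝
  ∈｛｝ i = ⌊⌋⁺ (i ≟ i) refl

  ∈｛｝⁻ : ∀ {n} {i j : Fin n} → j ∈ ｛ i ｝ → i ≡ j
  ∈｛｝⁻ {i = i} {j} = ⌊⌋⁻ (i ≟ j)

  ∈∖｛｝⁺ : ∀ {n} {P : Sub n} {v i} → i ∈ P → ¬ v ≡ i → i ∈ P ∖ ｛ v ｝
  ∈∖｛｝⁺ {v = v} {i} p ne = ∧⁺ p (not⁺ (⌊⌋-false⁺ (v ≟ i) ne))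

  ∈∖｛｝⁻ : ∀ {n} (P : Sub n) {v i} → i ∈ P ∖ ｛ v ｝ → i ∈ P × ¬ v ≡ i
  ∈∖｛｝⁻ P {v} {i} e = proj₁ (∧⁻ e) , ⌊⌋-false⁻ (v ≟ i) (not⁻ (proj₂ (∧⁻ e)))

  opaque
    # : ∀ {n} → Sub n → ℕ
    # P = sum (λ i → 𝟙 (P i))

    #-mono : ∀ {n} {P Q : Sub n} → P ⊆ Q → # P ≤ # Q
    #-mono h = sum-mono (λ i → 𝟙-mono (h i))

    #-cong : ∀ {n} {P Q : Sub n} → (∀ i → P i ≡ Q i) → # P ≡ # Q
    #-cong h = sum-cong (λ i → cong 𝟙 (h i))

    #-split : ∀ {n} (P Q : Sub n) → # P ≡ # (P ∩ Q) + # (P ∖ Q)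
    #-split P Q = trans (sum-cong eq) (sum-+ _ _)
      where
      eq : ∀ i → 𝟙 (P i) ≡ 𝟙 (P i ∧ Q i) + 𝟙 (P i ∧ not (Q i))
      eq i with P i | Q i
      ... | true | true = refl
      ... | true | false = refl
      ... | false | _ = refl

    #-∪ : ∀ {n} (P Q : Sub n) → # (P ∪ Q) ≤ # P + # Q
    #-∪ P Q = ≤-trans (sum-mono le) (≤-reflexive (sum-+ _ _))
      where
      le : ∀ i → 𝟙 (P i ∨ Q i) ≤ 𝟙 (P i) + 𝟙 (Q i)
      le i with P i | Q i
      ... | true | _ = s≤s z≤n
      ... | false | _ = ≤-refl

    #-∅ : ∀ {n} {P : Sub n} → (∀ i → i ∉ P) → # P ≡ 0
    #-∅ {n} h = trans (sum-cong (λ i → cong 𝟙 (h i))) (sum-zero n)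

    #-full : ∀ n → # {n} (λ _ → true) ≡ n
    #-full n = trans (sum-const n 1) (*-identityʳ n)

    #-single : ∀ {n} (i : Fin n) → # ｛ i ｝ ≡ 1
    #-single i = trans (sum-cong (λ j → ≡-sym (*-identityʳ (𝟙 ⌊ i ≟ j ⌋)))) (sum-δ i (λ _ → 1))

    #-pos : ∀ {n} {P : Sub n} {i} → i ∈ P → 1 ≤ # P
    #-pos {P = P} {i} p = ≤-trans (≤-reflexive (cong 𝟙 (≡-sym p))) (sum-term (λ j → 𝟙 (P j)) i)

    #-witness : ∀ {n} {P : Sub n} → 1 ≤ # P → ∃[ i ] i ∈ P
    #-witness {P = P} le with any? (λ i → P i ≟ᵇ true)
    ... | yes w = w
    ... | no ¬w = ⊥-elim (<-irrefl (≡-sym (#-∅ {P = P} (λ i → ≢true⇒false (λ e → ¬w (i , e))))) le)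

  opaque
    unfolding #

    #-remove : ∀ {n} {P : Sub n} {v} → v ∈ P → # P ≡ suc (# (P ∖ ｛ v ｝))
    #-remove {P = P} {v} p = trans (#-split P ｛ v ｝)
      (cong (_+ # (P ∖ ｛ v ｝)) (trans (#-cong eq) (#-single v)))
      where
      eq : ∀ i → P i ∧ ⌊ v ≟ i ⌋ ≡ ⌊ v ≟ i ⌋
      eq i with v ≟ i
      ... | yes refl = ∧⁺ p refl
      ... | no _ with P i
      ... | true = refl
      ... | false = refl

  opaque
    unfolding #

    sum-on : ∀ {n} → Sub n → (Fin n → ℕ) → ℕ
    sum-on P f = sum (λ i → 𝟙 (P i) * f i)

    sum-on-mono : ∀ {n} {P : Sub n} {f g : Fin n → ℕ} → (∀ i → i ∈ P → f i ≤ g i) → sum-on P f ≤ sum-on P g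
    sum-on-mono {P = P} {f} {g} h = sum-mono le
      where
      le : ∀ i → 𝟙 (P i) * f i ≤ 𝟙 (P i) * g i
      le i with P i in eq
      ... | true = *-monoʳ-≤ 1 (h i eq)
      ... | false = z≤n

    sum-on-⊆ : ∀ {n} {P Q : Sub n} (f : Fin n → ℕ) → P ⊆ Q → sum-on P f ≤ sum-on Q f
    sum-on-⊆ f h = sum-mono (λ i → *-monoˡ-≤ (f i) (𝟙-mono (h i)))

    sum-on-const : ∀ {n} (P : Sub n) c → sum-on P (λ _ → c) ≡ c * # P
    sum-on-const P c = trans (sum-cong (λ i → *-comm (𝟙 (P i)) c)) (sum-scale c _)

    sum-on-scale : ∀ {n} (P : Sub n) c (f : Fin n → ℕ) → sum-on P (λ i → c * f i) ≡ c * sum-on P f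
    sum-on-scale P c f = trans (sum-cong (λ i → swap (𝟙 (P i)) c (f i))) (sum-scale c _)
      where
      opaque
        swap : ∀ a b d → a * (b * d) ≡ b * (a * d)
        swap = solve-∀

    sum-on-+ : ∀ {n} (P : Sub n) (f g : Fin n → ℕ) → sum-on P (λ i → f i + g i) ≡ sum-on P f + sum-on P g
    sum-on-+ P f g = trans (sum-cong (λ i → *-distribˡ-+ (𝟙 (P i)) (f i) (g i))) (sum-+ _ _)

    sum-on-split : ∀ {n} (P Q : Sub n) (f : Fin n → ℕ) → sum-on P f ≡ sum-on (P ∩ Q) f + sum-on (P ∖ Q) f
    sum-on-split P Q f = trans (sum-cong eq) (sum-+ _ _)
      where
      eq : ∀ i → 𝟙 (P i) * f i ≡ 𝟙 (P i ∧ Q i) * f i + 𝟙 (P i ∧ not (Q i)) * f i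
      eq i with P i | Q i
      ... | true | true = ≡-sym (+-identityʳ _)
      ... | true | false = refl
      ... | false | _ = refl

    sum-on-cong : ∀ {n} {P : Sub n} {f g : Fin n → ℕ} → (∀ i → i ∈ P → f i ≡ g i) → sum-on P f ≡ sum-on P g
    sum-on-cong h = ≤-antisym (sum-on-mono (λ i p → ≤-reflexive (h i p)))
                              (sum-on-mono (λ i p → ≤-reflexive (≡-sym (h i p))))

    sum-on-remove : ∀ {n} {P : Sub n} {v} (f : Fin n → ℕ) → v ∈ P → sum-on P f ≡ f v + sum-on (P ∖ ｛ v ｝) f
    sum-on-remove {P = P} {v} f p = trans (sum-on-split P ｛ v ｝ f)
      (cong (_+ sum-on (P ∖ ｛ v ｝) f) (trans (sum-cong eq) (sum-δ v f)))
      where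
      eq : ∀ i → 𝟙 (P i ∧ ⌊ v ≟ i ⌋) * f i ≡ 𝟙 ⌊ v ≟ i ⌋ * f i
      eq i with v ≟ i
      ... | yes refl rewrite p = refl
      ... | no _ with P i
      ... | true = refl
      ... | false = refl

    double-count : ∀ {m n} (P : Sub m) (Q : Sub n) (R : Fin m → Fin n → Bool) →
      sum-on P (λ i → # (λ j → Q j ∧ R i j)) ≡ sum-on Q (λ j → # (λ i → P i ∧ R i j))
    double-count P Q R =
      trans (sum-cong (λ i → ≡-sym (sum-scale (𝟙 (P i)) _)))
      (trans (sum-comm _)
      (sum-cong (λ j → trans (sum-cong (λ i → swap (P i) (Q j) (R i j))) (sum-scale (𝟙 (Q j)) _))))
      where
      swap : ∀ a b c → 𝟙 a * 𝟙 (b ∧ c) ≡ 𝟙 b * 𝟙 (a ∧ c)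
      swap true true c = refl
      swap true false c = refl
      swap false true c = refl
      swap false false c = refl

  opaque
    unfolding # sum-on

    sum-on-𝟙 : ∀ {n} (P Q : Sub n) → sum-on P (λ i → 𝟙 (Q i)) ≡ # (λ i → P i ∧ Q i)
    sum-on-𝟙 P Q = sum-cong (λ i → eq (P i) (Q i))
      where
      eq : ∀ a b → 𝟙 a * 𝟙 b ≡ 𝟙 (a ∧ b)
      eq true b = +-identityʳ (𝟙 b)
      eq false b = refl

    #-∩-∪ : ∀ {n} (A B C D : Sub n) → (∀ i → 𝟙 (A i) + 𝟙 (B i) ≡ 𝟙 (C i) + 𝟙 (D i)) → # A + # B ≡ # C + # D
    #-∩-∪ A B C D h = trans (≡-sym (sum-+ _ _)) (trans (sum-cong h) (sum-+ _ _))

  pick-below : ∀ {n} (W : Sub n) (f : Fin n → ℕ) c → sum-on W f < c * # W → ∃[ a ] (a ∈ W × f a < c)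
  pick-below W f c lt with any? (λ a → ⌊ f a <? c ⌋ ∧ W a ≟ᵇ true)
  ... | yes (a , e) = a , proj₂ (∧⁻ e) , ⌊⌋⁻ (f a <? c) (proj₁ (∧⁻ e))
  ... | no ¬w = ⊥-elim (<-irrefl refl (<-≤-trans lt (begin
      c * # W                ≡⟨ ≡-sym (sum-on-const W c) ⟩
      sum-on W (λ _ → c)     ≤⟨ sum-on-mono (λ a p → ≮⇒≥ (λ q → ¬w (a , ∧⁺ (⌊⌋⁺ (f a <? c) q) p))) ⟩
      sum-on W f             ∎)))
    where open ≤-Reasoning

  ≤-sub-bound : ∀ {n} {P Q R : Sub n} → (∀ i → i ∈ P → i ∈ Q ⊎ i ∈ R) → # P ≤ # Q + # R
  ≤-sub-bound {P = P} {Q} {R} h = ≤-trans (#-mono (λ i p → [ ∨⁺ˡ , ∨⁺ʳ ]′ (h i p))) (#-∪ Q R)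

  choose : ∀ {n} m (Z : Sub n) → m ≤ # Z →
    Σ (Fin m → Fin n) λ e → (∀ i → e i ∈ Z) × (∀ i j → e i ≡ e j → i ≡ j)
  choose zero Z _ = (λ ()) , (λ ()) , (λ ())
  choose (suc m) Z le with #-witness {P = Z} (≤-trans (s≤s z≤n) le)
  ... | a , a∈ with choose m (Z ∖ ｛ a ｝) (≤-pred (≤-trans le (≤-reflexive (#-remove a∈))))
  ... | e , e∈ , inj = e′ , e′∈ , inj′
    where
    e′ : Fin (suc m) → _
    e′ zero = a
    e′ (suc i) = e i
    e′∈ : ∀ i → e′ i ∈ Z
    e′∈ zero = a∈
    e′∈ (suc i) = proj₁ (∈∖｛｝⁻ Z (e∈ i))
    inj′ : ∀ i j → e′ i ≡ e′ j → i ≡ j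
    inj′ zero zero _ = refl
    inj′ zero (suc j) eq = ⊥-elim (proj₂ (∈∖｛｝⁻ Z (e∈ j)) eq)
    inj′ (suc i) zero eq = ⊥-elim (proj₂ (∈∖｛｝⁻ Z (e∈ i)) (≡-sym eq))
    inj′ (suc i) (suc j) eq = cong suc (inj i j eq)

  image : ∀ {m n} → (Fin m → Fin n) → Sub n
  image e w = ⌊ any? (λ i → e i ≟ w) ⌋

  image⁺ : ∀ {m n} (e : Fin m → Fin n) i → e i ∈ image e
  image⁺ e i = ⌊⌋⁺ (any? (λ j → e j ≟ e i)) (i , refl)

  image⁻ : ∀ {m n} (e : Fin m → Fin n) {w} → w ∈ image e → ∃[ i ] e i ≡ w
  image⁻ e {w} = ⌊⌋⁻ (any? (λ j → e j ≟ w))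

  opaque
    unfolding #

    #-image : ∀ {m n} (e : Fin m → Fin n) → # (image e) ≤ m
    #-image {m} {n} e = begin
      # (image e)                              ≤⟨ sum-mono le ⟩
      sum (λ w → # (λ i → ⌊ e i ≟ w ⌋))        ≡⟨ sum-comm _ ⟩
      sum (λ i → # (λ w → ⌊ e i ≟ w ⌋))        ≡⟨ sum-cong (λ i → #-single (e i)) ⟩
      sum {m} (λ _ → 1)                        ≡⟨ #-full m ⟩
      m                                        ∎
      where
      open ≤-Reasoning
      le : ∀ w → 𝟙 (image e w) ≤ # (λ i → ⌊ e i ≟ w ⌋)
      le w with image e w in eq
      ... | false = z≤n
      ... | true with image⁻ e eq
      ... | i , p = #-pos {P = λ i → ⌊ e i ≟ w ⌋} {i} (⌊⌋⁺ (e i ≟ w) p)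

-- Minor models, edge contraction, irreducible graphs and Mader's bound.

module Minors where

  open Prelude
  open Counting
  open import Data.Bool.Properties using (∨-comm)

  module _ {n : ℕ} (H : Graph n) where

    N[_,_] : Sub n → Fin n → Sub n
    N[ P , u ] w = P w ∧ adj H u w

    deg : Sub n → Fin n → ℕ
    deg P u = # N[ P , u ]

    common : Sub n → Fin n → Fin n → ℕ
    common P u v = # (λ w → P w ∧ (adj H u w ∧ adj H v w))

    -- Twice the number of edges inside P.
    e₂ : Sub n → ℕ
    e₂ P = sum-on P (deg P)

    Walk : Sub n → Fin n → Fin n → Set
    Walk C = WalkIn H (_∈ C)

    -- The root makes a connected set nonempty by definition; walks from it suffice, as walks can be
    -- reversed and joined.
    Conn : Sub n → Set
    Conn C = ∃[ a ] (a ∈ C × (∀ u → u ∈ C → Walk C a u))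

    Touch : Sub n → Sub n → Set
    Touch C D = ∃[ u ] ∃[ v ] (u ∈ C × v ∈ D × adj H u v ≡ true)

  -- `R` is any relation on any index type, so that one notion serves for K_r, for l K_r indexed by
  -- pairs, and for joins of two models. The vertex set `P` is a predicate: deletion and contraction
  -- shrink `P` and keep the type `Graph n`.
  record Model {I : Set} {n : ℕ} (R : I → I → Set) (H : Graph n) (P : Sub n) : Set where
    field
      br     : I → Sub n
      inside : ∀ a → br a ⊆ P
      conn   : ∀ a → Conn H (br a)
      disj   : ∀ a b w → w ∈ br a → w ∈ br b → a ≡ b
      edge   : ∀ a b → R a b → Touch H (br a) (br b)

  open Model public

  model-mono : ∀ {I n} {R : I → I → Set} {H : Graph n} {P Q} → P ⊆ Q → Model R H P → Model R H Q
  model-mono h m = record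
    { br = br m ; inside = λ a i p → h i (inside m a i p) ; conn = conn m ; disj = disj m ; edge = edge m }

  reindex : ∀ {I J n} {R : I → I → Set} {S : J → J → Set} {H : Graph n} {P}
    (f : J → I) → (∀ a b → f a ≡ f b → a ≡ b) → (∀ a b → S a b → R (f a) (f b)) → Model R H P → Model S H P
  reindex f inj hom m = record
    { br = br m ∘ f ; inside = λ a → inside m (f a) ; conn = λ a → conn m (f a)
    ; disj = λ a b w p q → inj a b (disj m (f a) (f b) w p q) ; edge = λ a b s → edge m (f a) (f b) (hom a b s) }

  walk-start : ∀ {n} {H : Graph n} {Q : Fin n → Set} {u v} → WalkIn H Q u v → Q u
  walk-start (here q) = q
  walk-start (step q _ _) = q

  walk-map : ∀ {n} {H K : Graph n} {P Q : Fin n → Set} → (∀ i j → adj H i j ≡ true → adj K i j ≡ true) →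
    (∀ i → P i → Q i) → ∀ {u v} → WalkIn H P u v → WalkIn K Q u v
  walk-map a h (here p) = here (h _ p)
  walk-map a h (step p e w) = step (h _ p) (a _ _ e) (walk-map a h w)

  walk-mono : ∀ {n} {H : Graph n} {P Q : Fin n → Set} → (∀ i → P i → Q i) → ∀ {u v} → WalkIn H P u v → WalkIn H Q u v
  walk-mono = walk-map (λ _ _ e → e)

  walk-trans : ∀ {n} {H : Graph n} {P : Fin n → Set} {u v w} → WalkIn H P u v → WalkIn H P v w → WalkIn H P u w
  walk-trans (here _) q = q
  walk-trans (step p e w) q = step p e (walk-trans w q)

  walk-snoc : ∀ {n} {H : Graph n} {P : Fin n → Set} {u v w} → WalkIn H P u v → adj H v w ≡ true → P w → WalkIn H P u w
  walk-snoc (here p) e q = step p e (here q)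
  walk-snoc (step p e w) e′ q = step p e (walk-snoc w e′ q)

  walk-sym : ∀ {n} {H : Graph n} {P : Fin n → Set} {u v} → WalkIn H P u v → WalkIn H P v u
  walk-sym (here p) = here p
  walk-sym {H = H} (step p e w) = walk-snoc (walk-sym w) (trans (sym H _ _) e) p

  Conn-single : ∀ {n} (H : Graph n) v → Conn H ｛ v ｝
  Conn-single H v = v , ∈｛｝ v , λ u p → subst (Walk H ｛ v ｝ v) (∈｛｝⁻ p) (here (∈｛｝ v))

  adj≢ : ∀ {n} (H : Graph n) {i j} → adj H i j ≡ true → ¬ i ≡ j
  adj≢ H e refl = false≢true (irrefl H _) e

  #-∩-remove : ∀ {n} {P : Sub n} (Q : Sub n) {v} → v ∈ P →
    # (λ w → P w ∧ Q w) ≡ 𝟙 (Q v) + # (λ w → (P ∖ ｛ v ｝) w ∧ Q w)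
  #-∩-remove {P = P} Q {v} v∈ with Q v in eq
  ... | true = trans (#-remove {P = P ∩ Q} (∧⁺ v∈ eq)) (cong suc (#-cong (λ i → assoc (P i) (Q i) (not (｛ v ｝ i)))))
    where
    assoc : ∀ a b c → (a ∧ b) ∧ c ≡ (a ∧ c) ∧ b
    assoc true true c = lem c
      where
      lem : ∀ c → c ≡ c ∧ true
      lem true = refl
      lem false = refl
    assoc true false true = refl
    assoc true false false = refl
    assoc false b c = refl
  ... | false = #-cong same
    where
    same : ∀ i → P i ∧ Q i ≡ (P ∖ ｛ v ｝) i ∧ Q i
    same i with v ≟ i
    ... | no _ with P i
    ...   | true = refl
    ...   | false = refl
    same i | yes refl with P v
    ...   | true = eq
    ...   | false = refl

  module _ {n : ℕ} (H : Graph n) where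

    deg-remove : ∀ {P : Sub n} {v} → v ∈ P → ∀ w → deg H P w ≡ 𝟙 (adj H w v) + deg H (P ∖ ｛ v ｝) w
    deg-remove v∈ w = #-∩-remove (adj H w) v∈

    deg-self : ∀ {P : Sub n} {v} → v ∈ P → deg H P v ≡ deg H (P ∖ ｛ v ｝) v
    deg-self {P} {v} v∈ = trans (deg-remove {P} v∈ v) (cong (λ b → 𝟙 b + deg H (P ∖ ｛ v ｝) v) (irrefl H v))

    e₂-remove : ∀ {P : Sub n} {v} → v ∈ P → e₂ H P ≡ 2 * deg H P v + e₂ H (P ∖ ｛ v ｝)
    e₂-remove {P} {v} v∈ = begin
      e₂ H P                                                         ≡⟨ sum-on-remove (deg H P) v∈ ⟩
      d + sum-on P′ (deg H P)                                        ≡⟨ cong (d +_) (sum-on-cong (λ i _ → deg-remove {P} v∈ i)) ⟩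
      d + sum-on P′ (λ i → 𝟙 (adj H i v) + deg H P′ i)               ≡⟨ cong (d +_) (sum-on-+ P′ _ _) ⟩
      d + (sum-on P′ (λ i → 𝟙 (adj H i v)) + e₂ H P′)                ≡⟨ cong (λ x → d + (x + e₂ H P′)) eq ⟩
      d + (d + e₂ H P′)                                              ≡⟨ arith d (e₂ H P′) ⟩
      2 * d + e₂ H P′                                                ∎
      where
      open ≡-Reasoning
      P′ = P ∖ ｛ v ｝
      d = deg H P v
      opaque
        arith : ∀ a b → a + (a + b) ≡ 2 * a + b
        arith = solve-∀
      eq : sum-on P′ (λ i → 𝟙 (adj H i v)) ≡ d
      eq = trans (sum-on-𝟙 P′ (λ i → adj H i v))
          (trans (#-cong (λ i → cong (P′ i ∧_) (sym H i v))) (≡-sym (deg-self {P} v∈)))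

    deg≤# : ∀ (P : Sub n) v → deg H P v ≤ # P
    deg≤# P v = #-mono (λ i e → proj₁ (∧⁻ e))

  deg-mono : ∀ {n} {H K : Graph n} {P Q : Sub n} → (∀ i j → adj H i j ≡ true → adj K i j ≡ true) → P ⊆ Q →
    ∀ v → deg H P v ≤ deg K Q v
  deg-mono h s v = #-mono (λ i e → ∧⁺ (s i (proj₁ (∧⁻ e))) (h v i (proj₂ (∧⁻ e))))

  e₂-mono : ∀ {n} {H K : Graph n} {P : Sub n} → (∀ i j → adj H i j ≡ true → adj K i j ≡ true) → e₂ H P ≤ e₂ K P
  e₂-mono {H = H} {K} {P} h = sum-on-mono (λ i _ → deg-mono {H = H} {K} {P} {P} h (λ _ p → p) i)

  e₂-witness : ∀ {n} (H : Graph n) P → 1 ≤ e₂ H P → ∃[ v ] v ∈ P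
  e₂-witness H P le with any? (λ v → P v ≟ᵇ true)
  ... | yes w = w
  ... | no ¬w = ⊥-elim (<-irrefl refl (≤-trans le (begin
      e₂ H P                      ≤⟨ sum-on-mono {g = λ _ → 0} (λ i p → ⊥-elim (¬w (i , p))) ⟩
      sum-on P (λ _ → 0)          ≡⟨ sum-on-const P 0 ⟩
      0                           ∎)))
    where open ≤-Reasoning

  -- Contracting the edge uv: u takes over the neighbours of v, which is then to be dropped from the vertex set.
  contract : ∀ {n} (u v : Fin n) → Graph n → Graph n
  contract u v H = record
    { adj = λ i j → not ⌊ i ≟ j ⌋ ∧ (adj H i j ∨ ((⌊ u ≟ i ⌋ ∧ adj H v j) ∨ (⌊ u ≟ j ⌋ ∧ adj H v i)))
    ; sym = λ i j → cong₂ (λ a b → not a ∧ b) (≟-sym i j)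
                      (cong₂ _∨_ (sym H i j) (∨-comm (⌊ u ≟ i ⌋ ∧ adj H v j) _))
    ; irrefl = λ i → not-∧ (⌊⌋⁺ (i ≟ i) refl) }
    where
    not-∧ : ∀ {a b} → a ≡ true → not a ∧ b ≡ false
    not-∧ refl = refl
    ≟-sym : ∀ i j → ⌊ i ≟ j ⌋ ≡ ⌊ j ≟ i ⌋
    ≟-sym i j with i ≟ j | j ≟ i
    ... | yes _ | yes _ = refl
    ... | no _ | no _ = refl
    ... | yes p | no ¬q = ⊥-elim (¬q (≡-sym p))
    ... | no ¬p | yes q = ⊥-elim (¬p (≡-sym q))

  module _ {n : ℕ} (u v : Fin n) (H : Graph n) where

    private K = contract u v H

    contract-mono : ∀ i j → adj H i j ≡ true → adj K i j ≡ true
    contract-mono i j e = ∧⁺ (not⁺ (⌊⌋-false⁺ (i ≟ j) (adj≢ H e))) (∨⁺ˡ e)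

    contract-at : ∀ j → ¬ u ≡ j → adj H v j ≡ true → adj K u j ≡ true
    contract-at j ne e = ∧⁺ (not⁺ (⌊⌋-false⁺ (u ≟ j) ne)) (∨⁺ʳ {adj H u j} (∨⁺ˡ (∧⁺ (⌊⌋⁺ (u ≟ u) refl) e)))

    contract⁻ : ∀ i j → adj K i j ≡ true →
      adj H i j ≡ true ⊎ ((u ≡ i × adj H v j ≡ true) ⊎ (u ≡ j × adj H v i ≡ true))
    contract⁻ i j e with ∨⁻ {adj H i j} (proj₂ (∧⁻ e))
    ... | inj₁ p = inj₁ p
    ... | inj₂ q with ∨⁻ {⌊ u ≟ i ⌋ ∧ adj H v j} q
    ... | inj₁ r = inj₂ (inj₁ (⌊⌋⁻ (u ≟ i) (proj₁ (∧⁻ r)) , proj₂ (∧⁻ r)))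
    ... | inj₂ r = inj₂ (inj₂ (⌊⌋⁻ (u ≟ j) (proj₁ (∧⁻ r)) , proj₂ (∧⁻ r)))

    contract-elsewhere : ∀ i j → ¬ u ≡ i → ¬ u ≡ j → adj K i j ≡ adj H i j
    contract-elsewhere i j ni nj = bool-ext
      (λ e → case contract⁻ i j e of λ
        { (inj₁ p) → p
        ; (inj₂ (inj₁ (p , _))) → ⊥-elim (ni p)
        ; (inj₂ (inj₂ (p , _))) → ⊥-elim (nj p) })
      (contract-mono i j)

    contract-new : ∀ j → ¬ u ≡ j → adj K u j ≡ adj H u j ∨ adj H v j
    contract-new j nj = bool-ext
      (λ e → case contract⁻ u j e of λ
        { (inj₁ p) → ∨⁺ˡ p
        ; (inj₂ (inj₁ (_ , p))) → ∨⁺ʳ {adj H u j} p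
        ; (inj₂ (inj₂ (p , _))) → ⊥-elim (nj p) })
      (λ e → [ contract-mono u j , contract-at j nj ]′ (∨⁻ {adj H u j} e))

    -- Contraction destroys the edge uv and, for each common neighbour, one of two parallel edges.
    -- Both sides are reduced to the graph without u and v, where the sum of the two degrees is
    -- rewritten by inclusion-exclusion.
    contract-e₂ : ∀ {P : Sub n} → adj H u v ≡ true → u ∈ P → v ∈ P →
      e₂ H P ≡ e₂ K (P ∖ ｛ v ｝) + 2 * suc (common H P u v)
    contract-e₂ {P} uv u∈ v∈ = begin
      e₂ H P                                                 ≡⟨ e₂-remove H v∈ ⟩
      2 * deg H P v + e₂ H P₁                                ≡⟨ cong (2 * deg H P v +_) (e₂-remove H u∈P₁) ⟩
      2 * deg H P v + (2 * deg H P₁ u + e₂ H P₂)             ≡⟨ cong₂ (λ x y → 2 * x + (2 * y + e₂ H P₂)) degv (deg-self H u∈P₁) ⟩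
      2 * (1 + b) + (2 * a + e₂ H P₂)                        ≡⟨ arith₁ a b (e₂ H P₂) ⟩
      2 * (a + b) + (2 + e₂ H P₂)                            ≡⟨ cong (λ x → 2 * x + (2 + e₂ H P₂)) incl-excl ⟩
      2 * (c + d) + (2 + e₂ H P₂)                            ≡⟨ arith₂ c d (e₂ H P₂) ⟩
      (2 * d + e₂ H P₂) + 2 * suc c                          ≡⟨ cong₂ (λ x y → (2 * x + y) + 2 * suc c) (≡-sym degK) (≡-sym e₂K) ⟩
      (2 * deg K P₁ u + e₂ K P₂) + 2 * suc c                 ≡⟨ cong (_+ 2 * suc c) (≡-sym (e₂-remove K u∈P₁)) ⟩
      e₂ K P₁ + 2 * suc c                                    ≡⟨ cong (λ x → e₂ K P₁ + 2 * suc x) (≡-sym com) ⟩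
      e₂ K P₁ + 2 * suc (common H P u v)                     ∎
      where
      open ≡-Reasoning
      P₁ = P ∖ ｛ v ｝
      P₂ = P₁ ∖ ｛ u ｝
      u≢v : ¬ u ≡ v
      u≢v = adj≢ H uv
      u∈P₁ : u ∈ P₁
      u∈P₁ = ∈∖｛｝⁺ {P = P} u∈ (λ e → u≢v (≡-sym e))
      a = deg H P₂ u
      b = deg H P₂ v
      c = # (λ w → P₂ w ∧ (adj H u w ∧ adj H v w))
      d = # (λ w → P₂ w ∧ (adj H u w ∨ adj H v w))
      opaque
        arith₁ : ∀ a b e → 2 * (1 + b) + (2 * a + e) ≡ 2 * (a + b) + (2 + e)
        arith₁ = solve-∀
      opaque
        arith₂ : ∀ c d e → 2 * (c + d) + (2 + e) ≡ (2 * d + e) + 2 * suc c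
        arith₂ = solve-∀
      degv : deg H P v ≡ 1 + b
      degv = trans (deg-self H v∈) (trans (deg-remove H u∈P₁ v) (cong (λ x → 𝟙 x + b) (trans (sym H v u) uv)))
      incl-excl : a + b ≡ c + d
      incl-excl = #-∩-∪ _ _ _ _ (λ w → lem (P₂ w) (adj H u w) (adj H v w))
        where
        lem : ∀ p x y → 𝟙 (p ∧ x) + 𝟙 (p ∧ y) ≡ 𝟙 (p ∧ (x ∧ y)) + 𝟙 (p ∧ (x ∨ y))
        lem true true true = refl
        lem true true false = refl
        lem true false true = refl
        lem true false false = refl
        lem false _ _ = refl
      notu : ∀ w → w ∈ P₂ → ¬ u ≡ w
      notu w p = proj₂ (∈∖｛｝⁻ P₁ p)
      ∧-cong : ∀ {p x y} → (p ≡ true → x ≡ y) → p ∧ x ≡ p ∧ y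
      ∧-cong {true} h = h refl
      ∧-cong {false} _ = refl
      degK : deg K P₁ u ≡ d
      degK = trans (deg-self K {P₁} {u} u∈P₁) (#-cong (λ w → ∧-cong (λ p → contract-new w (notu w p))))
      e₂K : e₂ K P₂ ≡ e₂ H P₂
      e₂K = sum-on-cong (λ i p → #-cong (λ w → ∧-cong (λ q → contract-elsewhere i w (notu i p) (notu w q))))
      com : common H P u v ≡ c
      com = trans (#-∩-remove {P = P} (λ w → adj H u w ∧ adj H v w) v∈)
           (trans (cong₂ (λ x y → 𝟙 x + y) (trans (cong (adj H u v ∧_) (irrefl H v)) (∧-false (adj H u v)))
                    (#-∩-remove {P = P₁} (λ w → adj H u w ∧ adj H v w) u∈P₁))
                  (cong (λ x → 𝟙 (x ∧ adj H v u) + c) (irrefl H u)))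
        where
        ∧-false : ∀ x → x ∧ false ≡ false
        ∧-false true = refl
        ∧-false false = refl

    -- Branch sets are pulled back along `fold`, which sends v to u: v joins the branch set that
    -- contains u, if there is one. An edge at u that existed only through v becomes a walk through
    -- v.
    contract-model : ∀ {I} {R : I → I → Set} {P : Sub n} → adj H u v ≡ true → u ∈ P → v ∈ P →
      Model R K (P ∖ ｛ v ｝) → Model R H P
    contract-model {R = R} {P} uv u∈ v∈ m = record
      { br = λ a → br m a ∘ fold
      ; inside = inside′
      ; conn = conn′
      ; disj = λ a b w p q → disj m a b (fold w) p q
      ; edge = edge′ }
      where
      fold : Fin n → Fin n
      fold w = if ⌊ v ≟ w ⌋ then u else w
      fold-v : fold v ≡ u
      fold-v = cong (λ b → if b then u else v) (⌊⌋⁺ (v ≟ v) refl)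
      fold-≢ : ∀ w → ¬ v ≡ w → fold w ≡ w
      fold-≢ w ne = cong (λ b → if b then u else w) (⌊⌋-false⁺ (v ≟ w) ne)
      old : ∀ a w → w ∈ br m a → fold w ≡ w
      old a w p = fold-≢ w (proj₂ (∈∖｛｝⁻ P (inside m a w p)))
      old∈ : ∀ a w → w ∈ br m a → fold w ∈ br m a
      old∈ a w p = trans (cong (br m a) (old a w p)) p
      v∈′ : ∀ a → u ∈ br m a → fold v ∈ br m a
      v∈′ a p = trans (cong (br m a) fold-v) p
      inside′ : ∀ a w → fold w ∈ br m a → w ∈ P
      inside′ a w p with v ≟ w
      ... | yes refl = v∈
      ... | no _ = proj₁ (∈∖｛｝⁻ P (inside m a w p))
      link : ∀ a i j → adj K i j ≡ true → i ∈ br m a → j ∈ br m a → Walk H (br m a ∘ fold) i j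
      link a i j e p q with contract⁻ i j e
      ... | inj₁ e′ = step (old∈ a i p) e′ (here (old∈ a j q))
      ... | inj₂ (inj₁ (refl , e′)) = step (old∈ a u p) uv (step (v∈′ a p) e′ (here (old∈ a j q)))
      ... | inj₂ (inj₂ (refl , e′)) = step (old∈ a i p) (trans (sym H i v) e′)
                                        (step (v∈′ a q) (trans (sym H v u) uv) (here (old∈ a u q)))
      lift : ∀ a {i j} → Walk K (br m a) i j → Walk H (br m a ∘ fold) i j
      lift a (here p) = here (old∈ a _ p)
      lift a (step p e w) = walk-trans (link a _ _ e p (walk-start w)) (lift a w)
      conn′ : ∀ a → Conn H (br m a ∘ fold)
      conn′ a with conn m a
      ... | r , r∈ , walks = r , old∈ a r r∈ , go
        where
        go : ∀ w → fold w ∈ br m a → Walk H (br m a ∘ fold) r w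
        go w p with v ≟ w
        ... | yes refl = walk-snoc (lift a (walks u p)) uv (v∈′ a p)
        ... | no _ = lift a (walks w p)
      edge′ : ∀ a b → R a b → Touch H (br m a ∘ fold) (br m b ∘ fold)
      edge′ a b r with edge m a b r
      ... | i , j , p , q , e with contract⁻ i j e
      ... | inj₁ e′ = i , j , old∈ a i p , old∈ b j q , e′
      ... | inj₂ (inj₁ (refl , e′)) = v , j , v∈′ a p , old∈ b j q , e′
      ... | inj₂ (inj₂ (refl , e′)) = i , v , old∈ a i p , v∈′ b q , trans (sym H i v) e′

  Irreducible : ∀ {n} → ℕ → Graph n → Sub n → Set
  Irreducible β H P = (∀ v → v ∈ P → suc β ≤ deg H P v) ×
    (∀ u v → u ∈ P → v ∈ P → adj H u v ≡ true → β ≤ common H P u v)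

  -- Contracting an edge with fewer than β common neighbours, or deleting a vertex of degree at most β,
  -- does not decrease e − β |P|.
  reduce : ∀ {n I} {R : I → I → Set} β M →
    (∀ (H : Graph n) P → Irreducible β H P → 2 * β * # P + 2 * M ≤ e₂ H P → Model R H P) →
    ∀ (H : Graph n) P → 2 * β * # P + 2 * M ≤ e₂ H P → Model R H P
  reduce {n} {R = R} β M k H P = go (# P) H P ≤-refl
    where
    go : ∀ m H P → # P ≤ m → 2 * β * # P + 2 * M ≤ e₂ H P → Model R H P
    go m H P sz le with any? (λ v → (P v ≟ᵇ true) ×-dec (deg H P v ≤? β))
    go zero H P sz le | yes (v , v∈ , _) = ⊥-elim (<-irrefl refl (≤-trans (#-pos {P = P} v∈) sz))
    go (suc m) H P sz le | yes (v , v∈ , dv) = model-mono (λ i p → proj₁ (∈∖｛｝⁻ P p))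
      (go m H P′ (≤-pred (≤-trans (≤-reflexive (≡-sym (#-remove v∈))) sz))
        (linear 0 (subst (λ s → 2 * β * s + 2 * M ≤ e₂ H P) (#-remove v∈) le ⊕ ≤-reflexive (e₂-remove H v∈) ⊕ 2 ⊛ dv)
          (arith β (# P′) M (e₂ H P) (e₂ H P′) (deg H P v))))
      where
      P′ = P ∖ ｛ v ｝
      opaque
        arith : ∀ β p M e e′ d → e′ + ((2 * β * suc p + 2 * M) + e + 2 * d) ≡ (2 * β * p + 2 * M) + (e + (2 * d + e′) + 2 * β) + 0
        arith = solve-∀
    go m H P sz le | no ¬v with any? (λ u → any? (λ v → (P u ≟ᵇ true) ×-dec ((P v ≟ᵇ true) ×-dec
                                  ((adj H u v ≟ᵇ true) ×-dec (common H P u v <? β)))))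
    ... | no ¬uv = k H P ((λ v v∈ → ≰⇒> (λ d → ¬v (v , v∈ , d))) ,
                          (λ u v u∈ v∈ e → ≮⇒≥ (λ c → ¬uv (u , v , u∈ , v∈ , e , c)))) le
    go zero H P sz le | no _ | yes (u , v , u∈ , v∈ , e , c) = ⊥-elim (<-irrefl refl (≤-trans (#-pos {P = P} v∈) sz))
    go (suc m) H P sz le | no _ | yes (u , v , u∈ , v∈ , e , c) = contract-model u v H e u∈ v∈
      (go m K P′ (≤-pred (≤-trans (≤-reflexive (≡-sym (#-remove v∈))) sz))
        (linear 0 (subst (λ s → 2 * β * s + 2 * M ≤ e₂ H P) (#-remove v∈) le ⊕ ≤-reflexive (contract-e₂ u v H e u∈ v∈) ⊕ 2 ⊛ c)
          (arith β (# P′) M (e₂ H P) (e₂ K P′) (suc (common H P u v)))))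
      where
      K = contract u v H
      P′ = P ∖ ｛ v ｝
      opaque
        arith : ∀ β p M e e′ d → e′ + ((2 * β * suc p + 2 * M) + e + 2 * d) ≡ (2 * β * p + 2 * M) + (e + (e′ + 2 * d) + 2 * β) + 0
        arith = solve-∀

  -- Equals 2^(t+1) - 1. The doubling: 2m common neighbours are degrees 2m inside a neighbourhood,
  -- that is, density m. The extra 1 becomes the margin kept by `reduce`, which guarantees that an
  -- edge is left.
  maderDensity : ℕ → ℕ
  maderDensity zero = 1
  maderDensity (suc t) = suc (2 * maderDensity t)

  -- Mader's exponential bound: in an irreducible graph a neighbourhood inherits enough density for induction.
  mader : ∀ t {n} (H : Graph n) P → 1 ≤ # P → 2 * maderDensity t * # P ≤ e₂ H P → Model {Fin t} (λ a b → ¬ a ≡ b) H P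
  mader zero H P _ _ = record { br = λ () ; inside = λ () ; conn = λ () ; disj = λ () ; edge = λ () }
  mader (suc t) H P ne dense = reduce (2 * m) 1 irreducible-case H P
    (≤-trans (linear 0 (2 ⊛ ne) (arith₁ m (# P))) dense)
    where
    m = maderDensity t
    opaque
      arith₁ : ∀ m p → 2 * suc (2 * m) * p + 2 * 1 ≡ 2 * (2 * m) * p + 2 * 1 + 2 * p + 0
      arith₁ = solve-∀
    irreducible-case : ∀ H P → Irreducible (2 * m) H P → 2 * (2 * m) * # P + 2 * 1 ≤ e₂ H P → Model (λ a b → ¬ a ≡ b) H P
    irreducible-case H P (degs , commons) le with e₂-witness H P (≤-trans (≤-trans (s≤s z≤n) (m≤n+m 2 _)) le)
    ... | v , v∈ = record
      { br = br′ ; inside = inside′ ; conn = conn′ ; disj = disj′ ; edge = edge′ }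
      where
      N = N[_,_] H P v
      ih : Model (λ a b → ¬ a ≡ b) H N
      ih = mader t H N (≤-trans (s≤s z≤n) (degs v v∈)) (≤-trans (≤-reflexive (≡-sym (sum-on-const N (2 * m))))
        (sum-on-mono (λ u u∈ → ≤-trans (commons v u v∈ (proj₁ (∧⁻ u∈)) (proj₂ (∧⁻ u∈)))
          (#-mono (λ w w∈ → let p , q = ∧⁻ {P w} w∈ ; r , s = ∧⁻ {adj H v w} q in ∧⁺ (∧⁺ {P w} p r) s)))))
      v∉N : ∀ a → v ∈ br ih a → ⊥
      v∉N a p = false≢true (irrefl H v) (proj₂ (∧⁻ (inside ih a v p)))
      br′ : Fin (suc t) → Sub _
      br′ zero = ｛ v ｝
      br′ (suc a) = br ih a
      inside′ : ∀ a → br′ a ⊆ P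
      inside′ zero w p = subst (_∈ P) (∈｛｝⁻ p) v∈
      inside′ (suc a) w p = proj₁ (∧⁻ (inside ih a w p))
      conn′ : ∀ a → Conn H (br′ a)
      conn′ zero = Conn-single H v
      conn′ (suc a) = conn ih a
      disj′ : ∀ a b w → w ∈ br′ a → w ∈ br′ b → a ≡ b
      disj′ zero zero _ _ _ = refl
      disj′ zero (suc b) w p q = ⊥-elim (v∉N b (subst (_∈ br ih b) (≡-sym (∈｛｝⁻ p)) q))
      disj′ (suc a) zero w p q = ⊥-elim (v∉N a (subst (_∈ br ih a) (≡-sym (∈｛｝⁻ q)) p))
      disj′ (suc a) (suc b) w p q = cong suc (disj ih a b w p q)
      edge′ : ∀ a b → ¬ a ≡ b → Touch H (br′ a) (br′ b)
      edge′ zero zero ne = ⊥-elim (ne refl)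
      edge′ zero (suc b) _ with conn ih b
      ... | w , p , _ = v , w , ∈｛｝ v , p , proj₂ (∧⁻ (inside ih b w p))
      edge′ (suc a) zero _ with conn ih a
      ... | w , p , _ = w , v , p , ∈｛｝ v , trans (sym H w v) (proj₂ (∧⁻ (inside ih a w p)))
      edge′ (suc a) (suc b) ne = edge ih a b (λ e → ne (cong suc e))

-- Greedy selection, expanding subgraphs and the growth of balls.

module Expansion where

  open Prelude
  open Counting
  open Minors
  open import Data.Fin.Properties using (all?)
  open import Data.Fin.Subset.Properties using (anySubset?)
  open import Data.List using (List; []; _∷_; length)
  open import Data.List.Relation.Unary.All using (All; []; _∷_)
  open import Data.List.Relation.Unary.Any using (here; there)
  open import Data.List.Membership.Propositional using () renaming (_∈_ to _∈ˡ_)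
  open import Data.Vec using (lookup; tabulate)
  open import Data.Vec.Properties using (lookup∘tabulate)

  miss : ∀ {N n} → (Fin N → Fin n → Bool) → Fin N → List (Fin n) → Bool
  miss R o [] = true
  miss R o (a ∷ as) = not (R o a) ∧ miss R o as

  miss-false : ∀ {N n} (R : Fin N → Fin n → Bool) o as → miss R o as ≡ false → ∃[ a ] (a ∈ˡ as × R o a ≡ true)
  miss-false R o (a ∷ as) e with R o a in eq
  ... | true = a , here refl , eq
  ... | false with miss-false R o as e
  ... | b , b∈ , r = b , there b∈ , r

  -- Double counting replaces one random pick: since each object is missed by at most a fraction Z /
  -- X of `W`, an average element of `W` misses at most that fraction of the objects.
  greedy-step : ∀ {N n} (W : Sub n) (O : Sub N) (R : Fin N → Fin n → Bool) X Z → 1 ≤ # W →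
    (∀ o → o ∈ O → X * # (λ a → W a ∧ not (R o a)) ≤ Z * # W) →
    ∃[ a ] (a ∈ W × X * # (λ o → O o ∧ not (R o a)) ≤ Z * # O)
  greedy-step W O R X Z ne h with pick-below W (λ a → X * # (λ o → O o ∧ not (R o a))) (suc (Z * # O)) (begin-strict
      sum-on W (λ a → X * # (λ o → O o ∧ not (R o a)))     ≡⟨ sum-on-scale W X _ ⟩
      X * sum-on W (λ a → # (λ o → O o ∧ not (R o a)))     ≡⟨ cong (X *_) (≡-sym (double-count O W (λ o a → not (R o a)))) ⟩
      X * sum-on O (λ o → # (λ a → W a ∧ not (R o a)))     ≡⟨ ≡-sym (sum-on-scale O X _) ⟩
      sum-on O (λ o → X * # (λ a → W a ∧ not (R o a)))     ≤⟨ sum-on-mono h ⟩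
      sum-on O (λ _ → Z * # W)                             ≡⟨ sum-on-const O _ ⟩
      Z * # W * # O                                        ≡⟨ comm Z (# W) (# O) ⟩
      Z * # O * # W                                        <⟨ m<n+m _ ne ⟩
      suc (Z * # O) * # W                                  ∎)
    where
    open ≤-Reasoning
    opaque
      comm : ∀ a b c → a * b * c ≡ a * c * b
      comm = solve-∀
  ... | a , a∈ , lt = a , a∈ , ≤-pred lt

  -- The hypothesis concerns each object separately and so persists for those still missed; every
  -- pick multiplies their number by at most Z / X. Picks are always taken from the whole of `W`, so
  -- repetitions may occur.
  greedy : ∀ {N n} m (W : Sub n) (O : Sub N) (R : Fin N → Fin n → Bool) X Z → 1 ≤ # W →
    (∀ o → o ∈ O → X * # (λ a → W a ∧ not (R o a)) ≤ Z * # W) →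
    ∃[ as ] (length as ≡ m × All (_∈ W) as × X ^ m * # (λ o → O o ∧ miss R o as) ≤ Z ^ m * # O)
  greedy zero W O R X Z ne h = [] , refl , [] , +-monoˡ-≤ 0 (#-mono (λ o e → proj₁ (∧⁻ e)))
  greedy (suc m) W O R X Z ne h with greedy-step W O R X Z ne h
  ... | a , a∈ , le with greedy m W (λ o → O o ∧ not (R o a)) R X Z ne (λ o e → h o (proj₁ (∧⁻ e)))
  ... | as , len , all , le′ = a ∷ as , cong suc len , a∈ ∷ all , (begin
      X * X ^ m * # (λ o → O o ∧ (not (R o a) ∧ miss R o as))   ≡⟨ cong (X * X ^ m *_) (#-cong (λ o → ∧-assoc′ (O o) _ _)) ⟩
      X * X ^ m * # (λ o → (O o ∧ not (R o a)) ∧ miss R o as)   ≡⟨ *-assoc X _ _ ⟩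
      X * (X ^ m * # (λ o → (O o ∧ not (R o a)) ∧ miss R o as)) ≤⟨ X ⊛ le′ ⟩
      X * (Z ^ m * # (λ o → O o ∧ not (R o a)))                 ≡⟨ comm X (Z ^ m) _ ⟩
      Z ^ m * (X * # (λ o → O o ∧ not (R o a)))                 ≤⟨ (Z ^ m) ⊛ le ⟩
      Z ^ m * (Z * # O)                                         ≡⟨ comm′ (Z ^ m) Z (# O) ⟩
      Z * Z ^ m * # O                                           ∎)
    where
    open ≤-Reasoning
    opaque
      comm : ∀ a b c → a * (b * c) ≡ b * (a * c)
      comm = solve-∀
    opaque
      comm′ : ∀ a b c → a * (b * c) ≡ b * a * c
      comm′ = solve-∀
    ∧-assoc′ : ∀ a b c → a ∧ (b ∧ c) ≡ (a ∧ b) ∧ c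
    ∧-assoc′ true b c = refl
    ∧-assoc′ false b c = refl

  *-^ : ∀ a b k → (a * b) ^ k ≡ a ^ k * b ^ k
  *-^ a b zero = refl
  *-^ a b (suc k) = trans (cong (a * b *_) (*-^ a b k)) (swap a b (a ^ k) (b ^ k))
    where
    opaque
      swap : ∀ a b c d → a * b * (c * d) ≡ a * c * (b * d)
      swap = solve-∀

  halving-power : ∀ X Z h k u o .⦃ _ : NonZero Z ⦄ → 2 * Z ^ h ≤ X ^ h → X ^ (h * k) * u ≤ Z ^ (h * k) * o → 2 ^ k * u ≤ o
  halving-power X Z h k u o num le = *-cancelˡ-≤ (Z ^ (h * k)) ⦃ m^n≢0 Z (h * k) ⦄ (begin
      Z ^ (h * k) * (2 ^ k * u)     ≡⟨ arith (Z ^ (h * k)) (2 ^ k) u ⟩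
      2 ^ k * Z ^ (h * k) * u       ≡⟨ cong (λ x → 2 ^ k * x * u) (≡-sym (^-*-assoc Z h k)) ⟩
      2 ^ k * (Z ^ h) ^ k * u       ≡⟨ cong (_* u) (≡-sym (*-^ 2 (Z ^ h) k)) ⟩
      (2 * Z ^ h) ^ k * u           ≤⟨ *-monoˡ-≤ u (^-monoˡ-≤ k num) ⟩
      (X ^ h) ^ k * u               ≡⟨ cong (_* u) (^-*-assoc X h k) ⟩
      X ^ (h * k) * u               ≤⟨ le ⟩
      Z ^ (h * k) * o               ∎)
    where
    open ≤-Reasoning
    opaque
      arith : ∀ a b c → a * (b * c) ≡ b * a * c
      arith = solve-∀

  -- By the numerical hypothesis, h picks that each hit a 1/(z+1) fraction of the remaining objects halve their number.
  greedy-halving : ∀ {N n} z h k (W : Sub n) (O : Sub N) (R : Fin N → Fin n → Bool) .⦃ _ : NonZero z ⦄ →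
    2 * z ^ h ≤ suc z ^ h → 1 ≤ # W → (∀ o → o ∈ O → # W ≤ suc z * # (λ a → W a ∧ R o a)) →
    ∃[ as ] (length as ≡ h * k × All (_∈ W) as × 2 ^ k * # (λ o → O o ∧ miss R o as) ≤ # O)
  greedy-halving z h k W O R num ne hit with greedy (h * k) W O R (suc z) z ne (λ o o∈ →
      linear 0 (hit o o∈ ⊕ suc z ⊛ ≤-reflexive (≡-sym (#-split W (R o))))
        (arith z (# W) (# (λ a → W a ∧ R o a)) (# (λ a → W a ∧ not (R o a)))))
    where
    opaque
      arith : ∀ z w a b → z * w + (w + suc z * (a + b)) ≡ suc z * b + (suc z * a + suc z * w) + 0
      arith = solve-∀
  ... | as , len , all , le = as , len , all , halving-power (suc z) z h k _ _ num le

  -- After m picks at most a fraction (E / 2^k)^m of the objects is missed, which by the last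
  -- hypothesis is less than one object.
  greedy-all : ∀ {N n} E m k (W : Sub n) (O : Sub N) (R : Fin N → Fin n → Bool) → 1 ≤ # W →
    (∀ o → o ∈ O → 2 ^ k * # (λ a → W a ∧ not (R o a)) ≤ E * # W) → E ^ m * # O < (2 ^ k) ^ m →
    ∃[ as ] (length as ≡ m × All (_∈ W) as × (∀ o → o ∈ O → ∃[ a ] (a ∈ˡ as × R o a ≡ true)))
  greedy-all E m k W O R ne h lt with greedy m W O R (2 ^ k) E ne h
  ... | as , len , all , le = as , len , all , λ o o∈ → miss-false R o as (≢true⇒false (λ e →
    <-irrefl refl (<-≤-trans lt (begin
      (2 ^ k) ^ m                                      ≡⟨ ≡-sym (*-identityʳ _) ⟩
      (2 ^ k) ^ m * 1                                  ≤⟨ ((2 ^ k) ^ m) ⊛ #-pos {P = λ o → O o ∧ miss R o as} {o} (∧⁺ o∈ e) ⟩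
      (2 ^ k) ^ m * # (λ o → O o ∧ miss R o as)        ≤⟨ le ⟩
      E ^ m * # O                                      ∎))))
    where open ≤-Reasoning

  module _ {n : ℕ} (H : Graph n) where

    hasNb : Sub n → Sub n
    hasNb A w = ⌊ any? (λ a → (A a ∧ adj H a w) ≟ᵇ true) ⌋

    hasNb⁺ : ∀ {A : Sub n} {a w} → a ∈ A → adj H a w ≡ true → w ∈ hasNb A
    hasNb⁺ {A} {a} {w} a∈ e = ⌊⌋⁺ (any? (λ a → (A a ∧ adj H a w) ≟ᵇ true)) (a , ∧⁺ a∈ e)

    hasNb⁻ : ∀ {A : Sub n} {w} → w ∈ hasNb A → ∃[ a ] (a ∈ A × adj H a w ≡ true)
    hasNb⁻ {A} {w} e with ⌊⌋⁻ (any? (λ a → (A a ∧ adj H a w) ≟ᵇ true)) e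
    ... | a , p = a , ∧⁻ p

    boundary beyond : Sub n → Sub n → Sub n
    boundary V A = (V ∖ A) ∩ hasNb A
    beyond V A = (V ∖ A) ∖ hasNb A

    -- κ is additive: a search inside V meets κ new vertices per round until V is exhausted, however
    -- large the set already is. When up to κ / 2 vertices are forbidden, each round still gains κ /
    -- 2.
    Expanding : ℕ → Sub n → Set
    Expanding κ V = ∀ A → A ⊆ V → 1 ≤ # A → κ ≤ # (boundary V A) ⊎ (∀ w → w ∉ beyond V A)

    Separator : ℕ → Sub n → Sub n → Set
    Separator κ V A = A ⊆ V × 1 ≤ # A × # (boundary V A) < κ × 1 ≤ # (beyond V A)

    separator-cong : ∀ {κ V A B} → (∀ i → A i ≡ B i) → Separator κ V A → Separator κ V B
    separator-cong {κ} {V} {A} {B} eq (s , p , b , q) =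
      (λ i e → s i (trans (eq i) e)) , subst (1 ≤_) (#-cong eq) p ,
      subst (_< κ) (#-cong (λ i → cong₂ (λ x y → (V i ∧ not x) ∧ y) (eq i) (nb i))) b ,
      subst (1 ≤_) (#-cong (λ i → cong₂ (λ x y → (V i ∧ not x) ∧ not y) (eq i) (nb i))) q
      where
      nb : ∀ w → hasNb A w ≡ hasNb B w
      nb w = bool-ext
        (λ e → let a , p , r = hasNb⁻ e in hasNb⁺ (trans (≡-sym (eq a)) p) r)
        (λ e → let a , p , r = hasNb⁻ e in hasNb⁺ (trans (eq a) p) r)

    -- Decided by running through all subsets, given as vectors; `separator-cong` translates between
    -- a predicate and its table.
    expanding? : ∀ κ V → Expanding κ V ⊎ ∃[ A ] Separator κ V A
    expanding? κ V with anySubset? (λ s → (all? (λ i → (lookup s i ≟ᵇ true) →-dec (V i ≟ᵇ true)))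
        ×-dec ((1 ≤? # (lookup s)) ×-dec ((# (boundary V (lookup s)) <? κ) ×-dec (1 ≤? # (beyond V (lookup s))))))
    ... | yes (s , p) = inj₂ (lookup s , p)
    ... | no ¬s = inj₁ expand
      where
      expand : Expanding κ V
      expand A A⊆V ne with κ ≤? # (boundary V A)
      ... | yes le = inj₁ le
      ... | no ¬le with 1 ≤? # (beyond V A)
      ... | yes pos = ⊥-elim (¬s (tabulate A ,
              separator-cong (λ i → ≡-sym (lookup∘tabulate A i)) (A⊆V , ne , ≰⇒> ¬le , pos)))
      ... | no ¬pos = inj₂ (λ w → ≢true⇒false (λ e → ¬pos (#-pos {P = beyond V A} e)))

    -- While V has a separator, pass to the smaller side: this halves V and costs less than κ in minimum degree.
    expanding-subset : ∀ {a b κ} → b < a → ∀ j V → 1 ≤ # V → # V ≤ 2 ^ j * b → (∀ u → u ∈ V → a + j * κ ≤ deg H V u) →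
      ∃[ V′ ] (V′ ⊆ V × 1 ≤ # V′ × (∀ u → u ∈ V′ → a ≤ deg H V′ u) × Expanding κ V′)
    expanding-subset {a} {b} {κ} b<a j V ne size degs with expanding? κ V
    ... | inj₁ ex = V , (λ _ p → p) , ne , (λ u u∈ → ≤-trans (m≤m+n a (j * κ)) (degs u u∈)) , ex
    -- With no halvings left, |V| ≤ b contradicts the minimum degree a > b.
    expanding-subset {a} {b} {κ} b<a zero V ne size degs | inj₂ _ with #-witness ne
    ... | u , u∈ = ⊥-elim (<-irrefl refl (begin-strict
      b             <⟨ b<a ⟩
      a             ≤⟨ m≤m+n a 0 ⟩
      a + 0         ≤⟨ degs u u∈ ⟩
      deg H V u     ≤⟨ deg≤# H V u ⟩
      # V           ≤⟨ size ⟩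
      1 * b         ≡⟨ *-identityˡ b ⟩
      b             ∎))
      where open ≤-Reasoning
    expanding-subset {a} {b} {κ} b<a (suc j) V ne size degs | inj₂ (A , A⊆V , neA , small , neB) =
      [ (λ le → go A A⊆V neA (halve (≤-trans (arith₂ le) total)) (λ u u∈ w w∈ e → A-side u w u∈ w∈ e))
      , (λ le → go B (λ w p → B⊆V w p) neB (halve (≤-trans (arith₂′ le) total)) (λ u u∈ w w∈ e → B-side u w u∈ w∈ e))
      ]′ (≤-total (# A) (# B))
      where
      B = beyond V A
      ∂A = boundary V A
      B⊆V : B ⊆ V
      B⊆V w p = proj₁ (∧⁻ (proj₁ (∧⁻ p)))
      total : # A + # B ≤ # V
      total = ≤-trans (+-mono-≤ (#-mono (λ i p → ∧⁺ (A⊆V i p) p)) (#-mono (λ i p → proj₁ (∧⁻ p))))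
                (≤-reflexive (≡-sym (#-split V A)))
      arith₂ : # A ≤ # B → 2 * # A ≤ # A + # B
      arith₂ le = +-monoʳ-≤ (# A) (≤-trans (≤-reflexive (+-identityʳ _)) le)
      arith₂′ : # B ≤ # A → 2 * # B ≤ # A + # B
      arith₂′ le = ≤-trans (arith₃ (# A) (# B) le) ≤-refl
        where
        arith₃ : ∀ a b → b ≤ a → 2 * b ≤ a + b
        arith₃ a b p = ≤-trans (≤-reflexive (cong (b +_) (+-identityʳ b))) (+-monoˡ-≤ b p)
      halve : ∀ {x} → 2 * x ≤ # V → x ≤ 2 ^ j * b
      halve {x} le = *-cancelˡ-≤ 2 (≤-trans le (≤-trans size (≤-reflexive (*-assoc 2 (2 ^ j) _))))
      A-side : ∀ u w → u ∈ A → w ∈ V → adj H u w ≡ true → w ∈ A ⊎ w ∈ ∂A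
      A-side u w u∈ w∈ e with bool? (A w)
      ... | inj₁ p = inj₁ p
      ... | inj₂ p = inj₂ (∧⁺ (∧⁺ w∈ (not⁺ p)) (hasNb⁺ u∈ e))
      B-side : ∀ u w → u ∈ B → w ∈ V → adj H u w ≡ true → w ∈ B ⊎ w ∈ ∂A
      B-side u w u∈ w∈ e with bool? (A w) | bool? (hasNb A w)
      ... | inj₁ p | _ = ⊥-elim (false≢true (not⁻ (proj₂ (∧⁻ u∈))) (hasNb⁺ p (trans (sym H w u) e)))
      ... | inj₂ p | inj₁ q = inj₂ (∧⁺ (∧⁺ w∈ (not⁺ p)) q)
      ... | inj₂ p | inj₂ q = inj₁ (∧⁺ (∧⁺ w∈ (not⁺ p)) (not⁺ q))
      go : ∀ X → X ⊆ V → 1 ≤ # X → # X ≤ 2 ^ j * b →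
        (∀ u → u ∈ X → ∀ w → w ∈ V → adj H u w ≡ true → w ∈ X ⊎ w ∈ ∂A) →
        ∃[ V′ ] (V′ ⊆ V × 1 ≤ # V′ × (∀ u → u ∈ V′ → a ≤ deg H V′ u) × Expanding κ V′)
      go X X⊆V neX sizeX side with expanding-subset b<a j X neX sizeX degX
        where
        degX : ∀ u → u ∈ X → a + j * κ ≤ deg H X u
        degX u u∈ = linear 0 (degs u (X⊆V u u∈) ⊕ split ⊕ <⇒≤ small) (arith a j κ (deg H V u) (deg H X u) (# ∂A))
          where
          split : deg H V u ≤ deg H X u + # ∂A
          split = ≤-sub-bound (λ w p → let q , r = ∧⁻ p in
            [ (λ x → inj₁ (∧⁺ x r)) , inj₂ ]′ (side u u∈ w q r))
          opaque
            arith : ∀ a j κ v x b → x + (a + suc j * κ + v + b) ≡ a + j * κ + (v + (x + b) + κ) + 0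
            arith = solve-∀
      ... | V′ , s , rest = V′ , (λ i p → X⊆V i (s i p)) , rest

  module _ {n : ℕ} (H : Graph n) where

    Rooted : Fin n → Sub n → Set
    Rooted s C = s ∈ C × (∀ u → u ∈ C → Walk H C s u)

    Rooted-snoc : ∀ {s C t u} → Rooted s C → t ∈ C → adj H t u ≡ true → Rooted s (C ∪ ｛ u ｝)
    Rooted-snoc {s} {C} {t} {u} (s∈ , walks) t∈ e = ∨⁺ˡ s∈ , go
      where
      widen : ∀ {w} → Walk H C s w → Walk H (C ∪ ｛ u ｝) s w
      widen = walk-mono (λ i → ∨⁺ˡ)
      go : ∀ w → w ∈ C ∪ ｛ u ｝ → Walk H (C ∪ ｛ u ｝) s w
      go w p with ∨⁻ {C w} p
      ... | inj₁ q = widen (walks w q)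
      ... | inj₂ q = subst (Walk H (C ∪ ｛ u ｝) s) (∈｛｝⁻ q)
                       (walk-snoc (widen (walks t t∈)) e (∨⁺ʳ {C u} (∈｛｝ u)))

    Rooted-∪ : ∀ {s C D} → Rooted s C → Rooted s D → Rooted s (C ∪ D)
    Rooted-∪ {s} {C} {D} (s∈ , walks) (_ , walks′) = ∨⁺ˡ s∈ , λ w p →
      [ (λ q → walk-mono (λ i → ∨⁺ˡ) (walks w q)) , (λ q → walk-mono (λ i → ∨⁺ʳ {C i}) (walks′ w q)) ]′ (∨⁻ {C w} p)

    ball : Sub n → Fin n → ℕ → Sub n
    ball W s zero = ｛ s ｝
    ball W s (suc i) = ball W s i ∪ (W ∩ hasNb H (ball W s i))

    ball-⊆ : ∀ {W s} i → s ∈ W → ball W s i ⊆ W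
    ball-⊆ {W} zero s∈ w p = subst (_∈ W) (∈｛｝⁻ p) s∈
    ball-⊆ {W} {s} (suc i) s∈ w p = [ ball-⊆ i s∈ w , (λ q → proj₁ (∧⁻ q)) ]′ (∨⁻ {ball W s i w} p)

    ball-root : ∀ W s i → s ∈ ball W s i
    ball-root W s zero = ∈｛｝ s
    ball-root W s (suc i) = ∨⁺ˡ (ball-root W s i)

    path : ∀ {W s} i t → s ∈ W → t ∈ ball W s i → ∃[ C ] (C ⊆ W × # C ≤ suc i × t ∈ C × Rooted s C)
    path {W} {s} zero t s∈ p = ｛ s ｝ , ball-⊆ zero s∈ , ≤-reflexive (#-single s) , p , proj₂ (Conn-single H s)
    path {W} {s} (suc i) t s∈ p with ∨⁻ {ball W s i t} p
    ... | inj₁ q = let C , a , b , c , d = path i t s∈ q in C , a , m≤n⇒m≤1+n b , c , d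
    ... | inj₂ q with hasNb⁻ H {ball W s i} (proj₂ (∧⁻ q))
    ... | t′ , t′∈ , e with path i t′ s∈ t′∈
    ... | C , C⊆ , sz , t′∈C , rooted = C ∪ ｛ t ｝ ,
      (λ w r → [ C⊆ w , (λ x → subst (_∈ W) (∈｛｝⁻ x) (proj₁ (∧⁻ q))) ]′ (∨⁻ {C w} r)) ,
      ≤-trans (#-∪ C ｛ t ｝) (≤-trans (+-mono-≤ sz (≤-reflexive (#-single t))) (≤-reflexive (+-comm _ 1))) ,
      ∨⁺ʳ {C t} (∈｛｝ t) , Rooted-snoc rooted t′∈C e

    -- All paths start at `s`, so their union is connected; each listed vertex is charged a full
    -- path of L + 1 vertices, overlaps notwithstanding.
    path-list : ∀ {W s} L (as : List (Fin n)) → s ∈ W → W ⊆ ball W s L → All (_∈ W) as →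
      ∃[ C ] (C ⊆ W × # C ≤ 1 + length as * suc L × (∀ a → a ∈ˡ as → a ∈ C) × Rooted s C)
    path-list {W} {s} L [] s∈ cov _ = ｛ s ｝ , ball-⊆ zero s∈ , ≤-reflexive (#-single s) , (λ _ ()) , proj₂ (Conn-single H s)
    path-list {W} {s} L (a ∷ as) s∈ cov (a∈ ∷ all) with path L a s∈ (cov a a∈) | path-list L as s∈ cov all
    ... | C , C⊆ , szC , a∈C , rC | D , D⊆ , szD , as∈D , rD = C ∪ D ,
      (λ w p → [ C⊆ w , D⊆ w ]′ (∨⁻ {C w} p)) ,
      ≤-trans (#-∪ C D) (≤-trans (+-mono-≤ szC szD) (≤-reflexive (arith (suc L) (length as * suc L)))) ,
      mem , Rooted-∪ rC rD
      where
      opaque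
        arith : ∀ a b → a + (1 + b) ≡ 1 + (a + b)
        arith = solve-∀
      mem : ∀ b → b ∈ˡ a ∷ as → b ∈ C ∪ D
      mem b (here refl) = ∨⁺ˡ a∈C
      mem b (there q) = ∨⁺ʳ {C b} (as∈D b q)

    -- The ball has at least κ boundary vertices in V, at most κ / 2 of them in U, so a round adds
    -- at least κ / 2 vertices. Otherwise nothing of V lies beyond the boundary, and the next ball
    -- contains all of V outside U.
    ball-growth : ∀ {κ V U s} → Expanding H κ V → 2 * # U ≤ κ → s ∈ V ∖ U → ∀ i →
      i * κ ≤ 2 * # (ball (V ∖ U) s i) ⊎ (V ∖ U ⊆ ball (V ∖ U) s i)
    ball-growth ex small s∈ zero = inj₁ z≤n
    ball-growth {κ} {V} {U} {s} ex small s∈ (suc i) with ball-growth {κ} {V} {U} ex small s∈ i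
    ... | inj₂ cov = inj₂ (λ w p → ∨⁺ˡ (cov w p))
    ... | inj₁ le with ex (ball (V ∖ U) s i) (λ w p → proj₁ (∧⁻ (ball-⊆ i s∈ w p))) (#-pos {i = s} (ball-root (V ∖ U) s i))
    ... | inj₂ none = inj₂ cov
      where
      cov : V ∖ U ⊆ ball (V ∖ U) s (suc i)
      cov w p with bool? (ball (V ∖ U) s i w) | bool? (hasNb H (ball (V ∖ U) s i) w)
      ... | inj₁ q | _ = ∨⁺ˡ q
      ... | inj₂ q | inj₁ r = ∨⁺ʳ {ball (V ∖ U) s i w} (∧⁺ p r)
      ... | inj₂ q | inj₂ r = false≢true (none w) (∧⁺ (∧⁺ (proj₁ (∧⁻ p)) (not⁺ q)) (not⁺ r))
    ... | inj₁ bd = inj₁ (linear 0 (le ⊕ 2 ⊛ bd ⊕ 2 ⊛ new ⊕ small ⊕ 2 ⊛ ≤-reflexive (≡-sym (#-split B′ B)) ⊕ 2 ⊛ old)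
        (arith i κ (# B) (# (boundary H V B)) (# (B′ ∖ B)) (# U) (# B′) (# (B′ ∩ B))))
      where
      B B′ : Sub n
      B = ball (V ∖ U) s i
      B′ = ball (V ∖ U) s (suc i)
      new : # (boundary H V B) ≤ # (B′ ∖ B) + # U
      new = ≤-sub-bound bound
        where
        bound : ∀ w → w ∈ boundary H V B → w ∈ B′ ∖ B ⊎ w ∈ U
        bound w p with bool? (U w) | ∧⁻ {(V ∖ B) w} p
        ... | inj₁ u | _ = inj₂ u
        ... | inj₂ u | q , r = inj₁ (∧⁺ (∨⁺ʳ {B w} (∧⁺ (∧⁺ (proj₁ (∧⁻ q)) (not⁺ u)) r)) (proj₂ (∧⁻ q)))
      old : # B ≤ # (B′ ∩ B)
      old = #-mono (λ w p → ∧⁺ (∨⁺ˡ p) p)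
      opaque
        arith : ∀ i κ b d x u b′ c →
          2 * b′ + (i * κ + 2 * κ + 2 * d + 2 * u + 2 * (c + x) + 2 * b)
          ≡ suc i * κ + (2 * b + 2 * d + 2 * (x + u) + κ + 2 * b′ + 2 * c) + 0
        arith = solve-∀

    -- At κ / 2 per round, 2 D + 1 rounds would produce more than D κ vertices, which V does not
    -- have.
    ball-covers : ∀ {κ V U s} D → Expanding H κ V → 1 ≤ κ → # V ≤ D * κ → 2 * # U ≤ κ → s ∈ V ∖ U →
      V ∖ U ⊆ ball (V ∖ U) s (suc (2 * D))
    ball-covers {κ} {V} {U} {s} D ex κ≥1 size small s∈ with ball-growth {κ} {V} {U} ex small s∈ (suc (2 * D))
    ... | inj₂ cov = cov
    ... | inj₁ le = ⊥-elim (<-irrefl refl (linear {y = 0} 0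
        (κ≥1 ⊕ le ⊕ 2 ⊛ #-mono {Q = V} (λ w p → proj₁ (∧⁻ (ball-⊆ (suc (2 * D)) s∈ w p))) ⊕ 2 ⊛ size)
        (arith κ D (# (ball (V ∖ U) s (suc (2 * D)))) (# V))))
      where
      opaque
        arith : ∀ κ D b v → 0 + (1 + suc (2 * D) * κ + 2 * b + 2 * v) ≡ 1 + (κ + 2 * b + 2 * v + 2 * (D * κ)) + 0
        arith = solve-∀

-- Touching connected sets that dominate most of an expanding set.

module Domination where

  open Prelude
  open Counting
  open Minors
  open Expansion
  open import Data.List using (List; []; _∷_; _++_; length)
  open import Data.List.Properties using (length-++)
  open import Data.List.Relation.Unary.All using (All; []; _∷_)
  open import Data.List.Relation.Unary.All.Properties using (++⁺)
  open import Data.List.Membership.Propositional using () renaming (_∈_ to _∈ˡ_)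
  open import Data.List.Membership.Propositional.Properties using (∈-++⁺ˡ; ∈-++⁺ʳ)

  Touch-sym : ∀ {n} (H : Graph n) {C D} → Touch H C D → Touch H D C
  Touch-sym H (u , v , u∈ , v∈ , e) = v , u , v∈ , u∈ , trans (sym H v u) e

  -- V has at most D κ vertices and expands; every vertex of V, and every outside vertex counted as Rich,
  -- keeps at least c κ neighbours in V when at most κ / 2 vertices of V are used up.
  module Groups {n : ℕ} (H : Graph n) (V : Sub n) (κ D c z h : ℕ) .⦃ z≢0 : NonZero z ⦄
    (num : 2 * z ^ h ≤ suc z ^ h) (κ≥1 : 1 ≤ κ) (c≥1 : 1 ≤ c) (D≤ : D ≤ c * suc z)
    (size : # V ≤ D * κ) (V≢∅ : 1 ≤ # V) (expand : Expanding H κ V)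
    where

    Rich : Fin n → Set
    Rich x = 2 * (c * κ) + κ ≤ 2 * deg H V x

    module _ (rich : ∀ u → u ∈ V → Rich u) where

      -- A path inside a ball of radius 2 D + 1 has at most 2 D + 2 vertices; this is the price of
      -- joining one pick to the root.
      pickCost : ℕ
      pickCost = suc (suc (2 * D))

      -- The price of a set per unit of `k`: `h` picks to dominate most of V, `h` to dominate Y, one
      -- to escape the earlier bad sets, and one more unit that absorbs the root.
      groupCost : ℕ
      groupCost = (2 * h + 2) * pickCost

      module Free (U : Sub n) (small : 2 * # U ≤ κ) where

        W : Sub n
        W = V ∖ U

        opaque
          rich-W : ∀ x → Rich x → c * κ ≤ deg H W x
          rich-W x r = *-cancelˡ-≤ 2 (linear 0 (r ⊕ 2 ⊛ split ⊕ small) (arith (c * κ) κ (deg H V x) (deg H W x) (# U)))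
            where
            split : deg H V x ≤ deg H W x + # U
            split = ≤-sub-bound bound
              where
              bound : ∀ w → w ∈ N[_,_] H V x → w ∈ N[_,_] H W x ⊎ w ∈ U
              bound w p with bool? (U w) | ∧⁻ {V w} p
              ... | inj₁ u | _ = inj₂ u
              ... | inj₂ u | q , r = inj₁ (∧⁺ (∧⁺ q (not⁺ u)) r)
            opaque
              arith : ∀ x κ v w u → 2 * w + (2 * x + κ + 2 * v + 2 * u) ≡ 2 * x + (2 * v + 2 * (w + u) + κ) + 0
              arith = solve-∀

          cκ≤W : c * κ ≤ # W
          cκ≤W with #-witness V≢∅
          ... | u , u∈ = ≤-trans (rich-W u (rich u u∈)) (deg≤# H W u)

          W≢∅ : 1 ≤ # W
          W≢∅ = ≤-trans (*-mono-≤ c≥1 κ≥1) cκ≤W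

          W⊆V : W ⊆ V
          W⊆V w p = proj₁ (∧⁻ p)

          V≤ : ∀ {x} → c * κ ≤ x → # V ≤ suc z * x
          V≤ {x} le = begin
            # V                ≤⟨ size ⟩
            D * κ              ≤⟨ *-monoˡ-≤ κ D≤ ⟩
            c * suc z * κ      ≡⟨ comm c (suc z) κ ⟩
            suc z * (c * κ)    ≤⟨ suc z ⊛ le ⟩
            suc z * x          ∎
            where
            open ≤-Reasoning
            opaque
              comm : ∀ a b c → a * b * c ≡ b * (a * c)
              comm = solve-∀

        opaque
          -- A rich vertex keeps c κ neighbours in `W`, a share of at least 1 / (z + 1) because |V|
          -- ≤ D κ ≤ c (z + 1) κ. By `num`, `h` picks halve what is still undominated.
          dominate : ∀ k (O : Sub n) → (∀ y → y ∈ O → Rich y) →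
            ∃[ as ] (length as ≡ h * k × All (_∈ W) as × 2 ^ k * # (λ o → O o ∧ miss (adj H) o as) ≤ # O)
          dominate k O richO = greedy-halving z h k W O (adj H) num W≢∅
            (λ y y∈ → ≤-trans (#-mono W⊆V) (V≤ (rich-W y (richO y y∈))))

          escaped : ∀ {t} k (bad : Fin t → Sub n) → (∀ i → 2 ^ k * # (bad i) ≤ # V) →
            ∀ i → 2 ^ k * # (λ a → W a ∧ not (not (bad i a))) ≤ suc z * # W
          escaped k bad sz i = begin
            2 ^ k * # (λ a → W a ∧ not (not (bad i a)))   ≤⟨ *-monoʳ-≤ (2 ^ k) (#-mono (λ a p → not-not (proj₂ (∧⁻ {W a} p)))) ⟩
            2 ^ k * # (bad i)                             ≤⟨ sz i ⟩
            # V                                           ≤⟨ V≤ cκ≤W ⟩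
            suc z * # W                                   ∎
            where
            open ≤-Reasoning
            not-not : ∀ {b} → not (not b) ≡ true → b ≡ true
            not-not {true} _ = refl

          -- A bad set has at most |V| / 2^k ≤ (z + 1) |W| / 2^k elements, so `m` picks all fall
          -- into a given one at a rate of at most ((z + 1) / 2^k)^m, below 1 / t by hypothesis. For
          -- m = k the exponent is quadratic in k, which is why k of order sqrt(log r) suffices.
          avoid : ∀ {t} m k (bad : Fin t → Sub n) → (∀ i → 2 ^ k * # (bad i) ≤ # V) → suc z ^ m * t < (2 ^ k) ^ m →
            ∃[ as ] (length as ≡ m × All (_∈ W) as × (∀ i → ∃[ a ] (a ∈ˡ as × a ∉ bad i)))
          avoid {t} m k bad sz lt with greedy-all (suc z) m k W (λ _ → true) (λ i a → not (bad i a)) W≢∅ (λ i _ → escaped k bad sz i)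
              (subst (λ x → suc z ^ m * x < (2 ^ k) ^ m) (≡-sym (#-full t)) lt)
          ... | as , len , all , hit = as , len , all , λ i → let a , a∈ , e = hit i refl in a , a∈ , not⁻ e

          connect : ∀ {s} as → s ∈ W → All (_∈ W) as →
            ∃[ C ] (C ⊆ W × # C ≤ 1 + length as * pickCost × (∀ a → a ∈ˡ as → a ∈ C) × Rooted H s C)
          connect as s∈ all = path-list H _ as s∈ (ball-covers H {U = U} D expand κ≥1 size small s∈) all

      -- bad i is the part of V out of reach of set i; a later set touches set i as soon as it contains a vertex outside bad i.
      record Dominators (k : ℕ) (Y : Sub n) (t : ℕ) : Set where
        field
          used     : Sub n
          used⊆V   : used ⊆ V
          used≤    : # used ≤ t * (k * groupCost)
          set      : Fin t → Sub n
          set⊆     : ∀ i → set i ⊆ used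
          set-conn : ∀ i → Conn H (set i)
          set-disj : ∀ i j w → w ∈ set i → w ∈ set j → i ≡ j
          touching : ∀ i j → ¬ i ≡ j → Touch H (set i) (set j)
          bad      : Fin t → Sub n
          bad≤     : ∀ i → 2 ^ k * # (bad i) ≤ # V
          good     : ∀ i y → y ∈ V → y ∉ bad i → ∃[ a ] (a ∈ set i × adj H a y ≡ true)
          domY     : ∀ i y → y ∈ Y → ∃[ a ] (a ∈ set i × adj H a y ≡ true)

      open Dominators

      no-dominators : ∀ k Y → Dominators k Y 0
      no-dominators k Y = record
        { used = ∅ ; used⊆V = λ _ () ; used≤ = ≤-reflexive (#-∅ (λ _ → refl)) ; set = λ () ; set⊆ = λ () ; set-conn = λ ()
        ; set-disj = λ () ; touching = λ () ; bad = λ () ; bad≤ = λ () ; good = λ () ; domY = λ () }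

      -- The new set joins three lists of picks to one root. `as₁` leaves only a fraction 2^(-k) of
      -- V undominated, which becomes the bad set of the new set; `as₂` dominates all of Y, since
      -- fewer than 2^k vertices halved k times leave none; `as₃` has a vertex outside each earlier
      -- bad set and so touches every earlier set.
      add-dominator : ∀ {k Y t} → 1 ≤ k → (∀ y → y ∈ Y → Rich y) → # Y < 2 ^ k → suc z ^ k * t < (2 ^ k) ^ k →
        2 * (t * (k * groupCost)) ≤ κ → Dominators k Y t → Dominators k Y (suc t)
      add-dominator {k} {Y} {t} k≥1 richY Y< t< budget S = result
        where
        U = used S
        open Free U (≤-trans (2 ⊛ used≤ S) budget)
        root = #-witness W≢∅
        s = proj₁ root
        P₁ = dominate k V rich
        P₂ = dominate k Y richY
        P₃ = avoid k k (bad S) (bad≤ S) t<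
        as₁ = proj₁ P₁
        as₂ = proj₁ P₂
        as₃ = proj₁ P₃
        as = as₁ ++ (as₂ ++ as₃)
        linked = connect {s} as (proj₂ root)
          (++⁺ (proj₁ (proj₂ (proj₂ P₁))) (++⁺ (proj₁ (proj₂ (proj₂ P₂))) (proj₁ (proj₂ (proj₂ P₃)))))
        C = proj₁ linked
        C⊆W : C ⊆ W
        C⊆W = proj₁ (proj₂ linked)
        C∋ : ∀ a → a ∈ˡ as → a ∈ C
        C∋ = proj₁ (proj₂ (proj₂ (proj₂ linked)))
        C-rooted : Rooted H s C
        C-rooted = proj₂ (proj₂ (proj₂ (proj₂ linked)))
        fresh : ∀ i w → w ∈ C → w ∈ set S i → ⊥
        fresh i w p q = false≢true (not⁻ (proj₂ (∧⁻ (C⊆W w p)))) (set⊆ S i w q)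
        hits : ∀ i → Touch H C (set S i)
        hits i with proj₂ (proj₂ (proj₂ P₃)) i
        ... | a , a∈ , a∉ with C∋ a (∈-++⁺ʳ as₁ (∈-++⁺ʳ as₂ a∈))
        ... | a∈C with good S i a (W⊆V a (C⊆W a a∈C)) a∉
        ... | b , b∈ , e = a , b , a∈C , b∈ , trans (sym H a b) e
        lenas : length as ≡ h * k + (h * k + k)
        lenas = trans (length-++ as₁) (cong₂ _+_ (proj₁ (proj₂ P₁))
                 (trans (length-++ as₂) (cong₂ _+_ (proj₁ (proj₂ P₂)) (proj₁ (proj₂ P₃)))))
        #C : # C ≤ k * groupCost
        #C = begin
          # C                                                   ≤⟨ proj₁ (proj₂ (proj₂ linked)) ⟩
          1 + length as * pickCost                              ≡⟨ cong (λ y → 1 + y * pickCost) lenas ⟩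
          1 + (h * k + (h * k + k)) * pickCost                  ≤⟨ +-monoˡ-≤ _ (*-mono-≤ k≥1 (s≤s {n = suc (2 * D)} z≤n)) ⟩
          k * pickCost + (h * k + (h * k + k)) * pickCost       ≡⟨ arith k h pickCost ⟩
          k * groupCost                                         ∎
          where
          open ≤-Reasoning
          opaque
            arith : ∀ k h p → k * p + (h * k + (h * k + k)) * p ≡ k * ((2 * h + 2) * p)
            arith = solve-∀
        set′ bad′ : Fin (suc t) → Sub n
        set′ zero = C
        set′ (suc i) = set S i
        bad′ zero = λ y → V y ∧ miss (adj H) y as₁
        bad′ (suc i) = bad S i
        allY : ∀ y → y ∈ Y → ∃[ a ] (a ∈ C × adj H a y ≡ true)
        allY y y∈ with miss-false (adj H) y as₂ (≢true⇒false (λ e → <-irrefl refl (<-≤-trans Y< (begin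
            2 ^ k                                              ≡⟨ ≡-sym (*-identityʳ _) ⟩
            2 ^ k * 1                                          ≤⟨ (2 ^ k) ⊛ #-pos {P = λ o → Y o ∧ miss (adj H) o as₂} {y} (∧⁺ y∈ e) ⟩
            2 ^ k * # (λ o → Y o ∧ miss (adj H) o as₂)         ≤⟨ proj₂ (proj₂ (proj₂ P₂)) ⟩
            # Y                                                ∎))))
          where open ≤-Reasoning
        ... | a , a∈ , e = a , C∋ a (∈-++⁺ʳ as₁ (∈-++⁺ˡ a∈)) , trans (sym H a y) e
        goodC : ∀ y → y ∈ V → y ∉ bad′ zero → ∃[ a ] (a ∈ C × adj H a y ≡ true)
        goodC y y∈ y∉ with miss-false (adj H) y as₁ (≢true⇒false (λ e → false≢true y∉ (∧⁺ y∈ e)))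
        ... | a , a∈ , e = a , C∋ a (∈-++⁺ˡ a∈) , trans (sym H a y) e
        disj′ : ∀ i j w → w ∈ set′ i → w ∈ set′ j → i ≡ j
        disj′ zero zero _ _ _ = refl
        disj′ zero (suc j) w p q = ⊥-elim (fresh j w p q)
        disj′ (suc i) zero w p q = ⊥-elim (fresh i w q p)
        disj′ (suc i) (suc j) w p q = cong suc (set-disj S i j w p q)
        touching′ : ∀ i j → ¬ i ≡ j → Touch H (set′ i) (set′ j)
        touching′ zero zero ne = ⊥-elim (ne refl)
        touching′ zero (suc j) _ = hits j
        touching′ (suc i) zero _ = Touch-sym H (hits i)
        touching′ (suc i) (suc j) ne = touching S i j (λ e → ne (cong suc e))
        result : Dominators k Y (suc t)
        result = record
          { used = C ∪ U
          ; used⊆V = λ w p → [ (λ q → W⊆V w (C⊆W w q)) , used⊆V S w ]′ (∨⁻ {C w} p)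
          ; used≤ = ≤-trans (#-∪ C U) (+-mono-≤ #C (used≤ S))
          ; set = set′
          ; set⊆ = λ { zero w p → ∨⁺ˡ p ; (suc i) w p → ∨⁺ʳ {C w} (set⊆ S i w p) }
          ; set-conn = λ { zero → s , C-rooted ; (suc i) → set-conn S i }
          ; set-disj = disj′
          ; touching = touching′
          ; bad = bad′
          ; bad≤ = λ { zero → proj₂ (proj₂ (proj₂ P₁)) ; (suc i) → bad≤ S i }
          ; good = λ { zero → goodC ; (suc i) → good S i }
          ; domY = λ { zero → allY ; (suc i) → domY S i } }

      dominators : ∀ {k Y} t → 1 ≤ k → (∀ y → y ∈ Y → Rich y) → # Y < 2 ^ k → suc z ^ k * t < (2 ^ k) ^ k →
        2 * (t * (k * groupCost)) ≤ κ → Dominators k Y t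
      dominators zero _ _ _ _ _ = no-dominators _ _
      dominators {k} (suc t) k≥1 richY Y< t< budget = add-dominator k≥1 richY Y< t<′ budget′ (dominators t k≥1 richY Y< t<′ budget′)
        where
        t<′ = ≤-<-trans ((suc z ^ k) ⊛ n≤1+n t) t<
        budget′ = ≤-trans (2 ⊛ *-monoˡ-≤ (k * groupCost) (n≤1+n t)) budget

      -- For vertices `x i` that may be too many to be dominated together as `Y`. Each receives a
      -- connected set of its own in V, built around `j` picks, and it is this set that meets all
      -- dominators. Contact between two extensions is not asked for: the `x i` will come from a
      -- clique.
      record Extensions {k Y q} (S : Dominators k Y q) (j : ℕ) {m : ℕ} (x : Fin m → Fin n) : Set where
        field
          used′    : Sub n
          used′⊆V  : used′ ⊆ V
          used⊆    : used S ⊆ used′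
          used′≤   : # used′ ≤ q * (k * groupCost) + m * (j * groupCost)
          ext      : Fin m → Sub n
          ext⊆     : ∀ i → ext i ⊆ used′
          ext-new  : ∀ i w → w ∈ ext i → w ∉ used S
          ext-conn : ∀ i → Conn H (ext i)
          ext-disj : ∀ i i′ w → w ∈ ext i → w ∈ ext i′ → i ≡ i′
          attached : ∀ i → ∃[ a ] (a ∈ ext i × adj H (x i) a ≡ true)
          meets    : ∀ i i′ → Touch H (ext i) (set S i′)

      open Extensions

      extensions : ∀ {k Y q} (S : Dominators k Y q) j m (x : Fin m → Fin n) → 1 ≤ j → (∀ i → Rich (x i)) →
        suc z ^ j * q < (2 ^ k) ^ j → 2 * (q * (k * groupCost) + m * (j * groupCost)) ≤ κ → Extensions S j x
      extensions {k} {q = q} S j zero x j≥1 richx q< budget = record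
        { used′ = used S ; used′⊆V = used⊆V S ; used⊆ = λ _ p → p ; used′≤ = ≤-trans (used≤ S) (m≤m+n _ 0)
        ; ext = λ () ; ext⊆ = λ () ; ext-new = λ () ; ext-conn = λ () ; ext-disj = λ () ; attached = λ () ; meets = λ () }
      extensions {k} {Y} {q} S j (suc m) x j≥1 richx q< budget = result
        where
        budget′ = ≤-trans (2 ⊛ +-monoʳ-≤ (q * (k * groupCost)) (*-monoˡ-≤ (j * groupCost) (n≤1+n m))) budget
        E = extensions S j m (x ∘ suc) j≥1 (λ i → richx (suc i)) q< budget′
        U = used′ E
        open Free U (≤-trans (2 ⊛ used′≤ E) budget′)
        -- The root is a free neighbour of `x zero`, so that the extension is attached to it.
        root = #-witness {P = N[_,_] H W (x zero)} (≤-trans (*-mono-≤ c≥1 κ≥1) (rich-W (x zero) (richx zero)))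
        s = proj₁ root
        P₃ = avoid j k (bad S) (bad≤ S) q<
        as = proj₁ P₃
        linked = connect {s} as (proj₁ (∧⁻ (proj₂ root))) (proj₁ (proj₂ (proj₂ P₃)))
        C = proj₁ linked
        C⊆W : C ⊆ W
        C⊆W = proj₁ (proj₂ linked)
        C-rooted : Rooted H s C
        C-rooted = proj₂ (proj₂ (proj₂ (proj₂ linked)))
        #C : # C ≤ j * groupCost
        #C = begin
          # C                           ≤⟨ proj₁ (proj₂ (proj₂ linked)) ⟩
          1 + length as * pickCost      ≡⟨ cong (λ y → 1 + y * pickCost) (proj₁ (proj₂ P₃)) ⟩
          1 + j * pickCost              ≤⟨ +-monoˡ-≤ _ (*-mono-≤ j≥1 (s≤s {n = suc (2 * D)} z≤n)) ⟩
          j * pickCost + j * pickCost   ≤⟨ m≤m+n _ (j * (2 * h * pickCost)) ⟩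
          j * pickCost + j * pickCost + j * (2 * h * pickCost)   ≡⟨ arith j h pickCost ⟩
          j * groupCost                 ∎
          where
          open ≤-Reasoning
          opaque
            arith : ∀ j h p → j * p + j * p + j * (2 * h * p) ≡ j * ((2 * h + 2) * p)
            arith = solve-∀
        notU : ∀ w → w ∈ C → w ∉ U
        notU w p = not⁻ (proj₂ (∧⁻ (C⊆W w p)))
        ext′ : Fin (suc m) → Sub n
        ext′ zero = C
        ext′ (suc i) = ext E i
        disj′ : ∀ i j w → w ∈ ext′ i → w ∈ ext′ j → i ≡ j
        disj′ zero zero _ _ _ = refl
        disj′ zero (suc j) w p q = false≢true (notU w p) (ext⊆ E j w q)
        disj′ (suc i) zero w p q = false≢true (notU w q) (ext⊆ E i w p)
        disj′ (suc i) (suc j) w p q = cong suc (ext-disj E i j w p q)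
        new′ : ∀ i w → w ∈ ext′ i → w ∉ used S
        new′ zero w p = ≢true⇒false (λ e → false≢true (notU w p) (used⊆ E w e))
        new′ (suc i) = ext-new E i
        meetsC : ∀ i → Touch H C (set S i)
        meetsC i with proj₂ (proj₂ (proj₂ P₃)) i
        ... | a , a∈ , a∉ with proj₁ (proj₂ (proj₂ (proj₂ linked))) a a∈
        ... | a∈C with good S i a (W⊆V a (C⊆W a a∈C)) a∉
        ... | b , b∈ , e = a , b , a∈C , b∈ , trans (sym H a b) e
        result : Extensions S j x
        result = record
          { used′ = C ∪ U
          ; used′⊆V = λ w p → [ (λ r → W⊆V w (C⊆W w r)) , used′⊆V E w ]′ (∨⁻ {C w} p)
          ; used⊆ = λ w p → ∨⁺ʳ {C w} (used⊆ E w p)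
          ; used′≤ = ≤-trans (#-∪ C U) (≤-trans (+-mono-≤ #C (used′≤ E)) (≤-reflexive (arith (j * groupCost) (q * (k * groupCost)) m)))
          ; ext = ext′
          ; ext⊆ = λ { zero w p → ∨⁺ˡ p ; (suc i) w p → ∨⁺ʳ {C w} (ext⊆ E i w p) }
          ; ext-new = new′
          ; ext-conn = λ { zero → s , C-rooted ; (suc i) → ext-conn E i }
          ; ext-disj = disj′
          ; attached = λ { zero → s , proj₁ C-rooted , proj₂ (∧⁻ {W s} (proj₂ root)) ; (suc i) → attached E i }
          ; meets = λ { zero → meetsC ; (suc i) → meets E i } }
          where
          opaque
            arith : ∀ a b m → a + (b + m * a) ≡ b + suc m * a
            arith = solve-∀

-- Numerical conditions on the sizes of the sets.

module Parameters where

  open Prelude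
  open Counting

  square-cancel-< : ∀ {a b} → a * a < b * b → a < b
  square-cancel-< {a} {b} lt = ≰⇒> (λ b≤a → <-irrefl refl (<-≤-trans lt (*-mono-≤ b≤a b≤a)))

  m<suc[m/n]*n : ∀ m n .⦃ _ : NonZero n ⦄ → m < suc (m / n) * n
  m<suc[m/n]*n m n = begin-strict
    m                        ≡⟨ m≡m%n+[m/n]*n m n ⟩
    m % n + m / n * n  <⟨ +-monoˡ-< (m / n * n) (m%n<n m n) ⟩
    n + m / n * n            ∎
    where open ≤-Reasoning

  -- 1280 = 2 · 20 · 32: twice the number of vertices used, 19 d + d for dominators and extensions
  -- together, and d ≤ 32 κ.
  budget-bound : ∀ C g d κ q k m j → 1 ≤ C → 1280 * g ≤ C → d ≤ 32 * κ → q * k * C ≤ 19 * d → m * j * C ≤ d →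
    2 * (q * (k * g) + m * (j * g)) ≤ κ
  budget-bound C g d κ q k m j C≥1 g≤ d≤ qk mj = *-cancelˡ-≤ C ⦃ >-nonZero C≥1 ⦄ (begin
    C * (2 * (q * (k * g) + m * (j * g)))     ≡⟨ eq₁ C g q k m j ⟩
    2 * g * (q * k * C + m * j * C)           ≤⟨ (2 * g) ⊛ (qk ⊕ mj) ⟩
    2 * g * (19 * d + d)                      ≡⟨ eq₂ g d ⟩
    40 * g * d                                ≤⟨ (40 * g) ⊛ d≤ ⟩
    40 * g * (32 * κ)                         ≡⟨ eq₃ g κ ⟩
    1280 * g * κ                              ≤⟨ *-monoˡ-≤ κ g≤ ⟩
    C * κ                                     ∎)
    where
    open ≤-Reasoning
    opaque
      eq₁ : ∀ C g q k m j → C * (2 * (q * (k * g) + m * (j * g))) ≡ 2 * g * (q * k * C + m * j * C)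
      eq₁ = solve-∀
    opaque
      eq₂ : ∀ g d → 2 * g * (19 * d + d) ≡ 40 * g * d
      eq₂ = solve-∀
    opaque
      eq₃ : ∀ g κ → 40 * g * (32 * κ) ≡ 1280 * g * κ
      eq₃ = solve-∀

  power-bound : ∀ m k t lam → t < 2 ^ suc lam → 6 * m + suc lam ≤ k * m → 64 ^ m * t < (2 ^ k) ^ m
  power-bound m k t lam t< le = begin-strict
    64 ^ m * t                  <⟨ *-monoʳ-< (64 ^ m) ⦃ m^n≢0 64 m ⦄ t< ⟩
    64 ^ m * 2 ^ suc lam        ≡⟨ cong (_* 2 ^ suc lam) (^-*-assoc 2 6 m) ⟩
    2 ^ (6 * m) * 2 ^ suc lam   ≡⟨ ≡-sym (^-distribˡ-+-* 2 (6 * m) (suc lam)) ⟩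
    2 ^ (6 * m + suc lam)       ≤⟨ ^-monoʳ-≤ 2 le ⟩
    2 ^ (k * m)                 ≡⟨ ≡-sym (^-*-assoc 2 k m) ⟩
    (2 ^ k) ^ m                 ∎
    where open ≤-Reasoning

  k≥14 : ∀ k lam → 1 ≤ lam → 200 * lam ≤ suc k * suc k → 14 ≤ k
  k≥14 k lam λ≥1 le = ≤-pred (square-cancel-< {14} {suc k} (<-≤-trans (s≤s (m≤m+n 196 3)) (≤-trans (200 ⊛ λ≥1) le)))

  -- After doubling, one half of 2 k j covers 12 j since k ≥ 12. The other covers 2 + 2 λ ≤ 4 λ:
  -- since (k + 1) (j + 1) ≤ 4 k j, the last hypothesis gives 4 λ ≤ k j.
  product-exponent : ∀ k j lam → 14 ≤ k → 1 ≤ j → 1 ≤ lam → 16 * lam ≤ suc k * suc j → 6 * j + suc lam ≤ k * j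
  product-exponent k j lam k≥14 j≥1 λ≥1 le = *-cancelˡ-≤ 2 (begin
    2 * (6 * j + suc lam)            ≡⟨ eq₁ j lam ⟩
    12 * j + (2 * 1 + 2 * lam)       ≤⟨ *-monoˡ-≤ j (≤-trans (m≤m+n 12 2) k≥14) ⊕ (2 ⊛ λ≥1 ⊕ ≤-refl {2 * lam}) ⟩
    k * j + (2 * lam + 2 * lam)      ≡⟨ eq₂ (k * j) lam ⟩
    k * j + 4 * lam                  ≤⟨ +-monoʳ-≤ (k * j) four ⟩
    k * j + k * j                    ≡⟨ eq₃ (k * j) ⟩
    2 * (k * j)                      ∎)
    where
    open ≤-Reasoning
    opaque
      eq₁ : ∀ j l → 2 * (6 * j + suc l) ≡ 12 * j + (2 * 1 + 2 * l)
      eq₁ = solve-∀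
    opaque
      eq₂ : ∀ x l → x + (2 * l + 2 * l) ≡ x + 4 * l
      eq₂ = solve-∀
    opaque
      eq₃ : ∀ x → x + x ≡ 2 * x
      eq₃ = solve-∀
    opaque
      eq₄ : ∀ l → 4 * (4 * l) ≡ 16 * l
      eq₄ = solve-∀
    opaque
      eq₅ : ∀ k j → 2 * k * (2 * j) ≡ 4 * (k * j)
      eq₅ = solve-∀
    suc≤2* : ∀ {m} → 1 ≤ m → suc m ≤ 2 * m
    suc≤2* {m} m≥1 = +-mono-≤ m≥1 (≤-reflexive (≡-sym (+-identityʳ m)))
    four : 4 * lam ≤ k * j
    four = *-cancelˡ-≤ 4 (begin
      4 * (4 * lam)          ≡⟨ eq₄ lam ⟩
      16 * lam               ≤⟨ le ⟩
      suc k * suc j          ≤⟨ *-mono-≤ (suc≤2* (≤-trans (s≤s z≤n) k≥14)) (suc≤2* j≥1) ⟩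
      2 * k * (2 * j)        ≡⟨ eq₅ k j ⟩
      4 * (k * j)            ∎)

  square-exponent : ∀ k lam → 1 ≤ lam → 200 * lam ≤ suc k * suc k → 6 * k + suc lam ≤ k * k
  square-exponent k lam λ≥1 le = product-exponent k k lam 14≤k (≤-trans (s≤s z≤n) 14≤k) λ≥1
    (≤-trans (*-monoˡ-≤ lam (m≤m+n 16 184)) le)
    where
    14≤k = k≥14 k lam λ≥1 le

  -- g is the cost of a group per unit of its size; the factor 19 comes from many * l ≤ 19 * d, the factor 200 from the
  -- rounding in k = ⌊l / C⌋.
  record Sizes (C g l r lam d : ℕ) : Set where
    field
      C≥1   : 1 ≤ C
      g≤    : 1280 * g ≤ C
      l≥1   : 1 ≤ l
      r≥1   : 1 ≤ r
      λ≥1   : 1 ≤ lam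
      r<    : r < 2 ^ suc lam
      l≤d   : l ≤ d
      prod  : 19 * (200 * (C * C)) * (r * lam) ≤ d * l

  module _ {C g l r lam d : ℕ} (S : Sizes C g l r lam d) where

    open Sizes S
    open ≤-Reasoning

    private instance
      C≢0 : NonZero C
      C≢0 = >-nonZero C≥1
      l≢0 : NonZero l
      l≢0 = >-nonZero l≥1
      r≢0 : NonZero r
      r≢0 = >-nonZero r≥1
      Cr≢0 : NonZero (C * r)
      Cr≢0 = m*n≢0 C r

    -- From d² ≥ d l ≥ 3800 > 16²; it makes κ = ⌊d / 16⌋ positive.
    d≥16 : 16 ≤ d
    d≥16 = <⇒≤ (square-cancel-< (<-≤-trans (s≤s (m≤m+n 256 3543)) (begin
      19 * (200 * (1 * 1)) * (1 * 1)             ≤⟨ *-mono-≤ (19 ⊛ 200 ⊛ *-mono-≤ C≥1 C≥1) (*-mono-≤ r≥1 λ≥1) ⟩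
      19 * (200 * (C * C)) * (r * lam)           ≤⟨ prod ⟩
      d * l                                      ≤⟨ d ⊛ l≤d ⟩
      d * d                                      ∎)))

    -- The l pieces save `many` * l > 18 d vertices of S. Of these, 14 d make up for vertices
    -- unusable for a piece and d for the deficit of |S|; 3 d is slack. The successor gives
    -- strictness, which absorbs the 1 in l r ≤ β + 1.
    many : ℕ
    many = suc (18 * d / l)

    many-lower : 18 * d < many * l
    many-lower = m<suc[m/n]*n (18 * d) l

    many-upper : many * l ≤ 19 * d
    many-upper = begin
      l + 18 * d / l * l     ≤⟨ +-mono-≤ l≤d (m/n*n≤m (18 * d) l) ⟩
      d + 18 * d             ≡⟨ refl ⟩
      19 * d                 ∎

    record Plan (q : ℕ) : Set where
      field
        k       : ℕ
        k≥1     : 1 ≤ k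
        squares : 6 * k + suc lam ≤ k * k
        cost    : q * k * C ≤ 19 * d

    plan : ∀ k → 200 * lam ≤ suc k * suc k → ∀ q → q * k * C ≤ 19 * d → Plan q
    plan k k-large q c = record
      { k = k ; k≥1 = ≤-trans (s≤s z≤n) (k≥14 k lam λ≥1 k-large) ; squares = square-exponent k lam λ≥1 k-large ; cost = c }

    -- All r branch sets are to lie in V, which leaves k ≈ d / (C r) for each. From r l ≤ 19 d
    -- follows (d / r)² ≥ d l / (19 r) ≥ 200 C² λ; the factor 19 of the product bound is spent here.
    dense-plan : r ≤ many → Plan r
    dense-plan r≤q = plan k k-large r (begin
      r * k * C               ≡⟨ eq₁ r k C ⟩
      k * (C * r)             ≤⟨ m/n*n≤m d (C * r) ⟩
      d                       ≤⟨ m≤m+n d (18 * d) ⟩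
      19 * d                  ∎)
      where
      k = d / (C * r)
      opaque
        eq₁ : ∀ r k C → r * k * C ≡ k * (C * r)
        eq₁ = solve-∀
      opaque
        eq₂ : ∀ C r l → (19 * (C * C * (r * r))) * (200 * l) ≡ 19 * (200 * (C * C)) * (r * l) * r
        eq₂ = solve-∀
      opaque
        eq₃ : ∀ d l r → d * l * r ≡ d * (r * l)
        eq₃ = solve-∀
      opaque
        eq₄ : ∀ d → d * (19 * d) ≡ 19 * (d * d)
        eq₄ = solve-∀
      opaque
        eq₅ : ∀ x C r → 19 * (x * (C * r) * (x * (C * r))) ≡ (19 * (C * C * (r * r))) * (x * x)
        eq₅ = solve-∀
      d< : d < suc k * (C * r)
      d< = m<suc[m/n]*n d (C * r)
      k-large : 200 * lam ≤ suc k * suc k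
      k-large = *-cancelˡ-≤ (19 * (C * C * (r * r)))
        ⦃ m*n≢0 19 (C * C * (r * r)) ⦃ _ ⦄ ⦃ m*n≢0 (C * C) (r * r) ⦃ m*n≢0 C C ⦄ ⦃ m*n≢0 r r ⦄ ⦄ ⦄ (begin
        (19 * (C * C * (r * r))) * (200 * lam)             ≡⟨ eq₂ C r lam ⟩
        19 * (200 * (C * C)) * (r * lam) * r               ≤⟨ *-monoˡ-≤ r prod ⟩
        d * l * r                                          ≡⟨ eq₃ d l r ⟩
        d * (r * l)                                        ≤⟨ d ⊛ ≤-trans (*-monoˡ-≤ l r≤q) many-upper ⟩
        d * (19 * d)                                       ≡⟨ eq₄ d ⟩
        19 * (d * d)                                       ≤⟨ 19 ⊛ *-mono-≤ (<⇒≤ d<) (<⇒≤ d<) ⟩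
        19 * (suc k * (C * r) * (suc k * (C * r)))         ≡⟨ eq₅ (suc k) C r ⟩
        (19 * (C * C * (r * r))) * (suc k * suc k)         ∎)

    private
      k₀ : ℕ
      k₀ = l / C

      l< : l < suc k₀ * C
      l< = m<suc[m/n]*n l C

      cost₀ : many * k₀ * C ≤ 19 * d
      cost₀ = begin
        many * k₀ * C         ≡⟨ *-assoc many k₀ C ⟩
        many * (k₀ * C)       ≤⟨ many ⊛ m/n*n≤m l C ⟩
        many * l              ≤⟨ many-upper ⟩
        19 * d                ∎

    module _ (q<r : many < r) where

      d≤lr : d ≤ l * r
      d≤lr = begin
        d             ≤⟨ m≤m+n d (17 * d) ⟩
        18 * d        ≤⟨ <⇒≤ many-lower ⟩
        many * l      ≤⟨ *-monoˡ-≤ l (<⇒≤ q<r) ⟩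
        r * l         ≡⟨ *-comm r l ⟩
        l * r         ∎

      -- Since `many` < r gives d ≤ l r, the product bound yields l² ≥ d l / r ≥ 200 C² λ; here k is
      -- about l / C.
      k₀-large : 200 * lam ≤ suc k₀ * suc k₀
      k₀-large = *-cancelˡ-≤ (C * C * r) ⦃ m*n≢0 (C * C) r ⦃ m*n≢0 C C ⦄ ⦄ (begin
        C * C * r * (200 * lam)                    ≡⟨ eq₁ C r lam ⟩
        1 * (200 * (C * C)) * (r * lam)            ≤⟨ *-monoˡ-≤ (r * lam) (*-monoˡ-≤ (200 * (C * C)) (s≤s {n = 18} z≤n)) ⟩
        19 * (200 * (C * C)) * (r * lam)           ≤⟨ prod ⟩
        d * l                                      ≤⟨ *-monoˡ-≤ l d≤lr ⟩
        l * r * l                                  ≡⟨ eq₂ l r ⟩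
        r * (l * l)                                ≤⟨ r ⊛ *-mono-≤ (<⇒≤ l<) (<⇒≤ l<) ⟩
        r * (suc k₀ * C * (suc k₀ * C))            ≡⟨ eq₃ r (suc k₀) C ⟩
        C * C * r * (suc k₀ * suc k₀)              ∎)
        where
        opaque
          eq₁ : ∀ C r l → C * C * r * (200 * l) ≡ 1 * (200 * (C * C)) * (r * l)
          eq₁ = solve-∀
        opaque
          eq₂ : ∀ l r → l * r * l ≡ r * (l * l)
          eq₂ = solve-∀
        opaque
          eq₃ : ∀ r x C → r * (x * C * (x * C)) ≡ C * C * r * (x * x)
          eq₃ = solve-∀

      sparse-plan : Plan many
      sparse-plan = plan k₀ k₀-large many cost₀

      module _ (Cr≤d : C * r ≤ d) where

        extensionSize : ℕ
        extensionSize = d / (C * r)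

        extensionSize≥1 : 1 ≤ extensionSize
        extensionSize≥1 = m≥n⇒m/n>0 Cr≤d

        extension-cost : ∀ m → m ≤ r → m * extensionSize * C ≤ d
        extension-cost m m≤r = begin
          m * extensionSize * C         ≤⟨ *-monoˡ-≤ C (*-monoˡ-≤ extensionSize m≤r) ⟩
          r * extensionSize * C         ≡⟨ eq₁ r extensionSize C ⟩
          extensionSize * (C * r)       ≤⟨ m/n*n≤m d (C * r) ⟩
          d                             ∎
          where
          opaque
            eq₁ : ∀ r k C → r * k * C ≡ k * (C * r)
            eq₁ = solve-∀

        -- Contact of an extension with a dominator is governed by k₀ j, where k₀ ≈ l / C and j ≈ d
        -- / (C r). The product is about d l / (C² r), exactly what the product bound controls.
        extension-exponent : 6 * extensionSize + suc lam ≤ Plan.k sparse-plan * extensionSize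
        extension-exponent = product-exponent k₀ extensionSize lam (k≥14 k₀ lam λ≥1 k₀-large) extensionSize≥1 λ≥1
          (*-cancelˡ-≤ (C * C * r) ⦃ m*n≢0 (C * C) r ⦃ m*n≢0 C C ⦄ ⦄ (begin
            C * C * r * (16 * lam)                     ≡⟨ eq₁ C r lam ⟩
            16 * (C * C) * (r * lam)                   ≤⟨ *-monoˡ-≤ (r * lam) (*-monoˡ-≤ (C * C) (m≤m+n 16 3784)) ⟩
            3800 * (C * C) * (r * lam)                 ≡⟨ eq₂ C (r * lam) ⟩
            19 * (200 * (C * C)) * (r * lam)           ≤⟨ prod ⟩
            d * l                                      ≤⟨ *-mono-≤ (<⇒≤ (m<suc[m/n]*n d (C * r))) (<⇒≤ l<) ⟩
            suc extensionSize * (C * r) * (suc k₀ * C) ≡⟨ eq₃ (suc extensionSize) C r (suc k₀) ⟩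
            C * C * r * (suc k₀ * suc extensionSize)   ∎))
          where
          opaque
            eq₁ : ∀ C r l → C * C * r * (16 * l) ≡ 16 * (C * C) * (r * l)
            eq₁ = solve-∀
          opaque
            eq₂ : ∀ C x → 3800 * (C * C) * x ≡ 19 * (200 * (C * C)) * x
            eq₂ = solve-∀
          opaque
            eq₃ : ∀ j C r k → j * (C * r) * (k * C) ≡ C * C * r * (k * j)
            eq₃ = solve-∀

      -- Here l > 3800 C λ, so that k is linear in λ.
      dominating : d < C * r → r < 2 ^ Plan.k sparse-plan
      dominating d<Cr = <-≤-trans r< (^-monoʳ-≤ 2 (≤-pred (begin
        suc (suc lam)             ≤⟨ s≤s (s≤s (m≤m+n lam (lam + 0))) ⟩
        suc (suc (2 * lam))       ≤⟨ linear 0 (2 ⊛ λ≥1) (eq₀ lam) ⟩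
        4 * lam                   ≤⟨ *-cancelˡ-≤ (C * C * r) ⦃ m*n≢0 (C * C) r ⦃ m*n≢0 C C ⦄ ⦄ (begin
            C * C * r * (4 * lam)                      ≡⟨ eq₁ C r lam ⟩
            4 * (C * C) * (r * lam)                    ≤⟨ *-monoˡ-≤ (r * lam) (*-monoˡ-≤ (C * C) (m≤m+n 4 3796)) ⟩
            3800 * (C * C) * (r * lam)                 ≡⟨ eq₂ C (r * lam) ⟩
            19 * (200 * (C * C)) * (r * lam)           ≤⟨ prod ⟩
            d * l                                      ≤⟨ *-mono-≤ (<⇒≤ d<Cr) (<⇒≤ l<) ⟩
            C * r * (suc k₀ * C)                       ≡⟨ eq₃ C r (suc k₀) ⟩
            C * C * r * suc k₀                         ∎) ⟩
        suc k₀                    ∎)))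
        where
        opaque
          eq₀ : ∀ l → 4 * l + 2 * 1 ≡ suc (suc (2 * l)) + 2 * l + 0
          eq₀ = solve-∀
        opaque
          eq₁ : ∀ C r l → C * C * r * (4 * l) ≡ 4 * (C * C) * (r * l)
          eq₁ = solve-∀
        opaque
          eq₂ : ∀ C x → 3800 * (C * C) * x ≡ 19 * (200 * (C * C)) * x
          eq₂ = solve-∀
        opaque
          eq₃ : ∀ C r k → C * r * (k * C) ≡ C * C * r * k
          eq₃ = solve-∀

-- From a clique with disjoint neighbourhoods to l copies of K_r.

module LocalStructure where

  open Prelude
  open Counting
  open Minors
  open Expansion
  open Domination
  open Parameters
  open import Data.Fin using (splitAt)
  open import Data.Fin.Properties using (splitAt⁻¹-↑ˡ; splitAt⁻¹-↑ʳ)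

  -- In the application S and J are the neighbours of the hub v of high and of low degree.
  record Piece {n : ℕ} (H : Graph n) (S : Sub n) (β : ℕ) (v : Fin n) (J : Sub n) : Set where
    field
      J-S     : ∀ w → w ∈ J → w ∉ S
      v∉S     : v ∉ S
      v∉J     : v ∉ J
      hub-J   : ∀ u → u ∈ J → adj H v u ≡ true
      hub-S   : ∀ x → x ∈ S → adj H v x ≡ true
      upper   : # J + 2 * # S ≤ 2 * (β + 3)
      lower   : suc β ≤ # J + # S
      degrees : ∀ u → u ∈ J → β ≤ deg H J u + deg H S u

  Clique : ∀ {n} → Graph n → Sub n → Set
  Clique H S = ∀ x y → x ∈ S → y ∈ S → ¬ x ≡ y → adj H x y ≡ true

  _≢′_ : ∀ {A : Set} → A → A → Set
  a ≢′ b = ¬ a ≡ b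

  -- The last hypothesis holds if A is what at most l − 1 other pieces, using τ vertices each, leave of S.
  Extract : ∀ {n} → Graph n → Sub n → (l r τ : ℕ) → Sub n → Set
  Extract H S l r τ P = ∀ A → A ⊆ S → # S + τ ≤ # A + l * τ →
    ∃[ T ] (T ⊆ A × # T ≤ τ × Model {Fin r} _≢′_ H (P ∪ T))

  join-model : ∀ {n q m} {H : Graph n} {P} (A : Model {Fin q} _≢′_ H P) (B : Model {Fin m} _≢′_ H P) →
    (∀ i j w → w ∈ br A i → w ∈ br B j → ⊥) → (∀ i j → Touch H (br A i) (br B j)) → Model {Fin (q + m)} _≢′_ H P
  join-model {n} {q} {m} {H} {P} A B sep tch = reindex (splitAt q) inj (λ a b ne e → ne (inj a b e)) both
    where
    brs : Fin q ⊎ Fin m → Sub n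
    brs = [ br A , br B ]′
    inj : ∀ a b → splitAt q a ≡ splitAt q b → a ≡ b
    inj a b e with splitAt q a in ea | splitAt q b in eb
    inj a b refl | inj₁ x | inj₁ .x = trans (≡-sym (splitAt⁻¹-↑ˡ ea)) (splitAt⁻¹-↑ˡ eb)
    inj a b refl | inj₂ x | inj₂ .x = trans (≡-sym (splitAt⁻¹-↑ʳ {q} ea)) (splitAt⁻¹-↑ʳ {q} eb)
    both : Model {Fin q ⊎ Fin m} _≢′_ H P
    both = record
      { br = brs
      ; inside = λ { (inj₁ a) → inside A a ; (inj₂ b) → inside B b }
      ; conn = λ { (inj₁ a) → conn A a ; (inj₂ b) → conn B b }
      ; disj = λ { (inj₁ a) (inj₁ b) w p q → cong inj₁ (disj A a b w p q)
                 ; (inj₁ a) (inj₂ b) w p q → ⊥-elim (sep a b w p q)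
                 ; (inj₂ a) (inj₁ b) w p q → ⊥-elim (sep b a w q p)
                 ; (inj₂ a) (inj₂ b) w p q → cong inj₂ (disj B a b w p q) }
      ; edge = λ { (inj₁ a) (inj₁ b) ne → edge A a b (λ e → ne (cong inj₁ e))
                 ; (inj₁ a) (inj₂ b) _ → tch a b
                 ; (inj₂ a) (inj₁ b) _ → Touch-sym H (tch b a)
                 ; (inj₂ a) (inj₂ b) ne → edge B a b (λ e → ne (cong inj₂ e)) } }

  -- The hub is the last vertex of K_(r+1).
  extract-from-clique : ∀ {n} {H : Graph n} {S β v J} l r → Clique H S → Piece H S β v J → l * r ≤ # S →
    Extract H S l (suc r) r (J ∪ ｛ v ｝)
  extract-from-clique {n} {H} {S} {β} {v} {J} l r clique piece big A A⊆S room
    with choose r A (+-cancelʳ-≤ (# S) r (# A) (≤-trans (≤-reflexive (+-comm r (# S))) (≤-trans room (+-monoʳ-≤ (# A) big))))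
  ... | e , e∈ , e-inj = image e , T⊆ , #-image e , join-model hubModel rest sep tch
    where
    open Piece piece
    T⊆ : image e ⊆ A
    T⊆ w p = let i , eq = image⁻ e p in subst (_∈ A) eq (e∈ i)
    Q = (J ∪ ｛ v ｝) ∪ image e
    hubModel : Model {Fin 1} _≢′_ H Q
    hubModel = record
      { br = λ _ → ｛ v ｝ ; inside = λ _ w p → ∨⁺ˡ (∨⁺ʳ {J w} p) ; conn = λ _ → Conn-single H v
      ; disj = λ { zero zero _ _ _ → refl } ; edge = λ { zero zero ne → ⊥-elim (ne refl) } }
    rest : Model {Fin r} _≢′_ H Q
    rest = record
      { br = λ i → ｛ e i ｝
      ; inside = λ i w p → subst (_∈ Q) (∈｛｝⁻ p) (∨⁺ʳ {(J ∪ ｛ v ｝) (e i)} (image⁺ e i))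
      ; conn = λ i → Conn-single H (e i)
      ; disj = λ i j w p q → e-inj i j (trans (∈｛｝⁻ p) (≡-sym (∈｛｝⁻ q)))
      ; edge = λ i j ne → e i , e j , ∈｛｝ (e i) , ∈｛｝ (e j) ,
          clique (e i) (e j) (A⊆S _ (e∈ i)) (A⊆S _ (e∈ j)) (λ eq → ne (e-inj i j eq)) }
    sep : ∀ (i : Fin 1) j w → w ∈ ｛ v ｝ → w ∈ ｛ e j ｝ → ⊥
    sep _ j w p q = false≢true v∉S (subst (_∈ S) (trans (∈｛｝⁻ q) (≡-sym (∈｛｝⁻ p))) (A⊆S _ (e∈ j)))
    tch : ∀ (i : Fin 1) j → Touch H ｛ v ｝ ｛ e j ｝
    tch _ j = v , e j , ∈｛｝ v , ∈｛｝ (e j) , hub-S (e j) (A⊆S _ (e∈ j))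

  ⋃ : ∀ {m n} → (Fin m → Sub n) → Sub n
  ⋃ P w = ⌊ any? (λ i → P i w ≟ᵇ true) ⌋

  ⋃⁺ : ∀ {m n} (P : Fin m → Sub n) i {w} → w ∈ P i → w ∈ ⋃ P
  ⋃⁺ P i {w} p = ⌊⌋⁺ (any? (λ i → P i w ≟ᵇ true)) (i , p)

  ⋃⁻ : ∀ {m n} (P : Fin m → Sub n) {w} → w ∈ ⋃ P → ∃[ i ] w ∈ P i
  ⋃⁻ P {w} = ⌊⌋⁻ (any? (λ i → P i w ≟ᵇ true))

  SameCopy : ∀ {m r} → Fin m × Fin r → Fin m × Fin r → Set
  SameCopy a b = proj₁ a ≡ proj₁ b × ¬ proj₂ a ≡ proj₂ b

  -- The pieces are served one after another, each taking at most τ vertices of what is left of S.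
  -- The invariant says that the loss so far is at most that of l - m pieces, which leaves the room
  -- that `Extract` asks for.
  assemble : ∀ {n} {H : Graph n} {S : Sub n} {l r τ} m (P : Fin m → Sub n) (A : Sub n) →
    (∀ i w → w ∈ P i → w ∉ S) → (∀ i j w → w ∈ P i → w ∈ P j → i ≡ j) →
    (∀ i → Extract H S l r τ (P i)) → A ⊆ S → # S + m * τ ≤ # A + l * τ →
    Model {Fin m × Fin r} SameCopy H (⋃ P ∪ A)
  assemble zero P A _ _ _ _ _ = record
    { br = λ { (() , _) } ; inside = λ { (() , _) } ; conn = λ { (() , _) } ; disj = λ { (() , _) } ; edge = λ { (() , _) } }
  assemble {n} {H} {S} {l} {r} {τ} (suc m) P A P-S P-disj ext A⊆S room
    with ext zero A A⊆S (≤-trans (+-monoʳ-≤ (# S) (m≤m+n τ (m * τ))) room)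
  ... | T , T⊆A , #T , first = record { br = brs ; inside = inside′ ; conn = conn′ ; disj = disj′ ; edge = edge′ }
    where
    A′ = A ∖ T
    #A : # A ≤ # A′ + τ
    #A = ≤-trans (≤-sub-bound {P = A} {A′} {T} (λ w p → [ inj₂ , (λ t → inj₁ (∧⁺ p (not⁺ t))) ]′ (bool? (T w)))) (+-monoʳ-≤ (# A′) #T)
    room′ : # S + m * τ ≤ # A′ + l * τ
    room′ = linear 0 (room ⊕ #A) (arith (# S) τ m (# A) (# A′) (l * τ))
      where
      opaque
        arith : ∀ s t m a a′ x → a′ + x + ((s + suc m * t) + a) ≡ s + m * t + ((a + x) + (a′ + t)) + 0
        arith = solve-∀
    suc-inj : ∀ {k} {i j : Fin k} → _≡_ {A = Fin (suc k)} (suc i) (suc j) → i ≡ j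
    suc-inj refl = refl
    P′ : Fin m → Sub n
    P′ i = P (suc i)
    others : Model {Fin m × Fin r} SameCopy H (⋃ P′ ∪ A′)
    others = assemble {l = l} m P′ A′ (λ i → P-S (suc i))
      (λ i j w p q → suc-inj (P-disj (suc i) (suc j) w p q)) (λ i → ext (suc i)) (λ w p → A⊆S w (proj₁ (∧⁻ p))) room′
    brs : Fin (suc m) × Fin r → Sub n
    brs (zero , j) = br first j
    brs (suc i , j) = br others (i , j)
    firstIn : ∀ j w → w ∈ br first j → w ∈ P zero ⊎ w ∈ T
    firstIn j w p = ∨⁻ (inside first j w p)
    otherIn : ∀ a w → w ∈ br others a → (∃[ i ] w ∈ P (suc i)) ⊎ w ∈ A′
    otherIn a w p = [ (λ q → inj₁ (⋃⁻ P′ q)) , inj₂ ]′ (∨⁻ {⋃ P′ w} (inside others a w p))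
    inside′ : ∀ a → brs a ⊆ ⋃ P ∪ A
    inside′ (zero , j) w p = [ (λ q → ∨⁺ˡ (⋃⁺ P zero q)) , (λ q → ∨⁺ʳ {⋃ P w} (T⊆A w q)) ]′ (firstIn j w p)
    inside′ (suc i , j) w p =
      [ (λ { (i′ , q) → ∨⁺ˡ (⋃⁺ P (suc i′) q) }) , (λ q → ∨⁺ʳ {⋃ P w} (proj₁ (∧⁻ q))) ]′ (otherIn (i , j) w p)
    conn′ : ∀ a → Conn H (brs a)
    conn′ (zero , j) = conn first j
    conn′ (suc i , j) = conn others (i , j)
    apart : ∀ j a w → w ∈ br first j → w ∈ br others a → ⊥
    apart j a w p q with firstIn j w p | otherIn a w q
    ... | inj₁ x | inj₁ (i , y) = case P-disj zero (suc i) w x y of λ ()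
    ... | inj₁ x | inj₂ y = false≢true (P-S zero w x) (A⊆S w (proj₁ (∧⁻ y)))
    ... | inj₂ x | inj₁ (i , y) = false≢true (P-S (suc i) w y) (A⊆S w (T⊆A w x))
    ... | inj₂ x | inj₂ y = false≢true (not⁻ (proj₂ (∧⁻ y))) x
    disj′ : ∀ a b w → w ∈ brs a → w ∈ brs b → a ≡ b
    disj′ (zero , j) (zero , j′) w p q = cong (zero ,_) (disj first j j′ w p q)
    disj′ (zero , j) (suc i , j′) w p q = ⊥-elim (apart j (i , j′) w p q)
    disj′ (suc i , j) (zero , j′) w p q = ⊥-elim (apart j′ (i , j) w q p)
    disj′ (suc i , j) (suc i′ , j′) w p q = cong (λ a → suc (proj₁ a) , proj₂ a) (disj others (i , j) (i′ , j′) w p q)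
    edge′ : ∀ a b → SameCopy a b → Touch H (brs a) (brs b)
    edge′ (zero , j) (.zero , j′) (refl , ne) = edge first j j′ ne
    edge′ (suc i , j) (.(suc i) , j′) (refl , ne) = edge others (i , j) (i , j′) (refl , ne)

  module Local (D c z h : ℕ) .⦃ z≢0 : NonZero z ⦄ (num : 2 * z ^ h ≤ suc z ^ h)
    (c≥1 : 1 ≤ c) (c≤5 : c ≤ 5) (D≤ : D ≤ c * suc z) (D≥ : 256 ≤ D) (z≤ : suc z ≤ 64)
    where

    groupCost′ : ℕ
    groupCost′ = (2 * h + 2) * suc (suc (2 * D))

    module _ {n : ℕ} (H : Graph n) where

      good? : Sub n → ℕ → Sub n
      good? V κ x = ⌊ 2 * (c * κ) + κ ≤? 2 * deg H V x ⌋

      record Core (J S : Sub n) (κ d : ℕ) : Set where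
        field
          V      : Sub n
          V⊆J    : V ⊆ J
          V≢∅    : 1 ≤ # V
          size   : # V ≤ D * κ
          expand : Expanding H κ V
          rich   : ∀ u → u ∈ V → 2 * (c * κ) + κ ≤ 2 * deg H V u
          few    : # (S ∖ good? V κ) ≤ 14 * d

      opaque
        rich-bound : ∀ κ x → 11 * κ ≤ x → 2 * (c * κ) + κ ≤ x
        rich-bound κ x le = ≤-trans (+-monoˡ-≤ κ (2 ⊛ *-monoˡ-≤ κ c≤5)) (≤-trans (≤-reflexive (arith κ)) le)
          where
          opaque
            arith : ∀ κ → 2 * (5 * κ) + κ ≡ 11 * κ
            arith = solve-∀

        -- Double counting of the non-adjacent pairs between V and S.
        few-bad : ∀ (V S : Sub n) κ d → 1 ≤ # V → (∀ u → u ∈ V → 11 * κ ≤ deg H V u) →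
          (∀ u → u ∈ V → # S + d ≤ 8 * d + deg H S u) → # (S ∖ good? V κ) ≤ 14 * d
        few-bad V S κ d V≢∅ degs misses = *-cancelˡ-≤ (# V) ⦃ >-nonZero V≢∅ ⦄ (begin
            # V * # Bad                                             ≡⟨ ≡-sym (sum-on-const Bad (# V)) ⟩
            sum-on Bad (λ _ → # V)                                  ≤⟨ sum-on-mono half ⟩
            sum-on Bad (λ x → 2 * # (λ u → V u ∧ not (adj H x u)))  ≡⟨ sum-on-scale Bad 2 _ ⟩
            2 * sum-on Bad (λ x → # (λ u → V u ∧ not (adj H x u)))  ≡⟨ cong (2 *_) (double-count Bad V (λ x u → not (adj H x u))) ⟩
            2 * sum-on V (λ u → # (λ x → Bad x ∧ not (adj H x u)))  ≤⟨ 2 ⊛ sum-on-mono missed ⟩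
            2 * sum-on V (λ _ → 7 * d)                              ≡⟨ cong (2 *_) (sum-on-const V (7 * d)) ⟩
            2 * (7 * d * # V)                                       ≡⟨ arith₂ d (# V) ⟩
            # V * (14 * d)                                          ∎)
          where
          open ≤-Reasoning
          Bad : Sub n
          Bad = S ∖ good? V κ
          opaque
            arith₂ : ∀ d v → 2 * (7 * d * v) ≡ v * (14 * d)
            arith₂ = solve-∀
          opaque
            arith₃ : ∀ s d x y → 7 * d + ((s + d) + (x + y)) ≡ y + ((8 * d + x) + s) + 0
            arith₃ = solve-∀
          11κ≤V : 11 * κ ≤ # V
          11κ≤V = let u , u∈ = #-witness V≢∅ in ≤-trans (degs u u∈) (deg≤# H V u)
          -- A vertex that is not good has 2 deg < 2 c κ + κ ≤ 11 κ ≤ |V|, by c ≤ 5 and the minimum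
          -- degree in V, so it misses at least half of V.
          half : ∀ x → x ∈ Bad → # V ≤ 2 * # (λ u → V u ∧ not (adj H x u))
          half x x∈ = linear 0 (low ⊕ (≤-reflexive (#-split V (adj H x)) ⊕ ≤-reflexive (#-split V (adj H x))))
              (arith₁ (# V) (deg H V x) (# (V ∖ adj H x)))
            where
            low : 2 * deg H V x ≤ # V
            low = ≤-trans (<⇒≤ (≰⇒> (λ le → ⌊⌋-false⁻ (2 * (c * κ) + κ ≤? 2 * deg H V x) (not⁻ (proj₂ (∧⁻ x∈))) le))) (rich-bound κ (# V) 11κ≤V)
            opaque
              arith₁ : ∀ v a b → 2 * b + (2 * a + (v + v)) ≡ v + (v + ((a + b) + (a + b))) + 0
              arith₁ = solve-∀
          missed : ∀ u → u ∈ V → # (λ x → Bad x ∧ not (adj H x u)) ≤ 7 * d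
          missed u u∈ = ≤-trans (#-mono (λ x p → ∧⁺ (proj₁ (∧⁻ (proj₁ (∧⁻ {Bad x} p)))) (trans (cong not (sym H u x)) (proj₂ (∧⁻ {Bad x} p)))))
            (linear 0 (misses u u∈ ⊕ ≤-reflexive (≡-sym (#-split S (adj H u)))) (arith₃ (# S) d (deg H S u) (# (S ∖ adj H u))))

        find-core : ∀ J S κ d → 16 * κ ≤ d → d ≤ 32 * κ → 1 ≤ κ → 1 ≤ # J → # J ≤ 8 * d →
          (∀ u → u ∈ J → d ≤ deg H J u) → (∀ u → u ∈ J → # S + d ≤ 8 * d + deg H S u) → Core J S κ d
        find-core J S κ d κ≤ d≤ κ≥1 J≢∅ J≤ degs misses
          -- Five halvings would bring |J| ≤ 8 d ≤ 2^5 · 8 κ down to 8 κ, below the minimum degree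
          -- 11 κ; they cost 5 κ of the minimum degree d ≥ 16 κ.
          with expanding-subset H {11 * κ} {8 * κ} {κ} (*-monoˡ-< κ ⦃ >-nonZero κ≥1 ⦄ {8} {11} (m≤m+n 9 2)) 5 J J≢∅
            (≤-trans J≤ (≤-trans (8 ⊛ d≤) (≤-reflexive (arith₁ κ))))
            (λ u u∈ → ≤-trans (≤-reflexive (arith₂ κ)) (≤-trans κ≤ (degs u u∈)))
          where
          opaque
            arith₁ : ∀ κ → 8 * (32 * κ) ≡ 32 * (8 * κ)
            arith₁ = solve-∀
          opaque
            arith₂ : ∀ κ → 11 * κ + 5 * κ ≡ 16 * κ
            arith₂ = solve-∀
        ... | V , V⊆J , V≢∅ , degV , ex = record
          { V = V ; V⊆J = V⊆J ; V≢∅ = V≢∅ ; expand = ex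
          ; size = ≤-trans (#-mono V⊆J) (≤-trans J≤ (≤-trans (8 ⊛ d≤) (≤-trans (≤-reflexive (arith₃ κ)) (*-monoˡ-≤ κ D≥))))
          ; rich = λ u u∈ → rich-bound κ _ (≤-trans (degV u u∈) (m≤m+n _ _))
          ; few = few-bad V S κ d V≢∅ degV (λ u u∈ → misses u (V⊆J u u∈)) }
          where
          opaque
            arith₃ : ∀ κ → 8 * (32 * κ) ≡ 256 * κ
            arith₃ = solve-∀

      -- A vertex of J has at least β = |S| + d neighbours in J and S together: at most |S| of them
      -- in S leaves d in J, and at most |J| of them in J leaves all but 7 d of S. Here |J| ≤ 2 (d +
      -- 3) ≤ 8 d.
      piece-core : ∀ {S β v J} d κ → # S + d ≡ β → Piece H S β v J → 1 ≤ d → 16 * κ ≤ d → d ≤ 32 * κ → 1 ≤ κ → Core J S κ d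
      piece-core {S} {β} {v} {J} d κ eq piece d≥1 κ≤ d≤ κ≥1 =
        find-core J S κ d κ≤ d≤ κ≥1 J≢∅ J≤ degJ (λ u u∈ → ≤-trans (β≤ u u∈) (+-monoˡ-≤ (deg H S u) (≤-trans (deg≤# H J u) J≤)))
        where
        open Piece piece
        β≤ : ∀ u → u ∈ J → # S + d ≤ deg H J u + deg H S u
        β≤ u u∈ = ≤-trans (≤-reflexive eq) (degrees u u∈)
        J≤ : # J ≤ 8 * d
        J≤ = linear 0 (upper′ ⊕ 6 ⊛ d≥1) (arith (# J) (# S) d)
          where
          upper′ : # J + 2 * # S ≤ 2 * ((# S + d) + 3)
          upper′ = subst (λ b → # J + 2 * # S ≤ 2 * (b + 3)) (≡-sym eq) upper
          opaque
            arith : ∀ j s d → 8 * d + ((j + 2 * s) + 6 * 1) ≡ j + (2 * ((s + d) + 3) + 6 * d) + 0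
            arith = solve-∀
        J≢∅ : 1 ≤ # J
        J≢∅ = linear d lower′ (arith (# J) (# S) d)
          where
          lower′ : suc (# S + d) ≤ # J + # S
          lower′ = subst (λ b → suc b ≤ # J + # S) (≡-sym eq) lower
          opaque
            arith : ∀ j s d → j + suc (s + d) ≡ 1 + (j + s) + d
            arith = solve-∀
        degJ : ∀ u → u ∈ J → d ≤ deg H J u
        degJ u u∈ = linear 0 (β≤ u u∈ ⊕ deg≤# H S u) (arith (deg H J u) (deg H S u) (# S) d)
          where
          opaque
            arith : ∀ a b s d → a + ((s + d) + b) ≡ d + ((a + b) + s) + 0
            arith = solve-∀

  module LocalModel (D c z h : ℕ) .⦃ z≢0 : NonZero z ⦄ (num : 2 * z ^ h ≤ suc z ^ h)
    (c≥1 : 1 ≤ c) (c≤5 : c ≤ 5) (D≤ : D ≤ c * suc z) (D≥ : 256 ≤ D) (z≤ : suc z ≤ 64)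
    where

    open Local D c z h num c≥1 c≤5 D≤ D≥ z≤

    module _ {n : ℕ} {H : Graph n} {S J : Sub n} {β d : ℕ} {v : Fin n} {C l r lam : ℕ}
      (clique : Clique H S) (piece : Piece H S β v J) (sd : # S + d ≡ β) (lr≤ : l * r ≤ suc β)
      (Sz : Sizes C groupCost′ l r lam d) where

      open Sizes Sz

      private
        κ : ℕ
        κ = d / 16

        κ≥1 : 1 ≤ κ
        κ≥1 = m≥n⇒m/n>0 (d≥16 Sz)

        d≤32κ : d ≤ 32 * κ
        d≤32κ = begin
          d                     ≤⟨ <⇒≤ (m<suc[m/n]*n d 16) ⟩
          suc κ * 16            ≤⟨ *-monoˡ-≤ 16 (+-monoˡ-≤ κ κ≥1) ⟩
          (κ + κ) * 16          ≡⟨ arith κ ⟩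
          32 * κ                ∎
          where
          open ≤-Reasoning
          opaque
            arith : ∀ κ → (κ + κ) * 16 ≡ 32 * κ
            arith = solve-∀

      opaque
        core : Core H J S κ d
        core = piece-core H d κ sd piece (≤-trans l≥1 l≤d) (≤-trans (≤-reflexive (*-comm 16 κ)) (m/n*n≤m d 16)) d≤32κ κ≥1

      open Core core
      open Groups H V κ D c z h num κ≥1 c≥1 D≤ size V≢∅ expand
      open Dominators

      private
        Good : Sub n
        Good = good? H V κ

        pow : ∀ m k t → t < 2 ^ suc lam → 6 * m + suc lam ≤ k * m → suc z ^ m * t < (2 ^ k) ^ m
        pow m k t t< le = ≤-<-trans (*-monoˡ-≤ t (^-monoˡ-≤ m z≤)) (power-bound m k t lam t< le)

        make : ∀ {Y} q (p : Plan Sz q) → q ≤ r → (∀ y → y ∈ Y → Rich y) → # Y < 2 ^ Plan.k p → Dominators rich (Plan.k p) Y q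
        make q p q≤r richY Y< = dominators rich q k≥1 richY Y< (pow k k q (≤-<-trans q≤r r<) squares)
          (≤-trans (2 ⊛ m≤m+n (q * (k * groupCost′)) (0 * (0 * groupCost′))) (budget-bound C groupCost′ d κ q k 0 0 C≥1 g≤ d≤32κ cost z≤n))
          where open Plan p

        dominatorModel : ∀ {k Y q Q} (S′ : Dominators rich k Y q) → V ⊆ Q → Model {Fin q} _≢′_ H Q
        dominatorModel S′ V⊆Q = record
          { br = set S′ ; inside = λ i w p → V⊆Q w (used⊆V S′ w (set⊆ S′ i w p)) ; conn = set-conn S′
          ; disj = set-disj S′ ; edge = touching S′ }

        within : ∀ T → V ⊆ (J ∪ ｛ v ｝) ∪ T
        within T w p = ∨⁺ˡ (∨⁺ˡ (V⊆J w p))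

        V-S : ∀ w → w ∈ V → w ∈ S → ⊥
        V-S w p q = false≢true (Piece.J-S piece w (V⊆J w p)) q

        extract-dense : ∀ τ → r ≤ many Sz → Extract H S l r τ (J ∪ ｛ v ｝)
        extract-dense τ r≤q A A⊆S room = ∅ , (λ _ ()) , ≤-trans (≤-reflexive (#-∅ (λ _ → refl))) z≤n ,
          dominatorModel (make {∅} r p ≤-refl (λ _ ()) (≤-<-trans (≤-reflexive (#-∅ (λ _ → refl))) (m^n>0 2 (Plan.k p)))) (within ∅)
          where
          p = dense-plan Sz r≤q

        -- `many` branch sets are built in V; the others grow from rich vertices of S that earlier
        -- pieces have left. These are adjacent to each other because S is a clique, so only their
        -- contact with the dominators needs work.
        extract-sparse : many Sz < r → Extract H S l r (r ∸ many Sz) (J ∪ ｛ v ｝)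
        extract-sparse q<r A A⊆S room = image e , T⊆A , #-image e , subst (λ x → Model {Fin x} _≢′_ H Q) q+m both
          where
          q = many Sz
          m = r ∸ many Sz
          q+m : q + m ≡ r
          q+m = m+[n∸m]≡n (<⇒≤ q<r)
          m≤r : m ≤ r
          m≤r = m∸n≤m r q
          opaque
            enough : m ≤ # (A ∩ Good)
            -- l m ≤ |S| + d + 1 - l `many` ≤ |S| - 17 d, so A has at least m + 17 d vertices, of
            -- which at most 14 d are not good.
            enough = linear (3 * d) (room ⊕ #A ⊕ many-lower Sz ⊕ lr) (arith (# S) m (# A) (# (A ∩ Good)) l q d)
              where
              #A : # A ≤ # (A ∩ Good) + 14 * d
              #A = ≤-trans (≤-reflexive (#-split A Good)) (+-monoʳ-≤ (# (A ∩ Good))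
                     (≤-trans (#-mono (λ w p → ∧⁺ (A⊆S w (proj₁ (∧⁻ p))) (proj₂ (∧⁻ {A w} p)))) few))
              lr : l * (q + m) ≤ suc (# S + d)
              lr = subst₂ (λ x b → l * x ≤ suc b) (≡-sym q+m) (≡-sym sd) lr≤
              opaque
                arith : ∀ s m a g l q d → g + ((s + m) + a + suc (18 * d) + l * (q + m))
                  ≡ m + ((a + l * m) + (g + 14 * d) + q * l + suc (s + d)) + 3 * d
                arith = solve-∀
          opaque
            chosen : Σ (Fin m → Fin n) λ e → (∀ i → e i ∈ A ∩ Good) × (∀ i j → e i ≡ e j → i ≡ j)
            chosen = choose m (A ∩ Good) enough
          e : Fin m → Fin n
          e = proj₁ chosen
          e∈A : ∀ i → e i ∈ A
          e∈A i = proj₁ (∧⁻ (proj₁ (proj₂ chosen) i))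
          e∈S : ∀ i → e i ∈ S
          e∈S i = A⊆S _ (e∈A i)
          e-rich : ∀ i → Rich (e i)
          e-rich i = ⌊⌋⁻ (2 * (c * κ) + κ ≤? 2 * deg H V (e i)) (proj₂ (∧⁻ {A (e i)} (proj₁ (proj₂ chosen) i)))
          e-inj : ∀ i j → e i ≡ e j → i ≡ j
          e-inj = proj₂ (proj₂ chosen)
          e-adj : ∀ i j → ¬ i ≡ j → adj H (e i) (e j) ≡ true
          e-adj i j ne = clique (e i) (e j) (e∈S i) (e∈S j) (λ eq → ne (e-inj i j eq))
          T⊆A : image e ⊆ A
          T⊆A w p = let i , eq = image⁻ e p in subst (_∈ A) eq (e∈A i)
          Q = (J ∪ ｛ v ｝) ∪ image e
          e∈Q : ∀ i → e i ∈ Q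
          e∈Q i = ∨⁺ʳ {(J ∪ ｛ v ｝) (e i)} (image⁺ e i)
          p = sparse-plan Sz q<r
          k = Plan.k p
          clash : ∀ i w → w ∈ V → w ∈ ｛ e i ｝ → ⊥
          clash i w a b = V-S w a (subst (_∈ S) (∈｛｝⁻ b) (e∈S i))

          both : Model {Fin (q + m)} _≢′_ H Q
          both = by-size (C * r ≤? d)
            where
            by-size : Dec (C * r ≤ d) → Model {Fin (q + m)} _≢′_ H Q
            -- When d < C r, k is large enough for r < 2^k, and the chosen vertices themselves form
            -- the set Y that every dominator reaches.
            by-size (no Cr≰d) = join-model (dominatorModel doms (within (image e))) singles
                  (λ i j w a b → clash j w (used⊆V doms w (set⊆ doms i w a)) b)
                  (λ i j → let a , a∈ , ad = domY doms i (e j) (image⁺ e j) in a , e j , a∈ , ∈｛｝ (e j) , ad)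
              where
              opaque
                doms : Dominators rich k (image e) q
                doms = make q p (<⇒≤ q<r) (λ y y∈ → let i , eq = image⁻ e y∈ in subst Rich eq (e-rich i))
                  (≤-<-trans (≤-trans (#-image e) m≤r) (dominating Sz q<r (≰⇒> Cr≰d)))
              singles : Model {Fin m} _≢′_ H Q
              singles = record
                { br = λ i → ｛ e i ｝
                ; inside = λ i w a → subst (_∈ Q) (∈｛｝⁻ a) (e∈Q i)
                ; conn = λ i → Conn-single H (e i)
                ; disj = λ i j w a b → e-inj i j (trans (∈｛｝⁻ a) (≡-sym (∈｛｝⁻ b)))
                ; edge = λ i j ne → e i , e j , ∈｛｝ (e i) , ∈｛｝ (e j) , e-adj i j ne }
            -- When d is large compared with r, each chosen vertex can afford an extension of about
            -- d / (C r) picks that reaches the dominators on its behalf.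
            by-size (yes Cr≤d) = join-model (dominatorModel doms (within (image e))) extended sep
                  (λ i i′ → let a , b , a∈ , b∈ , ad = meets exts i′ i in b , a , b∈ , ∨⁺ˡ a∈ , trans (sym H b a) ad)
              where
              open Extensions
              j = extensionSize Sz q<r Cr≤d
              opaque
                doms : Dominators rich k ∅ q
                doms = make q p (<⇒≤ q<r) (λ _ ()) (≤-<-trans (≤-reflexive (#-∅ (λ _ → refl))) (m^n>0 2 k))
              opaque
                exts : Extensions rich doms j e
                exts = extensions rich doms j m e (extensionSize≥1 Sz q<r Cr≤d) e-rich
                  (pow j k q (<-trans q<r r<) (extension-exponent Sz q<r Cr≤d))
                  (budget-bound C groupCost′ d κ q k m j C≥1 g≤ d≤32κ (Plan.cost p) (extension-cost Sz q<r Cr≤d m m≤r))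
              ext∈V : ∀ i w → w ∈ ext exts i → w ∈ V
              ext∈V i w a = used′⊆V exts w (ext⊆ exts i w a)
              X : Fin m → Sub n
              X i = ext exts i ∪ ｛ e i ｝
              X-conn : ∀ i → Conn H (X i)
              X-conn i with ext-conn exts i | attached exts i
              ... | s , s∈ , walks | a , a∈ , ad = s , Rooted-snoc H (s∈ , walks) a∈ (trans (sym H a (e i)) ad)
              X-disj : ∀ i i′ w → w ∈ X i → w ∈ X i′ → i ≡ i′
              X-disj i i′ w a b with ∨⁻ {ext exts i w} a | ∨⁻ {ext exts i′ w} b
              ... | inj₁ a′ | inj₁ b′ = ext-disj exts i i′ w a′ b′
              ... | inj₁ a′ | inj₂ b′ = ⊥-elim (clash i′ w (ext∈V i w a′) b′)
              ... | inj₂ a′ | inj₁ b′ = ⊥-elim (clash i w (ext∈V i′ w b′) a′)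
              ... | inj₂ a′ | inj₂ b′ = e-inj i i′ (trans (∈｛｝⁻ a′) (≡-sym (∈｛｝⁻ b′)))
              extended : Model {Fin m} _≢′_ H Q
              extended = record
                { br = X
                ; inside = λ i w a → [ (λ a′ → within (image e) w (ext∈V i w a′)) , (λ a′ → subst (_∈ Q) (∈｛｝⁻ a′) (e∈Q i)) ]′ (∨⁻ {ext exts i w} a)
                ; conn = X-conn
                ; disj = X-disj
                ; edge = λ i i′ ne → e i , e i′ , ∨⁺ʳ {ext exts i (e i)} (∈｛｝ (e i)) , ∨⁺ʳ {ext exts i′ (e i′)} (∈｛｝ (e i′)) , e-adj i i′ ne }
              sep : ∀ i i′ w → w ∈ set doms i → w ∈ X i′ → ⊥
              sep i i′ w a b with ∨⁻ {ext exts i′ w} b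
              ... | inj₁ b′ = false≢true (ext-new exts i′ w b′) (set⊆ doms i w a)
              ... | inj₂ b′ = clash i′ w (used⊆V doms w (set⊆ doms i w a)) b′

      -- In the dense case `r ∸ many` is 0, in agreement with nothing being taken from S.
      extract-main : Extract H S l r (r ∸ many Sz) (J ∪ ｛ v ｝)
      extract-main with r ≤? many Sz
      ... | yes r≤q = extract-dense (r ∸ many Sz) r≤q
      ... | no r≰q = extract-sparse (≰⇒> r≰q)

  module Copies (D c z h : ℕ) .⦃ z≢0 : NonZero z ⦄ (num : 2 * z ^ h ≤ suc z ^ h)
    (c≥1 : 1 ≤ c) (c≤5 : c ≤ 5) (D≤ : D ≤ c * suc z) (D≥ : 256 ≤ D) (z≤ : suc z ≤ 64)
    where

    open Local D c z h num c≥1 c≤5 D≤ D≥ z≤ using (groupCost′)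
    open LocalModel D c z h num c≥1 c≤5 D≤ D≥ z≤

    module _ {C c₀ l lam : ℕ} (r′ : ℕ) (c₀≡ : c₀ ≡ 19 * (200 * (C * C))) (C≥1 : 1 ≤ C) (g≤ : 1280 * groupCost′ ≤ C) (l≥1 : 1 ≤ l) (λ≥1 : 1 ≤ lam)
      (r< : suc r′ < 2 ^ suc lam) .⦃ l≢0 : NonZero l ⦄ where

      private
        r = suc r′

      excess : ℕ
      excess = c₀ * (r * lam) / l

      -- If |S| ≥ l (r - 1), each copy is a hub with r - 1 vertices of S. Otherwise the strict
      -- shortage gives d ≥ l + `excess`, which contains both l ≤ d and the product bound.
      local-model : ∀ {n} {H : Graph n} {S : Sub n} β (v : Fin l → Fin n) (J : Fin l → Sub n) → l * r + excess ≤ suc β →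
        Clique H S → (∀ i → Piece H S β (v i) (J i)) → (∀ i j w → w ∈ J i ∪ ｛ v i ｝ → w ∈ J j ∪ ｛ v j ｝ → i ≡ j) →
        Model {Fin l × Fin r} SameCopy H (⋃ (λ i → J i ∪ ｛ v i ｝) ∪ S)
      local-model {n} {H} {S} β v J β≥ clique pieces apart = by-size (l * r′ ≤? # S)
        where
        P : Fin l → Sub n
        P i = J i ∪ ｛ v i ｝
        P-S : ∀ i w → w ∈ P i → w ∉ S
        P-S i w p = [ Piece.J-S (pieces i) w , (λ q → subst (λ x → S x ≡ false) (∈｛｝⁻ q) (Piece.v∉S (pieces i))) ]′ (∨⁻ {J i w} p)
        lr≤ : l * r ≤ suc β
        lr≤ = ≤-trans (m≤m+n (l * r) excess) β≥
        by-size : Dec (l * r′ ≤ # S) → Model {Fin l × Fin r} SameCopy H (⋃ P ∪ S)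
        by-size (yes big) = assemble {l = l} l P S P-S apart
          (λ i → extract-from-clique l r′ clique (pieces i) big) (λ _ p → p) ≤-refl
        by-size (no small) = assemble {l = l} l P S P-S apart
          (λ i → extract-main clique (pieces i) sd lr≤ sizes) (λ _ p → p) ≤-refl
          where
          S< : suc (# S) ≤ l * r′
          S< = ≰⇒> small
          d = β ∸ # S
          sd : # S + d ≡ β
          sd = m+[n∸m]≡n (≤-pred (≤-trans S< (≤-trans (*-monoʳ-≤ l (n≤1+n r′)) lr≤)))
          d≥ : l + excess ≤ d
          d≥ = linear 0 (S< ⊕ β≥′) (arith (# S) d l excess r′)
            where
            β≥′ : l * r + excess ≤ suc (# S + d)
            β≥′ = subst (λ b → l * r + excess ≤ suc b) (≡-sym sd) β≥
            opaque
              arith : ∀ s d l x r → d + (suc s + (l * suc r + x)) ≡ l + x + (l * r + suc (s + d)) + 0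
              arith = solve-∀
          -- Rounding down in `excess` may lose almost l in the product; the summand l of d ≥ l +
          -- `excess` contributes l² ≥ l and makes up for it.
          prod : c₀ * (r * lam) ≤ d * l
          prod = begin
            c₀ * (r * lam)          ≤⟨ <⇒≤ (m<suc[m/n]*n (c₀ * (r * lam)) l) ⟩
            l + excess * l          ≤⟨ +-monoˡ-≤ (excess * l) (≤-trans (≤-reflexive (≡-sym (*-identityˡ l))) (*-monoˡ-≤ l l≥1)) ⟩
            l * l + excess * l      ≡⟨ ≡-sym (*-distribʳ-+ l l excess) ⟩
            (l + excess) * l        ≤⟨ *-monoˡ-≤ l d≥ ⟩
            d * l                   ∎
            where open ≤-Reasoning
          sizes : Sizes C groupCost′ l r lam d
          sizes = record
            { C≥1 = C≥1 ; g≤ = g≤ ; l≥1 = l≥1 ; r≥1 = s≤s z≤n ; λ≥1 = λ≥1 ; r< = r<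
            ; l≤d = ≤-trans (m≤m+n l excess) d≥ ; prod = subst (λ x → x * (r * lam) ≤ d * l) c₀≡ prod }

-- Degree threshold, packing and pigeonhole: finding the clique and its pieces.

module GlobalStructure where

  open Prelude
  open Counting
  open Minors
  open LocalStructure

  module _ {n : ℕ} (P : Sub n) (f : Fin n → ℕ) where

    atLeast : ℕ → Sub n
    atLeast t u = P u ∧ ⌊ t ≤? f u ⌋

    -- A dyadic layer sum: with x = f u, the vertex u contributes 2^i to each level set f ≥ 2^i that
    -- contains it. Being geometric, the sum is at most 2 x.
    powersBelow : ℕ → ℕ → ℕ
    powersBelow zero x = 0
    powersBelow (suc R) x = powersBelow R x + 2 ^ R * 𝟙 ⌊ 2 ^ R ≤? x ⌋

    powersBelow< : ∀ R x → powersBelow R x < 2 ^ R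
    powersBelow< zero x = s≤s z≤n
    powersBelow< (suc R) x = +-mono-≤ (powersBelow< R x) (≤-trans (*-monoʳ-≤ (2 ^ R) (𝟙≤1 ⌊ 2 ^ R ≤? x ⌋)) (≤-reflexive (trans (*-identityʳ (2 ^ R)) (≡-sym (+-identityʳ (2 ^ R))))))

    powersBelow≤ : ∀ R x → powersBelow R x ≤ 2 * x
    powersBelow≤ zero x = z≤n
    powersBelow≤ (suc R) x with 2 ^ R ≤? x
    ... | no _ = ≤-trans (≤-reflexive (trans (cong (powersBelow R x +_) (*-zeroʳ (2 ^ R))) (+-identityʳ _))) (powersBelow≤ R x)
    ... | yes le = ≤-trans (+-mono-≤ (<⇒≤ (powersBelow< R x)) (≤-reflexive (trans (*-identityʳ _) (≡-sym (+-identityʳ _))))) (2 ⊛ le)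

    private
      scan : ∀ R₀ X R → (∃[ i ] (i < R × R₀ * (2 ^ i * # (atLeast (2 ^ i))) ≤ X)) ⊎ (R * suc X ≤ R₀ * sum-on P (λ u → powersBelow R (f u)))
      scan R₀ X zero = inj₂ z≤n
      scan R₀ X (suc R) with scan R₀ X R
      ... | inj₁ (i , i< , le) = inj₁ (i , m≤n⇒m≤1+n i< , le)
      ... | inj₂ le with R₀ * (2 ^ R * # (atLeast (2 ^ R))) ≤? X
      ... | yes p = inj₁ (R , ≤-refl , p)
      ... | no ¬p = inj₂ (begin
        suc X + R * suc X                                           ≤⟨ +-mono-≤ (≰⇒> ¬p) le ⟩
        R₀ * t + R₀ * s                                             ≡⟨ ≡-sym (*-distribˡ-+ R₀ t s) ⟩
        R₀ * (t + s)                                                ≡⟨ cong (R₀ *_) (trans (+-comm t s) (≡-sym whole)) ⟩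
        R₀ * sum-on P (λ u → powersBelow (suc R) (f u))             ∎)
        where
        open ≤-Reasoning
        t = 2 ^ R * # (atLeast (2 ^ R))
        s = sum-on P (λ u → powersBelow R (f u))
        whole : sum-on P (λ u → powersBelow (suc R) (f u)) ≡ s + t
        whole = trans (sum-on-+ P _ _) (cong (s +_) (trans (sum-on-scale P (2 ^ R) _) (cong (2 ^ R *_) (sum-on-𝟙 P _))))

    -- Averaging over i: the sum of 2 ^ i |{f ≥ 2 ^ i}| over all i is at most 2 Σ f.
    sparse-scale : ∀ R → 1 ≤ R → ∃[ i ] (i < R × R * (2 ^ i * # (atLeast (2 ^ i))) ≤ 2 * sum-on P f)
    sparse-scale R R≥1 with scan R (2 * sum-on P f) R
    ... | inj₁ r = r
    ... | inj₂ le = ⊥-elim (<-irrefl refl (*-cancelˡ-≤ R ⦃ >-nonZero R≥1 ⦄ (≤-trans le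
      (R ⊛ ≤-trans (sum-on-mono (λ u _ → powersBelow≤ R (f u))) (≤-reflexive (sum-on-scale P 2 f))))))

  #-insert : ∀ {n} {I : Sub n} {v} → v ∉ I → # (I ∪ ｛ v ｝) ≡ suc (# I)
  #-insert {I = I} {v} v∉ = trans (#-remove {P = I ∪ ｛ v ｝} {v} (∨⁺ʳ {I v} (∈｛｝ v))) (cong suc (#-cong eq))
    where
    eq : ∀ i → (I i ∨ ｛ v ｝ i) ∧ not (｛ v ｝ i) ≡ I i
    eq i with v ≟ i
    ... | no _ = lem (I i)
      where
      lem : ∀ a → (a ∨ false) ∧ true ≡ a
      lem true = refl
      lem false = refl
    ... | yes refl = trans (lem (I v)) (≡-sym v∉)
      where
      lem : ∀ a → (a ∨ true) ∧ false ≡ false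
      lem true = refl
      lem false = refl

  meet? : ∀ {n} → Sub n → Sub n → Bool
  meet? A B = ⌊ any? (λ u → (A u ∧ B u) ≟ᵇ true) ⌋

  meet⁺ : ∀ {n} {A B : Sub n} {u} → u ∈ A → u ∈ B → meet? A B ≡ true
  meet⁺ {A = A} {B} {u} a b = ⌊⌋⁺ (any? (λ u → (A u ∧ B u) ≟ᵇ true)) (u , ∧⁺ a b)

  meet⁻ : ∀ {n} {A B : Sub n} → meet? A B ≡ true → ∃[ u ] (u ∈ A × u ∈ B)
  meet⁻ {A = A} {B} e with ⌊⌋⁻ (any? (λ u → (A u ∧ B u) ≟ᵇ true)) e
  ... | u , p = u , ∧⁻ p

  Packed : ∀ {n} → (Fin n → Sub n) → Sub n → Set
  Packed B I = ∀ v w u → v ∈ I → w ∈ I → u ∈ B v → u ∈ B w → v ≡ w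

  -- Greedy: a chosen v discards the at most Δ members of Z whose sets meet `B v`; `self` puts v
  -- among them, so the recursion terminates.
  packing : ∀ {n} (B : Fin n → Sub n) Δ (Z : Sub n) → (∀ v → v ∈ Z → v ∈ B v) →
    (∀ v → v ∈ Z → # (λ w → Z w ∧ meet? (B v) (B w)) ≤ Δ) → ∃[ I ] (I ⊆ Z × Packed B I × # Z ≤ Δ * # I)
  packing {n} B Δ Z self few = go (# Z) Z ≤-refl self few
    where
    go : ∀ fuel Z → # Z ≤ fuel → (∀ v → v ∈ Z → v ∈ B v) → (∀ v → v ∈ Z → # (λ w → Z w ∧ meet? (B v) (B w)) ≤ Δ) →
      ∃[ I ] (I ⊆ Z × Packed B I × # Z ≤ Δ * # I)
    go fuel Z sz self few with 1 ≤? # Z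
    ... | no empty = ∅ , (λ _ ()) , (λ _ _ _ ()) , ≤-trans (≤-pred (≰⇒> empty)) z≤n
    go zero Z sz self few | yes ne = ⊥-elim (<-irrefl refl (≤-trans ne sz))
    go (suc fuel) Z sz self few | yes ne with #-witness ne
    ... | v , v∈ with go fuel Z′ sz′ (λ w w∈ → self w (proj₁ (∧⁻ w∈)))
                      (λ w w∈ → ≤-trans (#-mono (λ x p → ∧⁺ (proj₁ (∧⁻ (proj₁ (∧⁻ {Z′ x} p)))) (proj₂ (∧⁻ {Z′ x} p)))) (few w (proj₁ (∧⁻ w∈))))
      where
      Z′ : Sub n
      Z′ w = Z w ∧ not (meet? (B v) (B w))
      sz′ : # Z′ ≤ fuel
      sz′ = ≤-pred (≤-trans (≤-trans (s≤s (#-mono (λ w p → ∈∖｛｝⁺ {P = Z} {v} (proj₁ (∧⁻ p))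
              (λ { refl → false≢true (not⁻ (proj₂ (∧⁻ {Z w} p))) (meet⁺ {A = B v} {B v} (self v v∈) (self v v∈)) }))))
              (≤-reflexive (≡-sym (#-remove v∈)))) sz)
    ... | I , I⊆ , packed , le = I ∪ ｛ v ｝ , I′⊆ , packed′ , (begin
        # Z                                                       ≡⟨ #-split Z (λ w → meet? (B v) (B w)) ⟩
        # (Z ∩ (λ w → meet? (B v) (B w))) + # (Z ∖ (λ w → meet? (B v) (B w)))  ≤⟨ +-mono-≤ (few v v∈) le ⟩
        Δ + Δ * # I                                               ≡⟨ ≡-sym (*-suc Δ (# I)) ⟩
        Δ * suc (# I)                                             ≡⟨ cong (Δ *_) (≡-sym (#-insert v∉I)) ⟩
        Δ * # (I ∪ ｛ v ｝)                                       ∎)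
      where
      open ≤-Reasoning
      I-away : ∀ w u → w ∈ I → u ∈ B v → u ∈ B w → ⊥
      I-away w u w∈ a b = false≢true (not⁻ (proj₂ (∧⁻ {Z w} (I⊆ w w∈)))) (meet⁺ {A = B v} {B w} a b)
      v∉I : v ∉ I
      v∉I = ≢true⇒false (λ v∈I → I-away v v v∈I (self v v∈) (self v v∈))
      I′⊆ : I ∪ ｛ v ｝ ⊆ Z
      I′⊆ w p = [ (λ q → proj₁ (∧⁻ (I⊆ w q))) , (λ q → subst (_∈ Z) (∈｛｝⁻ q) v∈) ]′ (∨⁻ {I w} p)
      packed′ : Packed B (I ∪ ｛ v ｝)
      packed′ x y u p q a b with ∨⁻ {I x} p | ∨⁻ {I y} q
      ... | inj₁ p′ | inj₁ q′ = packed x y u p′ q′ a b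
      ... | inj₁ p′ | inj₂ q′ = ⊥-elim (I-away x u p′ (subst (λ z → u ∈ B z) (≡-sym (∈｛｝⁻ q′)) b) a)
      ... | inj₂ p′ | inj₁ q′ = ⊥-elim (I-away y u q′ (subst (λ z → u ∈ B z) (≡-sym (∈｛｝⁻ p′)) a) b)
      ... | inj₂ p′ | inj₂ q′ = trans (≡-sym (∈｛｝⁻ p′)) (∈｛｝⁻ q′)

  Agreeing : ∀ {n} → (Fin n → Sub n) → ℕ → Sub n → Set
  Agreeing {n} σ m I = Σ (Sub n) λ I′ → Σ (Sub n) λ S₁ → I′ ⊆ I × m ≤ # I′ × (∀ v → v ∈ I′ → ∀ x → σ v x ≡ S₁ x)

  -- Fixing the membership of one vertex of Z after another keeps at least half of the required
  -- family size each time; `S₀` records the values already fixed outside Z.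
  same-set : ∀ {n} (σ : Fin n → Sub n) m z (Z I S₀ : Sub n) → # Z ≤ z → m * 2 ^ z ≤ # I →
    (∀ v → v ∈ I → ∀ x → x ∉ Z → σ v x ≡ S₀ x) →
    Agreeing σ m I
  same-set σ m z Z I S₀ Z≤ I≥ agree with 1 ≤? # Z
  ... | no empty = I , S₀ , (λ _ p → p) , ≤-trans (m≤m*n m (2 ^ z) ⦃ m^n≢0 2 z ⦄) I≥ ,
        λ v v∈ x → agree v v∈ x (≢true⇒false (λ e → empty (#-pos {P = Z} e)))
  same-set σ m zero Z I S₀ Z≤ I≥ agree | yes ne = ⊥-elim (<-irrefl refl (≤-trans ne Z≤))
  same-set {n} σ m (suc z) Z I S₀ Z≤ I≥ agree | yes ne with #-witness ne
  ... | y , y∈ = [ (λ le → descend true (λ v → σ v y) (λ v e → e) le) , (λ le → descend false (λ v → not (σ v y)) (λ v e → not⁻ e) le) ]′ halves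
    where
    Z′ = Z ∖ ｛ y ｝
    Z′≤ : # Z′ ≤ z
    Z′≤ = ≤-pred (≤-trans (≤-reflexive (≡-sym (#-remove y∈))) Z≤)
    halves : m * 2 ^ z ≤ # (λ v → I v ∧ σ v y) ⊎ m * 2 ^ z ≤ # (λ v → I v ∧ not (σ v y))
    halves with m * 2 ^ z ≤? # (λ v → I v ∧ σ v y) | m * 2 ^ z ≤? # (λ v → I v ∧ not (σ v y))
    ... | yes p | _ = inj₁ p
    ... | no _ | yes q = inj₂ q
    ... | no p | no q = ⊥-elim (<-irrefl refl (begin-strict
        # I                                                            ≡⟨ #-split I (λ v → σ v y) ⟩
        # (λ v → I v ∧ σ v y) + # (λ v → I v ∧ not (σ v y))            <⟨ +-mono-< (≰⇒> p) (≰⇒> q) ⟩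
        m * 2 ^ z + m * 2 ^ z                                          ≡⟨ arith m (2 ^ z) ⟩
        m * 2 ^ suc z                                                  ≤⟨ I≥ ⟩
        # I                                                            ∎))
      where
      open ≤-Reasoning
      opaque
        arith : ∀ m x → m * x + m * x ≡ m * (x + (x + 0))
        arith = solve-∀
    descend : ∀ b (part : Fin n → Bool) → (∀ v → part v ≡ true → σ v y ≡ b) → m * 2 ^ z ≤ # (λ v → I v ∧ part v) →
      Agreeing σ m I
    descend b part part-b le with same-set σ m z Z′ (λ v → I v ∧ part v) S₀′ Z′≤ le agree′
      where
      S₀′ : Sub n
      S₀′ x = if ⌊ y ≟ x ⌋ then b else S₀ x
      agree′ : ∀ v → v ∈ (λ v → I v ∧ part v) → ∀ x → x ∉ Z′ → σ v x ≡ S₀′ x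
      agree′ v v∈ x x∉ with y ≟ x
      ... | yes refl = part-b v (proj₂ (∧⁻ {I v} v∈))
      ... | no _ = agree v (proj₁ (∧⁻ v∈)) x (≢true⇒false (λ e → false≢true x∉ (∧⁺ e refl)))
    ... | I′ , S₁ , I′⊆ , m≤ , same = I′ , S₁ , (λ v p → proj₁ (∧⁻ (I′⊆ v p))) , m≤ , same

  DenseSubset : ∀ {n} → Graph n → ℕ → Sub n → Set
  DenseSubset {n} H K Q = Σ (Sub n) λ Q′ → Q′ ⊆ Q × 1 ≤ # Q′ × 2 * K * # Q′ ≤ e₂ H Q′

  -- Unless Q has a dense subset, vertices of degree below 2 K can be split off repeatedly; the cliques through such a vertex
  -- are subsets of its neighbourhood.
  same-clique : ∀ {n} (H : Graph n) (σ : Fin n → Sub n) K m (Q I : Sub n) →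
    (∀ v → v ∈ I → σ v ⊆ Q × Clique H (σ v)) → # Q * (m * 2 ^ (2 * K)) + m ≤ # I → DenseSubset H K Q ⊎ Agreeing σ m I
  same-clique {n} H σ K m Q I cliques I≥ = go (# Q) Q I ≤-refl cliques I≥
    where
    go : ∀ fuel Q I → # Q ≤ fuel →
      (∀ v → v ∈ I → σ v ⊆ Q × Clique H (σ v)) → # Q * (m * 2 ^ (2 * K)) + m ≤ # I → DenseSubset H K Q ⊎ Agreeing σ m I
    go fuel Q I sz cliques I≥ with 1 ≤? # Q
    ... | no empty = inj₂ (I , ∅ , (λ _ p → p) , ≤-trans (m≤n+m m _) I≥ ,
          λ v v∈ x → ≢true⇒false (λ e → empty (#-pos {P = Q} (proj₁ (cliques v v∈) x e))))
    go zero Q I sz cliques I≥ | yes ne = ⊥-elim (<-irrefl refl (≤-trans ne sz))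
    go (suc fuel) Q I sz cliques I≥ | yes ne with 2 * K * # Q ≤? e₂ H Q
    ... | yes dense = inj₁ (Q , (λ _ p → p) , ne , dense)
    ... | no sparse with pick-below Q (deg H Q) (2 * K) (≰⇒> sparse)
    ... | x , x∈ , dx with m * 2 ^ (2 * K) ≤? # (λ v → I v ∧ σ v x)
    ... | yes many with same-set σ m (2 * K) (N[_,_] H Q x) (λ v → I v ∧ σ v x) ｛ x ｝ (<⇒≤ dx) many agree
      where
      agree : ∀ v → v ∈ (λ v → I v ∧ σ v x) → ∀ y → y ∉ N[_,_] H Q x → σ v y ≡ ｛ x ｝ y
      agree v v∈ y y∉ with ∧⁻ {I v} v∈
      ... | v∈I , x∈σ = bool-ext
        (λ y∈σ → ⌊⌋⁺ (x ≟ y) (stable y∈σ (x ≟ y)))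
        (λ e → subst (λ z → σ v z ≡ true) (∈｛｝⁻ {i = x} e) x∈σ)
        where
        stable : y ∈ σ v → Dec (x ≡ y) → x ≡ y
        stable y∈σ (yes e) = e
        stable y∈σ (no ne) = false≢true y∉ (∧⁺ (proj₁ (cliques v v∈I) y y∈σ) (proj₂ (cliques v v∈I) x y x∈σ y∈σ ne))
    ... | I′ , S₁ , I′⊆ , m≤ , same = inj₂ (I′ , S₁ , (λ v p → proj₁ (∧⁻ (I′⊆ v p))) , m≤ , same)
    -- Fewer than m 2^(2K) of the sets contain x. Dropping them together with x is paid for by the
    -- term |Q| m 2^(2K).
    go (suc fuel) Q I sz cliques I≥ | yes ne | no sparse | x , x∈ , dx | no few
      with go fuel (Q ∖ ｛ x ｝) (λ v → I v ∧ not (σ v x)) (≤-pred (≤-trans (≤-reflexive (≡-sym (#-remove x∈))) sz)) cliques′ I′≥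
      where
      cliques′ : ∀ v → v ∈ (λ v → I v ∧ not (σ v x)) → σ v ⊆ Q ∖ ｛ x ｝ × Clique H (σ v)
      cliques′ v v∈ = (λ y y∈ → ∈∖｛｝⁺ {P = Q} (proj₁ (cliques v (proj₁ (∧⁻ v∈))) y y∈)
          (λ { refl → false≢true (not⁻ (proj₂ (∧⁻ {I v} v∈))) y∈ })) , proj₂ (cliques v (proj₁ (∧⁻ v∈)))
      X = m * 2 ^ (2 * K)
      I′≥ : # (Q ∖ ｛ x ｝) * X + m ≤ # (λ v → I v ∧ not (σ v x))
      I′≥ = linear 0 (I≥′ ⊕ ≤-reflexive (#-split I (λ v → σ v x)) ⊕ <⇒≤ (≰⇒> few))
          (arith (# (Q ∖ ｛ x ｝)) X m (# I) (# (λ v → I v ∧ σ v x)) (# (λ v → I v ∧ not (σ v x))))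
        where
        I≥′ : suc (# (Q ∖ ｛ x ｝)) * X + m ≤ # I
        I≥′ = subst (λ q → q * X + m ≤ # I) (#-remove x∈) I≥
        opaque
          arith : ∀ q X m i a b → b + ((suc q * X + m) + i + a) ≡ q * X + m + (i + (a + b) + X) + 0
          arith = solve-∀
    ... | inj₁ (Q′ , Q′⊆ , rest) = inj₁ (Q′ , (λ i p → proj₁ (∧⁻ (Q′⊆ i p))) , rest)
    ... | inj₂ (I′ , S₁ , I′⊆ , rest) = inj₂ (I′ , S₁ , (λ v p → proj₁ (∧⁻ (I′⊆ v p))) , rest)

  Extends : ∀ {n} → Graph n → Graph n → Set
  Extends H K = ∀ i j → adj H i j ≡ true → adj K i j ≡ true

  -- Contractions take place between the choice of the pieces and their use; they only add edges,
  -- and the size bounds of a piece do not involve edges.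
  Piece-mono : ∀ {n} {H K : Graph n} {S β v J} → Extends H K → Piece H S β v J → Piece K S β v J
  Piece-mono {H = H} {K} {S} {β} {v} {J} ext p = record
    { J-S = J-S ; v∉S = v∉S ; v∉J = v∉J ; hub-J = λ u u∈ → ext v u (hub-J u u∈) ; hub-S = λ x x∈ → ext v x (hub-S x x∈)
    ; upper = upper ; lower = lower
    ; degrees = λ u u∈ → ≤-trans (degrees u u∈) (+-mono-≤ (deg-mono {H = H} {K} {J} {J} ext (λ _ q → q) u) (deg-mono {H = H} {K} {S} {S} ext (λ _ q → q) u)) }
    where open Piece p

  Piece-cong : ∀ {n} {H : Graph n} {S S′ β v J} → (∀ x → S x ≡ S′ x) → Piece H S β v J → Piece H S′ β v J
  Piece-cong {H = H} {S} {S′} {β} {v} {J} eq p = record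
    { J-S = λ w w∈ → trans (≡-sym (eq w)) (J-S w w∈) ; v∉S = trans (≡-sym (eq v)) v∉S ; v∉J = v∉J
    ; hub-J = hub-J ; hub-S = λ x x∈ → hub-S x (trans (eq x) x∈)
    ; upper = subst (λ s → # J + 2 * s ≤ 2 * (β + 3)) (#-cong eq) upper ; lower = subst (λ s → suc β ≤ # J + s) (#-cong eq) lower
    ; degrees = λ u u∈ → subst (λ s → β ≤ deg H J u + s) (#-cong (λ w → cong (_∧ adj H u w) (eq w))) (degrees u u∈) }
    where open Piece p

  e₂-strict : ∀ {n} {H K : Graph n} {S : Sub n} {x y} → Extends H K → x ∈ S → y ∈ S → adj H x y ≡ false → adj K x y ≡ true →
    2 + e₂ H S ≤ e₂ K S
  e₂-strict {n} {H} {K} {S} {x} {y} ext x∈ y∈ no-xy xy = begin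
    2 + e₂ H S                                         ≡⟨ cong (2 +_) (e₂-remove H x∈) ⟩
    2 + (2 * deg H S x + e₂ H (S ∖ ｛ x ｝))           ≡⟨ arith (deg H S x) (e₂ H (S ∖ ｛ x ｝)) ⟩
    2 * suc (deg H S x) + e₂ H (S ∖ ｛ x ｝)           ≤⟨ +-mono-≤ (2 ⊛ more) (e₂-mono {H = H} {K} {S ∖ ｛ x ｝} ext) ⟩
    2 * deg K S x + e₂ K (S ∖ ｛ x ｝)                 ≡⟨ ≡-sym (e₂-remove K x∈) ⟩
    e₂ K S                                             ∎
    where
    open ≤-Reasoning
    opaque
      arith : ∀ d e → 2 + (2 * d + e) ≡ 2 * suc d + e
      arith = solve-∀
    more : suc (deg H S x) ≤ deg K S x
    more = ≤-trans (s≤s (#-mono (λ w p → ∈∖｛｝⁺ {P = N[_,_] K S x} {y} (∧⁺ (proj₁ (∧⁻ p)) (ext x w (proj₂ (∧⁻ {S w} p))))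
             (λ { refl → false≢true no-xy (proj₂ (∧⁻ {S w} p)) })))) (≤-reflexive (≡-sym (#-remove {P = N[_,_] K S x} {y} (∧⁺ y∈ xy))))

  -- As long as some σ v ⊆ S is not a clique, contract v into S; this adds an edge inside S.
  contract-into : ∀ {n I} {R : I → I → Set} (S : Sub n) (σ B : Fin n → Sub n) (Z : Sub n) →
    (∀ v → v ∈ Z → v ∈ B v × v ∉ S × σ v ⊆ S) → Packed B Z → (H : Graph n) (P : Sub n) → S ⊆ P → (∀ v → v ∈ Z → B v ⊆ P) →
    (∀ v → v ∈ Z → ∀ x → x ∈ σ v → adj H v x ≡ true) →
    (∀ H′ P′ Z′ → Extends H H′ → S ⊆ P′ → Z′ ⊆ Z → (∀ v → v ∈ Z′ → B v ⊆ P′) → (∀ v → v ∈ Z′ → Clique H′ (σ v)) →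
      2 * # Z + e₂ H S ≤ 2 * # Z′ + e₂ H′ S → Model R H′ P′) → Model R H P
  contract-into {n} {R = R} S σ B Z facts packed H P S⊆P B⊆P hub k = go (# Z) Z H P ≤-refl (λ _ p → p) (λ _ _ e → e) S⊆P B⊆P ≤-refl
    where
    go : ∀ fuel Z′ K Q → # Z′ ≤ fuel → Z′ ⊆ Z → Extends H K → S ⊆ Q → (∀ v → v ∈ Z′ → B v ⊆ Q) →
      2 * # Z + e₂ H S ≤ 2 * # Z′ + e₂ K S → Model R K Q
    go fuel Z′ K Q sz Z′⊆ ext S⊆Q B⊆Q count with any? (λ v → any? (λ x → any? (λ y → (Z′ v ≟ᵇ true) ×-dec
        ((σ v x ≟ᵇ true) ×-dec ((σ v y ≟ᵇ true) ×-dec (¬? (x ≟ y) ×-dec (adj K x y ≟ᵇ false)))))))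
    ... | no ¬bad = k K Q Z′ ext S⊆Q Z′⊆ B⊆Q cliques count
      where
      cliques : ∀ v → v ∈ Z′ → Clique K (σ v)
      cliques v v∈ x y x∈ y∈ ne = [ (λ e → e) , (λ e → ⊥-elim (¬bad (v , x , y , v∈ , x∈ , y∈ , ne , e))) ]′ (bool? (adj K x y))
    go zero Z′ K Q sz _ _ _ _ _ | yes (v , x , y , v∈ , _) = ⊥-elim (<-irrefl refl (≤-trans (#-pos {P = Z′} v∈) sz))
    -- v is adjacent to both x and y, so merging it into x creates the edge xy. By `packed`, v lies
    -- in no other set `B u`, so the remaining pieces are untouched.
    go (suc fuel) Z′ K Q sz Z′⊆ ext S⊆Q B⊆Q count | yes (v , x , y , v∈ , x∈ , y∈ , ne , no-xy) =
      contract-model x v K (trans (sym K x v) vx) (S⊆Q x x∈S) (B⊆Q v v∈ v v∈B)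
        (go fuel Z″ K′ (Q ∖ ｛ v ｝) (≤-pred (≤-trans (≤-reflexive (≡-sym (#-remove v∈))) sz))
          (λ w p → Z′⊆ w (proj₁ (∈∖｛｝⁻ Z′ p))) (λ i j e → contract-mono x v K i j (ext i j e)) S⊆ B⊆ count′)
      where
      v∈Z = Z′⊆ v v∈
      v∈B = proj₁ (facts v v∈Z)
      v∉S = proj₁ (proj₂ (facts v v∈Z))
      σ⊆S = proj₂ (proj₂ (facts v v∈Z))
      x∈S = σ⊆S x x∈
      y∈S = σ⊆S y y∈
      vx = ext v x (hub v v∈Z x x∈)
      vy = ext v y (hub v v∈Z y y∈)
      K′ = contract x v K
      Z″ = Z′ ∖ ｛ v ｝
      S⊆ : S ⊆ Q ∖ ｛ v ｝
      S⊆ w w∈ = ∈∖｛｝⁺ {P = Q} (S⊆Q w w∈) (λ { refl → false≢true v∉S w∈ })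
      B⊆ : ∀ u → u ∈ Z″ → B u ⊆ Q ∖ ｛ v ｝
      B⊆ u u∈ w w∈ = ∈∖｛｝⁺ {P = Q} (B⊆Q u (proj₁ (∈∖｛｝⁻ Z′ u∈)) w w∈)
        (λ { refl → proj₂ (∈∖｛｝⁻ Z′ u∈) (packed v u v v∈Z (Z′⊆ u (proj₁ (∈∖｛｝⁻ Z′ u∈))) v∈B w∈) })
      count′ : 2 * # Z + e₂ H S ≤ 2 * # Z″ + e₂ K′ S
      count′ = linear 0 (subst (λ s → 2 * # Z + e₂ H S ≤ 2 * s + e₂ K S) (#-remove v∈) count
          ⊕ e₂-strict {H = K} {K′} {S} (contract-mono x v K) x∈S y∈S no-xy (contract-at x v K y ne vy))
          (arith (# Z) (# Z″) (e₂ H S) (e₂ K S) (e₂ K′ S))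
        where
        opaque
          arith : ∀ z z″ h k k′ → 2 * z″ + k′ + ((2 * z + h) + (2 + k)) ≡ 2 * z + h + ((2 * suc z″ + k) + k′) + 0
          arith = solve-∀

  module _ {n : ℕ} (H : Graph n) {P S J : Sub n} (P-split : ∀ w → w ∈ P → w ∈ S ⊎ w ∈ J)
    (S⊆P : S ⊆ P) (J⊆P : J ⊆ P) (J-S : ∀ w → w ∈ J → w ∉ S) where

    deg-split : ∀ u → deg H P u ≡ deg H J u + deg H S u
    deg-split u = trans (#-split (N[_,_] H P u) S) (trans (+-comm (# (N[_,_] H P u ∩ S)) _) (cong₂ _+_ (#-cong inJ) (#-cong inS)))
      where
      inS : ∀ w → (P w ∧ adj H u w) ∧ S w ≡ S w ∧ adj H u w
      inS w = bool-ext (λ e → ∧⁺ (proj₂ (∧⁻ {P w ∧ adj H u w} e)) (proj₂ (∧⁻ {P w} (proj₁ (∧⁻ {P w ∧ adj H u w} e)))))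
        (λ e → ∧⁺ (∧⁺ (S⊆P w (proj₁ (∧⁻ e))) (proj₂ (∧⁻ {S w} e))) (proj₁ (∧⁻ e)))
      inJ : ∀ w → (P w ∧ adj H u w) ∧ not (S w) ≡ J w ∧ adj H u w
      inJ w = bool-ext
        (λ e → let p , s = ∧⁻ {P w ∧ adj H u w} e ; q , a = ∧⁻ {P w} p in
          ∧⁺ ([ (λ s′ → false≢true (not⁻ s) s′) , (λ j → j) ]′ (P-split w q)) a)
        (λ e → ∧⁺ (∧⁺ (J⊆P w (proj₁ (∧⁻ e))) (proj₂ (∧⁻ {J w} e))) (not⁺ (J-S w (proj₁ (∧⁻ e)))))

    #-parts : # P ≡ # J + # S
    #-parts = trans (#-split P S) (trans (+-comm (# (P ∩ S)) _) (cong₂ _+_ (#-cong inJ) (#-cong inS)))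
      where
      inS : ∀ w → P w ∧ S w ≡ S w
      inS w = bool-ext (λ e → proj₂ (∧⁻ {P w} e)) (λ e → ∧⁺ (S⊆P w e) e)
      inJ : ∀ w → P w ∧ not (S w) ≡ J w
      inJ w = bool-ext (λ e → [ (λ s → false≢true (not⁻ (proj₂ (∧⁻ {P w} e))) s) , (λ j → j) ]′ (P-split w (proj₁ (∧⁻ e))))
        (λ e → ∧⁺ (J⊆P w e) (not⁺ (J-S w e)))

    sum-parts : ∀ f → sum-on P f ≡ sum-on J f + sum-on S f
    sum-parts f = trans (sum-on-split P S f) (trans (+-comm (sum-on (P ∩ S) f) _)
        (cong₂ _+_ (≤-antisym (sum-on-⊆ f inJ) (sum-on-⊆ f inJ′)) (≤-antisym (sum-on-⊆ f (λ w p → proj₂ (∧⁻ {P w} p))) (sum-on-⊆ f (λ w p → ∧⁺ (S⊆P w p) p)))))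
      where
      inJ : P ∖ S ⊆ J
      inJ w e = [ (λ s → false≢true (not⁻ (proj₂ (∧⁻ {P w} e))) s) , (λ j → j) ]′ (P-split w (proj₁ (∧⁻ e)))
      inJ′ : J ⊆ P ∖ S
      inJ′ w e = ∧⁺ (J⊆P w e) (not⁺ (J-S w e))

    -- `e₂` counts an edge between J and S from both ends, which allows the weight 2; edges inside S
    -- are given away.
    e₂-parts : sum-on J (λ u → deg H J u + 2 * deg H S u) ≤ e₂ H P
    e₂-parts = begin
      sum-on J (λ u → deg H J u + 2 * deg H S u)                                         ≡⟨ sum-on-cong (λ u _ → arith (deg H J u) (deg H S u)) ⟩
      sum-on J (λ u → (deg H J u + deg H S u) + deg H S u)                               ≡⟨ sum-on-+ J _ _ ⟩
      sum-on J (λ u → deg H J u + deg H S u) + sum-on J (deg H S)                        ≡⟨ cong₂ _+_ (sum-on-cong (λ u _ → ≡-sym (deg-split u))) flip ⟩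
      sum-on J (deg H P) + sum-on S (deg H J)                                            ≤⟨ +-monoʳ-≤ (sum-on J (deg H P)) (sum-on-mono (λ u _ → ≤-trans (m≤m+n _ _) (≤-reflexive (≡-sym (deg-split u))))) ⟩
      sum-on J (deg H P) + sum-on S (deg H P)                                            ≡⟨ ≡-sym (sum-parts (deg H P)) ⟩
      e₂ H P                                                                             ∎
      where
      open ≤-Reasoning
      opaque
        arith : ∀ a b → a + 2 * b ≡ (a + b) + b
        arith = solve-∀
      flip : sum-on J (deg H S) ≡ sum-on S (deg H J)
      flip = trans (double-count J S (adj H)) (sum-on-cong (λ u _ → #-cong (λ w → cong (J w ∧_) (sym H w u))))

  -- Read p = |P|, s = |S|, z = |Z|, and k for the number of hubs. If k were smaller, p ≤ a (z + s)
  -- would be at most A T s + a b T m; `sparse` makes the first term at most p / 2, and then p ≤ 2 a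
  -- b m T contradicts `large`.
  many-hubs : ∀ {a b B M m p s T z k X} → 4 * B * (2 * (a * (b * M + 1))) * (T * s) ≤ 2 * (2 * B * p) → 1 ≤ B → 1 ≤ T → T ≤ X →
    p ≤ a * (z + s) → z ≤ b * T * k → suc (2 * (a * b) * m * X) ≤ p → M * s + m ≤ k
  many-hubs {a} {b} {B} {M} {m} {p} {s} {T} {z} {k} {X} sparse B≥1 T≥1 T≤ p≤ z≤ large = ≮⇒≥ (λ k< →
    <-irrefl refl (<-≤-trans (s≤s (bound k<)) large))
    where
    open ≤-Reasoning
    A = a * (b * M + 1)
    s-small : 2 * A * (T * s) ≤ p
    s-small = *-cancelˡ-≤ (4 * B) ⦃ m*n≢0 4 B ⦃ _ ⦄ ⦃ >-nonZero B≥1 ⦄ ⦄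
      (≤-trans (≤-reflexive (≡-sym (*-assoc (4 * B) (2 * A) (T * s)))) (≤-trans sparse (≤-reflexive (arith₁ B p))))
      where
      opaque
        arith₁ : ∀ x p → 2 * (2 * x * p) ≡ 4 * x * p
        arith₁ = solve-∀
    s≤Ts : s ≤ T * s
    s≤Ts = ≤-trans (≤-reflexive (≡-sym (*-identityˡ s))) (*-monoˡ-≤ s T≥1)
    p-upper : k < M * s + m → p ≤ A * (T * s) + a * b * T * m
    p-upper k< = begin
      p                                                ≤⟨ p≤ ⟩
      a * (z + s)                                      ≤⟨ a ⊛ (z≤ ⊕ s≤Ts) ⟩
      a * (b * T * k + T * s)                          ≤⟨ a ⊛ +-monoˡ-≤ (T * s) ((b * T) ⊛ <⇒≤ k<) ⟩
      a * (b * T * (M * s + m) + T * s)                ≡⟨ arith₂ a b T M s m ⟩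
      A * (T * s) + a * b * T * m                      ∎
      where
      opaque
        arith₂ : ∀ a b T M s m → a * (b * T * (M * s + m) + T * s) ≡ a * (b * M + 1) * (T * s) + a * b * T * m
        arith₂ = solve-∀
    bound : k < M * s + m → p ≤ 2 * (a * b) * m * X
    bound k< = begin
      p                              ≤⟨ linear 0 (2 ⊛ p-upper k< ⊕ s-small) (arith₃ p A (T * s) (a * b) T m) ⟩
      2 * (a * b) * m * T            ≤⟨ *-monoʳ-≤ (2 * (a * b) * m) T≤ ⟩
      2 * (a * b) * m * X            ∎
      where
      opaque
        arith₃ : ∀ p c x y T m → 2 * y * m * T + (2 * p + 2 * c * x) ≡ p + (2 * (c * x + y * T * m) + p) + 0
        arith₃ = solve-∀

  module Structure {I : Set} {R : I → I → Set} (K β m : ℕ) (m≥1 : 1 ≤ m)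
    (base : ∀ {n} (H : Graph n) Q → 1 ≤ # Q → 2 * K * # Q ≤ e₂ H Q → Model R H Q)
    (local : ∀ {n} {H : Graph n} {S : Sub n} (v : Fin m → Fin n) (J : Fin m → Sub n) → Clique H S →
      (∀ i → Piece H S β (v i) (J i)) → (∀ i j w → w ∈ J i ∪ ｛ v i ｝ → w ∈ J j ∪ ｛ v j ｝ → i ≡ j) →
      Model R H (⋃ (λ i → J i ∪ ｛ v i ｝) ∪ S))
    where

    -- `perVertex`: K |S| hubs may be contracted before S becomes dense enough for `base`, and m
    -- 2^(2K) per vertex of S feed the pigeonhole. The number `scales` is such that the best scale
    -- satisfies 2 `coefficient` T |S| ≤ |P|; `largeOrder` beats every T up to 2^`scales`.
    perVertex coefficient scales largeOrder : ℕ
    perVertex = K + m * 2 ^ (2 * K)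
    coefficient = (β + 3) * ((2 * β + 7) * perVertex + 1)
    scales = 4 * (β + 2) * (2 * coefficient)
    largeOrder = suc (2 * ((β + 3) * (2 * β + 7)) * m * 2 ^ scales)

    structure : ∀ {n} (H : Graph n) P → Irreducible β H P → largeOrder ≤ # P → e₂ H P ≤ 2 * (β + 2) * # P → Model R H P
    structure {n} H P (degs , commons) large upper = from-scale (sparse-scale P (deg H P) scales scales≥1)
      where
      scales≥1 : 1 ≤ scales
      scales≥1 = *-mono-≤ {1} {4 * (β + 2)} (*-mono-≤ {1} {4} (s≤s z≤n) (≤-trans (s≤s z≤n) (m≤n+m 2 β)))
        (*-mono-≤ {1} {2} (s≤s z≤n) (*-mono-≤ {1} {β + 3} (≤-trans (s≤s z≤n) (m≤n+m 3 β)) (m≤n+m 1 _)))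

      from-scale : ∃[ i ] (i < scales × scales * (2 ^ i * # (atLeast P (deg H P) (2 ^ i))) ≤ 2 * e₂ H P) → Model R H P
      from-scale (i , i< , sparse) = from-packing (packing B ((2 * β + 7) * T) Z (λ v v∈ → self∈ v) few)
        where
        T = 2 ^ i
        S J Z : Sub n
        S = atLeast P (deg H P) T
        J = P ∖ S
        -- The weight 2 gives |`τ v`| ≤ 2 (β + 3 - |`σ v`|): a piece is small in proportion to what
        -- its clique lacks.
        Z v = J v ∧ ⌊ deg H J v + 2 * deg H S v ≤? 2 * (β + 3) ⌋
        σ τ B : Fin n → Sub n
        σ v = N[_,_] H S v
        τ v = N[_,_] H J v
        B v = τ v ∪ ｛ v ｝

        S⊆P : S ⊆ P
        S⊆P w p = proj₁ (∧⁻ p)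
        J⊆P : J ⊆ P
        J⊆P w p = proj₁ (∧⁻ p)
        J-S : ∀ w → w ∈ J → w ∉ S
        J-S w p = not⁻ (proj₂ (∧⁻ {P w} p))
        P-split : ∀ w → w ∈ P → w ∈ S ⊎ w ∈ J
        P-split w p = [ inj₁ , (λ s → inj₂ (∧⁺ p (not⁺ s))) ]′ (bool? (S w))
        Z⊆J : Z ⊆ J
        Z⊆J w p = proj₁ (∧⁻ p)
        self∈ : ∀ v → v ∈ B v
        self∈ v = ∨⁺ʳ {τ v v} (∈｛｝ v)
        B⊆J : ∀ v → v ∈ Z → B v ⊆ J
        B⊆J v v∈ w p = [ (λ q → proj₁ (∧⁻ q)) , (λ q → subst (_∈ J) (∈｛｝⁻ q) (Z⊆J v v∈)) ]′ (∨⁻ {τ v w} p)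

        Z-bound : ∀ v → v ∈ Z → deg H J v + 2 * deg H S v ≤ 2 * (β + 3)
        Z-bound v v∈ = ⌊⌋⁻ (deg H J v + 2 * deg H S v ≤? 2 * (β + 3)) (proj₂ (∧⁻ {J v} v∈))

        J-deg : ∀ u → u ∈ J → suc (deg H J u) ≤ T
        J-deg u u∈ = ≤-trans (s≤s (deg-mono {H = H} {H} {J} {P} (λ _ _ e → e) J⊆P u))
          (≰⇒> (λ le → false≢true (J-S u u∈) (∧⁺ (J⊆P u u∈) (⌊⌋⁺ (T ≤? deg H P u) le))))

        -- If `B w` meets `B v` in u, then u is one of at most 2 β + 7 elements of `B v`, and w is u
        -- or one of fewer than T neighbours of u in J.
        few : ∀ v → v ∈ Z → # (λ w → Z w ∧ meet? (B v) (B w)) ≤ (2 * β + 7) * T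
        few v v∈ = begin
          # X                                                 ≡⟨ ≡-sym (trans (sum-on-const X 1) (*-identityˡ (# X))) ⟩
          sum-on X (λ _ → 1)                                  ≤⟨ sum-on-mono (λ w w∈ → let u , a , b = meet⁻ {A = B v} {B w} (proj₂ (∧⁻ {Z w} w∈)) in #-pos {P = λ u → B v u ∧ B w u} {u} (∧⁺ a b)) ⟩
          sum-on X (λ w → # (λ u → B v u ∧ B w u))            ≡⟨ double-count X (B v) (λ w u → B w u) ⟩
          sum-on (B v) (λ u → # (λ w → X w ∧ B w u))          ≤⟨ sum-on-mono near ⟩
          sum-on (B v) (λ _ → T)                              ≡⟨ trans (sum-on-const (B v) T) (*-comm T (# (B v))) ⟩
          # (B v) * T                                         ≤⟨ *-monoˡ-≤ T #B ⟩
          (2 * β + 7) * T                                     ∎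
          where
          open ≤-Reasoning
          X : Sub n
          X w = Z w ∧ meet? (B v) (B w)
          near : ∀ u → u ∈ B v → # (λ w → X w ∧ B w u) ≤ T
          near u u∈ = ≤-trans (≤-sub-bound {Q = τ u} {｛ u ｝} cover) (≤-trans (≤-reflexive (trans (cong (# (τ u) +_) (#-single u)) (+-comm (# (τ u)) 1))) (J-deg u (B⊆J v v∈ u u∈)))
            where
            cover : ∀ w → w ∈ (λ w → X w ∧ B w u) → w ∈ τ u ⊎ w ∈ ｛ u ｝
            cover w p with ∧⁻ {X w} p
            ... | x , b with ∨⁻ {τ w u} b
            ... | inj₁ q = inj₁ (∧⁺ (Z⊆J w (proj₁ (∧⁻ x))) (trans (sym H u w) (proj₂ (∧⁻ {J u} q))))
            ... | inj₂ q = inj₂ (⌊⌋⁺ (u ≟ w) (≡-sym (∈｛｝⁻ q)))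
          #B : # (B v) ≤ 2 * β + 7
          #B = ≤-trans (#-∪ (τ v) ｛ v ｝) (≤-trans (+-mono-≤ (≤-trans (m≤m+n _ _) (Z-bound v v∈)) (≤-reflexive (#-single v))) (≤-reflexive (arith β)))
            where
            opaque
              arith : ∀ b → 2 * (b + 3) + 1 ≡ 2 * b + 7
              arith = solve-∀

        piece : ∀ v → v ∈ Z → Piece H (σ v) β v (τ v)
        piece v v∈ = record
          { J-S = λ w w∈ → ≢true⇒false (λ e → false≢true (J-S w (proj₁ (∧⁻ w∈))) (proj₁ (∧⁻ e)))
          ; v∉S = ≢true⇒false (λ e → false≢true (irrefl H v) (proj₂ (∧⁻ {S v} e)))
          ; v∉J = ≢true⇒false (λ e → false≢true (irrefl H v) (proj₂ (∧⁻ {J v} e)))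
          ; hub-J = λ u u∈ → proj₂ (∧⁻ {J u} u∈)
          ; hub-S = λ x x∈ → proj₂ (∧⁻ {S x} x∈)
          ; upper = Z-bound v v∈
          ; lower = ≤-trans (degs v (J⊆P v (Z⊆J v v∈))) (≤-reflexive (deg-split H P-split S⊆P J⊆P J-S v))
          ; degrees = λ u u∈ → ≤-trans (commons v u (J⊆P v (Z⊆J v v∈)) (J⊆P u (proj₁ (∧⁻ u∈))) (proj₂ (∧⁻ {J u} u∈)))
              (≤-sub-bound {Q = N[_,_] H (τ v) u} {N[_,_] H (σ v) u} (λ w p →
                let w∈P , q = ∧⁻ {P w} p ; vw , uw = ∧⁻ {adj H v w} q in
                [ (λ s → inj₂ (∧⁺ (∧⁺ s vw) uw)) , (λ j → inj₁ (∧⁺ (∧⁺ j vw) uw)) ]′ (P-split w w∈P))) }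

        -- Markov: the weights sum to at most 2 (β + 2) |P| over J, so at most a fraction (β + 2) /
        -- (β + 3) of P exceeds 2 (β + 3). This is why the density must be bounded from above.
        most-good : # P ≤ (β + 3) * (# Z + # S)
        most-good = linear 0 (bad ⊕ (β + 3) ⊛ ≤-reflexive parts) (arith β (# P) (# Z) (# (J ∖ G)) (# S))
          where
          G : Sub n
          G v = ⌊ deg H J v + 2 * deg H S v ≤? 2 * (β + 3) ⌋
          parts : # P ≡ # Z + # (J ∖ G) + # S
          parts = trans (#-parts H P-split S⊆P J⊆P J-S) (cong (_+ # S) (#-split J G))
          bad : (β + 3) * # (J ∖ G) ≤ (β + 2) * # P
          bad = *-cancelˡ-≤ 2 (begin
            2 * ((β + 3) * # (J ∖ G))                             ≡⟨ ≡-sym (*-assoc 2 (β + 3) _) ⟩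
            2 * (β + 3) * # (J ∖ G)                               ≡⟨ ≡-sym (sum-on-const (J ∖ G) (2 * (β + 3))) ⟩
            sum-on (J ∖ G) (λ _ → 2 * (β + 3))                    ≤⟨ sum-on-mono (λ v p → <⇒≤ (≰⇒> (⌊⌋-false⁻ (deg H J v + 2 * deg H S v ≤? 2 * (β + 3)) (not⁻ (proj₂ (∧⁻ {J v} p)))))) ⟩
            sum-on (J ∖ G) (λ v → deg H J v + 2 * deg H S v)      ≤⟨ sum-on-⊆ _ (λ v p → proj₁ (∧⁻ p)) ⟩
            sum-on J (λ v → deg H J v + 2 * deg H S v)            ≤⟨ e₂-parts H P-split S⊆P J⊆P J-S ⟩
            e₂ H P                                                ≤⟨ upper ⟩
            2 * (β + 2) * # P                                     ≡⟨ *-assoc 2 (β + 2) (# P) ⟩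
            2 * ((β + 2) * # P)                                   ∎)
            where open ≤-Reasoning
          opaque
            arith : ∀ b p z g s → (b + 3) * (z + s) + ((b + 3) * g + (b + 3) * p) ≡ p + ((b + 2) * p + (b + 3) * (z + g + s)) + 0
            arith = solve-∀

        from-packing : ∃[ I₀ ] (I₀ ⊆ Z × Packed B I₀ × # Z ≤ (2 * β + 7) * T * # I₀) → Model R H P
        from-packing (I₀ , I₀⊆Z , packed , Z≤) = contract-into S σ B I₀
            (λ v v∈ → self∈ v , J-S v (Z⊆J v (I₀⊆Z v v∈)) , λ x p → proj₁ (∧⁻ p)) packed H P S⊆P
            (λ v v∈ w p → J⊆P w (B⊆J v (I₀⊆Z v v∈) w p)) (λ v v∈ x p → proj₂ (∧⁻ {S x} p)) contracted
          where
          hubs : perVertex * # S + m ≤ # I₀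
          hubs = many-hubs {β + 3} {2 * β + 7} {β + 2} {perVertex} {X = 2 ^ scales} (≤-trans sparse (2 ⊛ upper)) (≤-trans (s≤s z≤n) (m≤n+m 2 β)) (m^n>0 2 i) (^-monoʳ-≤ 2 (<⇒≤ i<)) most-good Z≤ large

          contracted : ∀ H′ P′ Z′ → Extends H H′ → S ⊆ P′ → Z′ ⊆ I₀ → (∀ v → v ∈ Z′ → B v ⊆ P′) → (∀ v → v ∈ Z′ → Clique H′ (σ v)) →
            2 * # I₀ + e₂ H S ≤ 2 * # Z′ + e₂ H′ S → Model R H′ P′
          contracted H′ P′ Z′ ext S⊆P′ Z′⊆ B⊆P′ cliques count = by-density (1 ≤? # S) (2 * K * # S ≤? e₂ H′ S)
            where
            agreeing : Agreeing σ m Z′ → Model R H′ P′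
            agreeing (I′ , S₁ , I′⊆ , m≤ , same) with choose m I′ m≤ | #-witness {P = I′} (≤-trans m≥1 m≤)
            ... | v , v∈ , v-inj | a , a∈ = model-mono within (local v (λ i → τ (v i)) clique₁
                (λ i → Piece-cong (same (v i) (v∈ i)) (Piece-mono ext (piece (v i) (in-Z (v i) (v∈ i)))))
                (λ i j w p q → v-inj i j (packed (v i) (v j) w (Z′⊆ _ (I′⊆ _ (v∈ i))) (Z′⊆ _ (I′⊆ _ (v∈ j))) p q)))
              where
              in-Z : ∀ v → v ∈ I′ → v ∈ Z
              in-Z v p = I₀⊆Z v (Z′⊆ v (I′⊆ v p))
              clique₁ : Clique H′ S₁
              clique₁ x y x∈ y∈ = cliques a (I′⊆ a a∈) x y (trans (same a a∈ x) x∈) (trans (same a a∈ y) y∈)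
              within : ⋃ (λ i → τ (v i) ∪ ｛ v i ｝) ∪ S₁ ⊆ P′
              within w p = [ (λ q → let i , r = ⋃⁻ (λ i → B (v i)) q in B⊆P′ (v i) (I′⊆ _ (v∈ i)) w r)
                           , (λ q → S⊆P′ w (proj₁ (∧⁻ (trans (same a a∈ w) q)))) ]′ (∨⁻ {⋃ (λ i → B (v i)) w} p)

            finish : e₂ H′ S ≤ 2 * K * # S → Model R H′ P′
            finish sparse′ = [ (λ { (Q , Q⊆ , ne , dense) → model-mono (λ w p → S⊆P′ w (Q⊆ w p)) (base H′ Q ne dense) }) , agreeing ]′
              (same-clique H′ σ K m S Z′ (λ v v∈ → (λ x p → proj₁ (∧⁻ p)) , cliques v v∈) enough)
              where
              enough : # S * (m * 2 ^ (2 * K)) + m ≤ # Z′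
              enough = *-cancelˡ-≤ 2 (linear (e₂ H S) (2 ⊛ hubs ⊕ count ⊕ sparse′) (arith (# S) (m * 2 ^ (2 * K)) m K (# I₀) (# Z′) (e₂ H S) (e₂ H′ S)))
                where
                opaque
                  arith : ∀ s x m K i z e e′ → 2 * z + (2 * ((K + x) * s + m) + (2 * i + e) + e′)
                    ≡ 2 * (s * x + m) + (2 * i + (2 * z + e′) + 2 * K * s) + e
                  arith = solve-∀

            -- Either the contractions made S dense and `base` finds the model inside S, or `e₂` of
            -- S bounds their number by K |S|. An empty S goes to the second case, since `base` asks
            -- for a vertex.
            by-density : Dec (1 ≤ # S) → Dec (2 * K * # S ≤ e₂ H′ S) → Model R H′ P′
            by-density (yes ne) (yes dense) = model-mono S⊆P′ (base H′ S ne dense)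
            by-density _ (no sparse′) = finish (<⇒≤ (≰⇒> sparse′))
            by-density (no empty) (yes _) = finish (≤-trans (≤-pred (≰⇒> (λ e → empty (#-pos {P = S} (proj₂ (e₂-witness H′ S e)))))) z≤n)

-- Descent on the density, and translation to the given notions of minor and density.

module Density where

  open Prelude
  open Counting
  open Minors
  open LocalStructure
  open GlobalStructure
  open import Data.Bool using (T)
  open import Data.Fin using (toℕ; combine; remQuot)
  open import Data.Fin.Properties using (toℕ-combine; combine-remQuot; toℕ<n; toℕ-injective)
  import Data.Integer as ℤ
  import Data.Integer.Properties as ℤ
  open import Data.List using (map; allFin; tabulate)
  open import Data.List.Properties using (map-tabulate)
  import Data.Nat.ListAction as List
  open import Data.Maybe using (Maybe; just; nothing)
  open import Data.Maybe.Properties using (just-injective)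
  open import Data.Nat.Divisibility using (n∣m*n)
  import Data.Rational as ℚ
  import Data.Rational.Properties as ℚ
  import Data.Rational.Unnormalised as ℚᵘ
  import Data.Rational.Unnormalised.Properties as ℚᵘ
  open import Data.Unit using (tt)

  Dense : {I : Set} → (I → I → Set) → ℕ → ℕ → Set
  Dense R γ N = ∀ {n} (H : Graph n) P → N ≤ # P → 2 * γ * # P ≤ e₂ H P → Model R H P

  module _ {I : Set} {R : I → I → Set} (K m : ℕ) (m≥1 : 1 ≤ m)
    (base : ∀ {n} (H : Graph n) Q → 1 ≤ # Q → 2 * K * # Q ≤ e₂ H Q → Model R H Q) (β₀ : ℕ)
    (local : ∀ β → β₀ ≤ β → ∀ {n} {H : Graph n} {S : Sub n} (v : Fin m → Fin n) (J : Fin m → Sub n) → Clique H S →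
      (∀ i → Piece H S β (v i) (J i)) → (∀ i j w → w ∈ J i ∪ ｛ v i ｝ → w ∈ J j ∪ ｛ v j ｝ → i ≡ j) →
      Model R H (⋃ (λ i → J i ∪ ｛ v i ｝) ∪ S))
    where

    -- The choice of M makes irreducible graphs with fewer than N vertices dense enough for base.
    density-step : ∀ β → β₀ ≤ β → ∃[ N ] Dense R (2 + β) N → ∃[ N ] Dense R (1 + β) N
    density-step β β≥ (N₁ , dense) = M , λ H P large e≥ → reduce β M irreducible-case H P
        (≤-trans (linear 0 (2 ⊛ large) (arith β (# P) M)) e≥)
      where
      open Structure {R = R} K β m m≥1 base (local β β≥)
      N = largeOrder + N₁
      M = suc (K * N)
      opaque
        arith : ∀ b p M → 2 * (1 + b) * p + 2 * M ≡ 2 * b * p + 2 * M + 2 * p + 0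
        arith = solve-∀
      irreducible-case : ∀ {n} (H : Graph n) P → Irreducible β H P → 2 * β * # P + 2 * M ≤ e₂ H P → Model R H P
      irreducible-case H P irr e≥ = by-size (N ≤? # P) (2 * (2 + β) * # P ≤? e₂ H P)
        where
        2M≤ : 2 * M ≤ e₂ H P
        2M≤ = ≤-trans (m≤n+m (2 * M) _) e≥
        by-size : Dec (N ≤ # P) → Dec (2 * (2 + β) * # P ≤ e₂ H P) → Model R H P
        -- A large irreducible graph either reaches density β + 2, where the preceding stage of the
        -- descent applies, or satisfies the upper bound required by `structure`.
        by-size (yes big) (yes e≥′) = dense H P (≤-trans (m≤n+m N₁ largeOrder) big) e≥′
        by-size (yes big) (no e<) = structure H P irr (≤-trans (m≤m+n largeOrder N₁) big)
          (subst (λ x → e₂ H P ≤ 2 * x * # P) (+-comm 2 β) (<⇒≤ (≰⇒> e<)))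
        by-size (no small) _ = base H P (#-pos {P = P} (proj₂ (e₂-witness H P (≤-trans (s≤s z≤n) 2M≤)))) (begin
          2 * K * # P       ≤⟨ *-monoʳ-≤ (2 * K) (<⇒≤ (≰⇒> small)) ⟩
          2 * K * N         ≡⟨ *-assoc 2 K N ⟩
          2 * (K * N)       ≤⟨ 2 ⊛ n≤1+n (K * N) ⟩
          2 * M             ≤⟨ 2M≤ ⟩
          e₂ H P            ∎)
          where open ≤-Reasoning

    density-descent : ∀ i → ∃[ N ] Dense R (1 + (β₀ + i)) N → ∃[ N ] Dense R (1 + β₀) N
    density-descent zero (N , dense) = N , subst (λ x → Dense R (1 + x) N) (+-identityʳ β₀) dense
    density-descent (suc i) (N , dense) = density-descent i (density-step (β₀ + i) (m≤m+n β₀ i)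
      (N , subst (λ x → Dense R (1 + x) N) (+-suc β₀ i) dense))

    dense-enough : ∃[ N ] Dense R (1 + β₀) N
    -- The descent starts K levels up, where the density is at least K and `base` applies to every
    -- nonempty graph.
    dense-enough = density-descent K (1 , λ H P ne e≥ → base H P ne
      (≤-trans (*-monoˡ-≤ (# P) (2 ⊛ ≤-trans (m≤n+m K β₀) (n≤1+n _))) e≥))

  opaque
    unfolding sum

    sum-allFin : ∀ n (f : Fin n → ℕ) → List.sum (map f (allFin n)) ≡ sum f
    sum-allFin n f = trans (cong List.sum (map-tabulate (λ i → i) f)) (tab n f)
      where
      tab : ∀ n (f : Fin n → ℕ) → List.sum (tabulate f) ≡ sum f
      tab zero f = refl
      tab (suc n) f = cong (f zero +_) (tab n (λ i → f (suc i)))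

  opaque
    unfolding # sum-on

    e₂-full : ∀ {n} (G : Graph n) → e₂ G (λ _ → true) ≡ sum (λ i → sum (λ j → 𝟙 (adj G i j)))
    e₂-full G = sum-cong (λ i → +-identityʳ _)

  edgeCount≤e₂ : ∀ {n} (G : Graph n) → 2 * edgeCount G ≤ e₂ G (λ _ → true)
  edgeCount≤e₂ {n} G = begin
    2 * edgeCount G                                                            ≡⟨ cong (edgeCount G +_) (+-identityʳ _) ⟩
    edgeCount G + edgeCount G                                                  ≡⟨ cong₂ _+_ count (trans count (sum-comm (λ i j → 𝟙 (lt i j)))) ⟩
    sum (λ i → sum (λ j → 𝟙 (lt i j))) + sum (λ i → sum (λ j → 𝟙 (lt j i)))    ≡⟨ ≡-sym (sum-+ _ _) ⟩
    sum (λ i → sum (λ j → 𝟙 (lt i j)) + sum (λ j → 𝟙 (lt j i)))                ≡⟨ sum-cong (λ i → ≡-sym (sum-+ _ _)) ⟩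
    sum (λ i → sum (λ j → 𝟙 (lt i j) + 𝟙 (lt j i)))                            ≤⟨ sum-mono (λ i → sum-mono (λ j → once i j)) ⟩
    sum (λ i → sum (λ j → 𝟙 (adj G i j)))                                      ≡⟨ ≡-sym (e₂-full G) ⟩
    e₂ G (λ _ → true)                                                          ∎
    where
    open ≤-Reasoning
    lt : Fin n → Fin n → Bool
    lt i j = (toℕ i <ᵇ toℕ j) ∧ adj G i j
    if-𝟙 : ∀ b → (if b then 1 else 0) ≡ 𝟙 b
    if-𝟙 true = refl
    if-𝟙 false = refl
    count : edgeCount G ≡ sum (λ i → sum (λ j → 𝟙 (lt i j)))
    count = trans (sum-allFin n _) (sum-cong (λ i → trans (sum-allFin n _) (sum-cong (λ j → if-𝟙 (lt i j)))))
    <ᵇ-asym : ∀ a b → (a <ᵇ b) ≡ true → (b <ᵇ a) ≡ true → ⊥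
    <ᵇ-asym a b p q = <-asym (<ᵇ⇒< a b (subst T (≡-sym p) tt)) (<ᵇ⇒< b a (subst T (≡-sym q) tt))
    once : ∀ i j → 𝟙 (lt i j) + 𝟙 (lt j i) ≤ 𝟙 (adj G i j)
    once i j rewrite sym G j i with toℕ i <ᵇ toℕ j in p | toℕ j <ᵇ toℕ i in q | adj G i j
    ... | true | true | _ = ⊥-elim (<ᵇ-asym (toℕ i) (toℕ j) p q)
    ... | true | false | true = ≤-refl
    ... | true | false | false = z≤n
    ... | false | true | true = ≤-refl
    ... | false | true | false = z≤n
    ... | false | false | _ = z≤n

  combine-/ : ∀ {l r} .⦃ _ : NonZero r ⦄ (i : Fin l) (j : Fin r) → toℕ (combine i j) / r ≡ toℕ i
  combine-/ {l} {r} i j = begin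
    toℕ (combine i j) / r          ≡⟨ cong (_/ r) (trans (toℕ-combine i j) (cong (_+ toℕ j) (*-comm r (toℕ i)))) ⟩
    (toℕ i * r + toℕ j) / r        ≡⟨ +-distrib-/-∣ˡ (toℕ j) (n∣m*n (toℕ i)) ⟩
    toℕ i * r / r + toℕ j / r      ≡⟨ cong₂ _+_ (m*n/n≡m (toℕ i) r) (m<n⇒m/n≡0 (toℕ<n j)) ⟩
    toℕ i + 0                      ≡⟨ +-identityʳ (toℕ i) ⟩
    toℕ i                          ∎
    where open ≡-Reasoning

  -- Disjointness makes the owner of a vertex unique, so a search defines `φ`; `remQuot` recovers
  -- copy and position from an index, in agreement with division by r.
  lK-minor : ∀ {l r n} .⦃ _ : NonZero r ⦄ {G : Graph n} {P} → Model {Fin l × Fin r} SameCopy G P → IsMinor (lK l r) G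
  lK-minor {l} {r} {n} {G} M = record { φ = φ ; nonempty = nonempty ; connected = connected ; edges = edges }
    where
    split : Fin (l * r) → Fin l × Fin r
    split = remQuot r
    split-inj : ∀ a b → split a ≡ split b → a ≡ b
    split-inj a b e = trans (≡-sym (combine-remQuot {l} r a)) (trans (cong (λ x → combine (proj₁ x) (proj₂ x)) e) (combine-remQuot {l} r b))
    owner : ∀ w → Dec (∃[ a ] w ∈ br M (split a)) → Maybe (Fin (l * r))
    owner w (yes (a , _)) = just a
    owner w (no _) = nothing
    owned? : ∀ w → Dec (∃[ a ] w ∈ br M (split a))
    owned? w = any? (λ a → br M (split a) w ≟ᵇ true)
    φ : Fin n → Maybe (Fin (l * r))
    φ w = owner w (owned? w)
    φ⁺ : ∀ a w → w ∈ br M (split a) → φ w ≡ just a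
    φ⁺ a w p = go (owned? w)
      where
      go : ∀ d → owner w d ≡ just a
      go (yes (b , q)) = cong just (split-inj b a (disj M (split b) (split a) w q p))
      go (no ¬q) = ⊥-elim (¬q (a , p))
    φ⁻ : ∀ a w → φ w ≡ just a → w ∈ br M (split a)
    φ⁻ a w = go (owned? w)
      where
      go : ∀ d → owner w d ≡ just a → w ∈ br M (split a)
      go (yes (b , q)) e = subst (λ x → w ∈ br M (split x)) (just-injective e) q
    nonempty : ∀ a → ∃[ v ] (φ v ≡ just a)
    nonempty a = let v , v∈ , _ = conn M (split a) in v , φ⁺ a v v∈
    connected : ∀ a u v → φ u ≡ just a → φ v ≡ just a → WalkIn G (λ w → φ w ≡ just a) u v
    connected a u v pu pv = let s , _ , walks = conn M (split a) in
      walk-mono (φ⁺ a) (walk-trans (walk-sym (walks u (φ⁻ a u pu))) (walks v (φ⁻ a v pv)))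
    ≡ᵇ-true : ∀ a b → (a ≡ᵇ b) ≡ true → a ≡ b
    ≡ᵇ-true a b e = ≡ᵇ⇒≡ a b (subst T (≡-sym e) tt)
    quot : ∀ a → toℕ a / r ≡ toℕ (proj₁ (split a))
    quot a = trans (cong (λ x → toℕ x / r) (≡-sym (combine-remQuot {l} r a))) (combine-/ (proj₁ (split a)) (proj₂ (split a)))
    edges : ∀ a b → adj (lK l r) a b ≡ true → ∃[ u ] ∃[ v ] (φ u ≡ just a × φ v ≡ just b × adj G u v ≡ true)
    edges a b e with edge M (split a) (split b) (same , differ)
      where
      same : proj₁ (split a) ≡ proj₁ (split b)
      same = toℕ-injective (trans (≡-sym (quot a)) (trans (≡ᵇ-true _ _ (proj₂ (∧⁻ {not (toℕ a ≡ᵇ toℕ b)} e))) (quot b)))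
      differ : ¬ proj₂ (split a) ≡ proj₂ (split b)
      differ e′ = false≢true (not⁻ (proj₁ (∧⁻ {not (toℕ a ≡ᵇ toℕ b)} e)))
        (trans (cong (λ x → toℕ a ≡ᵇ toℕ x) (≡-sym (split-inj a b (cong₂ _,_ same e′)))) (≡ᵇ-self (toℕ a)))
        where
        ≡ᵇ-self : ∀ x → (x ≡ᵇ x) ≡ true
        ≡ᵇ-self zero = refl
        ≡ᵇ-self (suc x) = ≡ᵇ-self x
    ... | u , v , u∈ , v∈ , uv = u , v , φ⁺ a u u∈ , φ⁺ b v v∈ , uv

  /-toℚᵘ : ∀ i d .⦃ _ : NonZero d ⦄ → ℚ.toℚᵘ (i ℚ./ d) ℚᵘ.≃ i ℚᵘ./ d
  /-toℚᵘ i (suc d) = ℚ.toℚᵘ-fromℚᵘ (ℚᵘ.mkℚᵘ i d)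

  quotient-bound : ∀ e n s c x l .⦃ _ : NonZero n ⦄ .⦃ _ : NonZero l ⦄ → e * l ≤ (s * l + c * x) * n →
    (ℤ.+ e) ℚ./ n ℚ.≤ ((ℤ.+ s) ℚ./ 1) ℚ.+ ((ℤ.+ c) ℚ./ 1) ℚ.* ((ℤ.+ x) ℚ./ l)
  quotient-bound e n@(suc n′) s c x l@(suc l′) le = ℚ.toℚᵘ-cancel-≤ (begin
    ℚ.toℚᵘ ((ℤ.+ e) ℚ./ n)                                              ≃⟨ /-toℚᵘ (ℤ.+ e) n ⟩
    (ℤ.+ e) ℚᵘ./ n                                                      ≤⟨ ℚᵘ.*≤* (subst₂ ℤ._≤_ lhs rhs (ℤ.+≤+ le)) ⟩
    ((ℤ.+ s) ℚᵘ./ 1) ℚᵘ.+ ((ℤ.+ c) ℚᵘ./ 1) ℚᵘ.* ((ℤ.+ x) ℚᵘ./ l)        ≃⟨ ℚᵘ.≃-sym homo ⟩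
    ℚ.toℚᵘ (((ℤ.+ s) ℚ./ 1) ℚ.+ ((ℤ.+ c) ℚ./ 1) ℚ.* ((ℤ.+ x) ℚ./ l))    ∎)
    where
    open ℚᵘ.≤-Reasoning
    homo : ℚ.toℚᵘ (((ℤ.+ s) ℚ./ 1) ℚ.+ ((ℤ.+ c) ℚ./ 1) ℚ.* ((ℤ.+ x) ℚ./ l))
      ℚᵘ.≃ ((ℤ.+ s) ℚᵘ./ 1) ℚᵘ.+ ((ℤ.+ c) ℚᵘ./ 1) ℚᵘ.* ((ℤ.+ x) ℚᵘ./ l)
    homo = ℚᵘ.≃-trans (ℚ.toℚᵘ-homo-+ ((ℤ.+ s) ℚ./ 1) _) (ℚᵘ.+-cong (/-toℚᵘ (ℤ.+ s) 1)
      (ℚᵘ.≃-trans (ℚ.toℚᵘ-homo-* ((ℤ.+ c) ℚ./ 1) _) (ℚᵘ.*-cong (/-toℚᵘ (ℤ.+ c) 1) (/-toℚᵘ (ℤ.+ x) l))))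
    -- `suc (l′ + 0 + 0)` is what the denominator 1 * (1 * l) of the right-hand side computes to.
    lhs : ℤ.+ (e * l) ≡ ℤ.+ e ℤ.* ℤ.+ suc (l′ + 0 + 0)
    lhs = trans (ℤ.pos-* e l) (cong (λ z → ℤ.+ e ℤ.* ℤ.+ suc z) (≡-sym (trans (+-identityʳ (l′ + 0)) (+-identityʳ l′))))
    rhs : ℤ.+ ((s * l + c * x) * n) ≡ (ℤ.+ s ℤ.* ℤ.+ suc (l′ + 0) ℤ.+ ℤ.+ c ℤ.* ℤ.+ x ℤ.* ℤ.+ 1) ℤ.* ℤ.+ n
    rhs = trans (ℤ.pos-* (s * l + c * x) n) (cong (ℤ._* ℤ.+ n) (trans (ℤ.pos-+ (s * l) (c * x)) (cong₂ ℤ._+_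
      (trans (ℤ.pos-* s l) (cong (λ z → ℤ.+ s ℤ.* ℤ.+ suc z) (≡-sym (+-identityʳ l′))))
      (trans (ℤ.pos-* c x) (≡-sym (ℤ.*-identityʳ (ℤ.+ c ℤ.* ℤ.+ x)))))))

-- Choice of the constants and the final bound.

open import Defs
open import Data.Nat using (ℕ; _≥_; NonZero) renaming (_*_ to _*ℕ_)
open import Data.Nat.Logarithm using (⌊log₂_⌋)
open import Data.Integer using (+_)
open import Data.Rational using (ℚ; _/_; _≤_; Positive) renaming (_+_ to _+ℚ_; _*_ to _*ℚ_)
open import Data.Product using (Σ; _×_; ∃; ∃-syntax)
open import Relation.Nullary using (¬_)
open import Data.Bool using (true)
open import Data.Empty using (⊥-elim)
open import Data.Fin using (Fin; zero; suc; combine)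
open import Data.Fin.Properties using (combine-injective)
open import Data.Nat using (zero; suc; >-nonZero; >-nonZero⁻¹; z≤n; s≤s; _+_; _∸_; _^_; _<_) renaming (_≤_ to _≤ℕ_)
open import Data.Nat.Properties
import Data.Nat.DivMod as ℕ
open import Data.Nat.Logarithm using (⌊log₂⌋-mono-≤; ⌊log₂[2^n]⌋≡n)
open import Data.Nat.Tactic.RingSolver using (solve-∀)
open import Data.Product using (_,_; proj₁; proj₂)
import Data.Rational.Properties as ℚ
open import Data.Unit using (tt)
open import Relation.Binary.PropositionalEquality using (_≡_; refl; cong; cong₂; subst; trans) renaming (sym to ≡-sym)
open Counting
open Minors
open LocalStructure
open Density

-- (1 + 1/63)^64 exceeds e.
halving-64 : 2 *ℕ 63 ^ 64 ≤ℕ 64 ^ 64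
halving-64 = <⇒≤ (<ᵇ⇒< (2 *ℕ 63 ^ 64) (64 ^ 64) tt)

-- D = 256 comes from |V| ≤ 8 d ≤ 8 · 32 κ; c = 5 is the largest value with 2 c + 1 ≤ 11, the
-- minimum degree in V in units of κ; z + 1 = 64 is a power of two with 256 ≤ 5 · 64; h = 64 by
-- `halving-64`.
open Local 256 5 63 64 halving-64 (s≤s z≤n) ≤-refl (m≤m+n 256 64) ≤-refl ≤-refl using (groupCost′)
open Copies 256 5 63 64 halving-64 (s≤s z≤n) ≤-refl (m≤m+n 256 64) ≤-refl ≤-refl

opaque
  -- 1280 · 130 · 514 = 85529600 is required of `scale`, and 2^27 is the next power of two.
  -- `constant` is the coefficient in the product bound of `Sizes`.
  scale constant : ℕ
  scale = 2 ^ 27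
  constant = 19 *ℕ (200 *ℕ (scale *ℕ scale))

  scale≥1 : 1 ≤ℕ scale
  scale≥1 = m^n>0 2 27

  groupCost≤scale : 1280 *ℕ groupCost′ ≤ℕ scale
  groupCost≤scale = <⇒≤ (<ᵇ⇒< (1280 *ℕ groupCost′) (2 ^ 27) tt)

  constant-def : constant ≡ 19 *ℕ (200 *ℕ (scale *ℕ scale))
  constant-def = refl

  constant-nonZero : NonZero constant
  constant-nonZero = m*n≢0 19 (200 *ℕ (scale *ℕ scale)) ⦃ _ ⦄
    ⦃ m*n≢0 200 (scale *ℕ scale) ⦃ _ ⦄ ⦃ m*n≢0 scale scale ⦃ >-nonZero scale≥1 ⦄ ⦃ >-nonZero scale≥1 ⦄ ⦄ ⦄

opaque
  copies : ∀ {l lam} r′ → 1 ≤ℕ l → 1 ≤ℕ lam → suc r′ < 2 ^ suc lam → .⦃ _ : NonZero l ⦄ →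
    ∀ {n} {H : Graph n} {S : Sub n} β (v : Fin l → Fin n) (J : Fin l → Sub n) →
    l *ℕ suc r′ + constant *ℕ (suc r′ *ℕ lam) ℕ./ l ≤ℕ suc β →
    Clique H S → (∀ i → Piece H S β (v i) (J i)) → (∀ i j w → w ∈ J i ∪ ｛ v i ｝ → w ∈ J j ∪ ｛ v j ｝ → i ≡ j) →
    Model {Fin l × Fin (suc r′)} SameCopy H (⋃ (λ i → J i ∪ ｛ v i ｝) ∪ S)
  copies r′ l≥1 λ≥1 r< β v J = local-model r′ constant-def scale≥1 groupCost≤scale l≥1 λ≥1 r< β v J

module _ (l r′ : ℕ) .⦃ _ : NonZero l ⦄ where

  private
    r lam : ℕ
    r = suc (suc r′)
    lam = ⌊log₂ r ⌋

    l≥1 : 1 ≤ℕ l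
    l≥1 = >-nonZero⁻¹ l

    λ≥1 : 1 ≤ℕ lam
    λ≥1 = ≤-trans (≤-reflexive (≡-sym (⌊log₂[2^n]⌋≡n 1))) (⌊log₂⌋-mono-≤ {2} {r} (s≤s (s≤s z≤n)))

    r<2^ : r < 2 ^ suc lam
    r<2^ = ≰⇒> (λ le → <-irrefl refl (≤-trans (≤-reflexive (≡-sym (⌊log₂[2^n]⌋≡n (suc lam)))) (⌊log₂⌋-mono-≤ le)))

  threshold : ℕ
  threshold = l *ℕ r + constant *ℕ (r *ℕ lam) ℕ./ l

  private
    threshold≥1 : 1 ≤ℕ threshold
    threshold≥1 = ≤-trans (*-mono-≤ l≥1 (s≤s z≤n)) (m≤m+n (l *ℕ r) _)

    threshold-pred : suc (threshold ∸ 1) ≡ threshold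
    threshold-pred = m+[n∸m]≡n threshold≥1

  dense-above-threshold : ∃[ N ] Dense {Fin l × Fin r} SameCopy threshold N
  dense-above-threshold = subst (λ γ → ∃[ N ] Dense {Fin l × Fin r} SameCopy γ N) threshold-pred
    -- The descent ends at β = `threshold` - 1, since β common neighbours correspond to density β +
    -- 1.
    (dense-enough {R = SameCopy {l} {r}} (maderDensity (l *ℕ r)) l l≥1 base (threshold ∸ 1)
      (λ β β≥ v J → copies (suc r′) l≥1 λ≥1 r<2^ β v J (≤-trans (≤-reflexive (≡-sym threshold-pred)) (s≤s β≥))))
    where
    base : ∀ {n} (H : Graph n) Q → 1 ≤ℕ # Q → 2 *ℕ maderDensity (l *ℕ r) *ℕ # Q ≤ℕ e₂ H Q → Model {Fin l × Fin r} SameCopy H Q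
    base H Q ne e≥ = reindex (λ a → combine (proj₁ a) (proj₂ a)) inj
      (λ a b same eq → proj₂ same (proj₂ (combine-injective (proj₁ a) (proj₂ a) (proj₁ b) (proj₂ b) eq)))
      (mader (l *ℕ r) H Q ne e≥)
      where
      inj : ∀ (a b : Fin l × Fin r) → combine (proj₁ a) (proj₂ a) ≡ combine (proj₁ b) (proj₂ b) → a ≡ b
      inj a b eq with combine-injective (proj₁ a) (proj₂ a) (proj₁ b) (proj₂ b) eq
      ... | p , q = cong₂ _,_ p q

  below-threshold : ∀ n e .⦃ _ : NonZero n ⦄ → e ≤ℕ threshold *ℕ n →
    (+ e) / n ≤ ((+ (l *ℕ r)) / 1) +ℚ (((+ constant) / 1) *ℚ ((+ (r *ℕ lam)) / l))
  below-threshold n e e≤ = quotient-bound e n (l *ℕ r) constant (r *ℕ lam) l (begin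
    e *ℕ l                                                       ≤⟨ *-monoˡ-≤ l e≤ ⟩
    threshold *ℕ n *ℕ l                                          ≡⟨ arith (l *ℕ r) x n l ⟩
    (l *ℕ r *ℕ l + x *ℕ l) *ℕ n                                  ≤⟨ *-monoˡ-≤ n (+-monoʳ-≤ (l *ℕ r *ℕ l) (ℕ.m/n*n≤m (constant *ℕ (r *ℕ lam)) l)) ⟩
    (l *ℕ r *ℕ l + constant *ℕ (r *ℕ lam)) *ℕ n                  ∎)
    where
    open ≤-Reasoning
    x = constant *ℕ (r *ℕ lam) ℕ./ l
    opaque
      arith : ∀ a x n l → (a + x) *ℕ n *ℕ l ≡ (a *ℕ l + x *ℕ l) *ℕ n
      arith = solve-∀

lK₁-minor : ∀ l {n} (G : Graph n) → l ≤ℕ n → IsMinor (lK l 1) G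
lK₁-minor l {n} G l≤n with choose l (λ _ → true) (≤-trans l≤n (≤-reflexive (≡-sym (#-full n))))
... | e , _ , e-inj = lK-minor {P = λ _ → true} (record
  { br = λ a → ｛ e (proj₁ a) ｝ ; inside = λ _ _ _ → refl ; conn = λ a → Conn-single G (e (proj₁ a))
  ; disj = λ { (i , zero) (j , zero) w p q → cong (_, zero) (e-inj i j (trans (∈｛｝⁻ p) (≡-sym (∈｛｝⁻ q)))) }
  ; edge = λ { (i , zero) (j , zero) (_ , ne) → ⊥-elim (ne refl) } })

p≤q⇒p≤q+ε : ∀ {p q} ε → Positive ε → p ≤ q → p ≤ q +ℚ ε
p≤q⇒p≤q+ε {p} {q} ε ε>0 p≤q = ℚ.≤-trans p≤q (ℚ.≤-trans (ℚ.≤-reflexive (≡-sym (ℚ.+-identityʳ q)))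
  (ℚ.+-monoʳ-≤ q (ℚ.<⇒≤ (ℚ.positive⁻¹ ε ⦃ ε>0 ⦄))))

edge-bound : ∀ l r′ .⦃ _ : NonZero l ⦄ → ∃[ N ] (∀ n .⦃ _ : NonZero n ⦄ → n ≥ N → ∀ (G : Graph n) → ¬ IsMinor (lK l (suc (suc r′))) G →
  edgeCount G ≤ℕ threshold l r′ *ℕ n)
edge-bound l r′ = proj₁ (dense-above-threshold l r′) , λ n n≥N G no-minor → <⇒≤ (≰⇒> (λ dense → no-minor (lK-minor
  (proj₂ (dense-above-threshold l r′) G (λ _ → true) (≤-trans n≥N (≤-reflexive (≡-sym (#-full n))))
    (≤-trans (≤-reflexive (trans (cong (2 *ℕ threshold l r′ *ℕ_) (#-full n)) (*-assoc 2 (threshold l r′) n)))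
      (≤-trans (*-monoʳ-≤ 2 dense) (edgeCount≤e₂ G)))))))

constant-positive : Positive ((+ constant) / 1)
constant-positive = ℚ.normalize-pos constant 1 ⦃ _ ⦄ ⦃ constant-nonZero ⦄

density-bound : ∀ (l r : ℕ) .⦃ _ : NonZero l ⦄ .⦃ _ : NonZero r ⦄ → ∃[ N ] (∀ (n : ℕ) .⦃ _ : NonZero n ⦄ → n ≥ N → ∀ (G : Graph n) →
  ¬ IsMinor (lK l r) G → (+ edgeCount G) / n ≤ ((+ (l *ℕ r)) / 1) +ℚ (((+ constant) / 1) *ℚ ((+ (r *ℕ ⌊log₂ r ⌋)) / l)))
density-bound l zero = ⊥-elim (<-irrefl refl (>-nonZero⁻¹ 0))
density-bound l (suc zero) = l , λ n n≥l G no-minor → ⊥-elim (no-minor (lK₁-minor l G n≥l))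
density-bound l (suc (suc r′)) = let N , few = edge-bound l r′ in
  N , λ n n≥N G no-minor → below-threshold l r′ n (edgeCount G) (few n n≥N G no-minor)

-- ε and N express an upper bound on the limit. Since ⌊log₂ r⌋ ≤ log r / log 2, a bound with C here
-- is one with C / log 2 for the natural logarithm.
theorem1p9 : ∃[ C ] (Positive C × (∀ (l r : ℕ) .{{_ : NonZero l}} .{{_ : NonZero r}} → ∀ (ε : ℚ) → Positive ε → ∃[ N ] (∀ (n : ℕ) .{{_ : NonZero n}} → n ≥ N → ∀ (G : Graph n) → ¬ IsMinor (lK l r) G → ((+ edgeCount G) / n) ≤ ((((+ (l *ℕ r)) / 1) +ℚ (C *ℚ ((+ (r *ℕ ⌊log₂ r ⌋)) / l))) +ℚ ε))))
theorem1p9 = (+ constant) / 1 , constant-positive , λ l r ε ε>0 → let N , bound = density-bound l r in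
  N , λ n n≥N G no-minor → p≤q⇒p≤q+ε ε ε>0 (bound n n≥N G no-minor)
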